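{- Let $\Gamma$ be a connected unbalanced unicyclic signed graph (with at least one edge) whose Laplacian eigenvalues are $\mu_1\ge\mu_2\ge\cdots\ge\mu_n>0$. Then $S(\Gamma)\times K_2$ and $S(\Gamma)\otimes K_2$ are noncospectral and equienergetic if and only if $\mu_n\ge 1$.
   Context: A signed graph $\Gamma=(G,\sigma)$ is a simple graph $G$ with a sign function $\sigma:E(G)\to\{1,-1\}$; $A(\Gamma)$ has $(i,j)$ entry $\sigma(v_iv_j)$ if $v_iv_j\in E(G)$ and $0$ otherwise, and $L(\Gamma)=D(G)-A(\Gamma)$ with $D(G)$ the diagonal degree matrix. Unbalanced means some cycle has an odd number of negative edges; unicyclic means $G$ is connected with exactly one cycle. The energy $\mathcal{E}(\Gamma)$ is the sum of absolute values of the adjacency eigenvalues; two signed graphs are equienergetic if they have equal energy, and noncospectral if their adjacency spectra differ. Signed subdivision graph $S(\Gamma)$: fix $\vartheta(v,e)\in\{1,-1\}$ for each vertex $v$ incident with edge $e$, with $\vartheta(v,e)\vartheta(w,e)=-\sigma(e)$ for every edge $e=vw$; $S(\Gamma)$ has vertex set $V(G)\cup E(G)$ and an edge $ve$ of sign $\vartheta(v,e)$ whenever $v$ is an end of $e$, and no other edges. $K_2$ denotes the single positive edge. For signed graphs $\Gamma_1=(G_1,\sigma_1)$, $\Gamma_2=(G_2,\sigma_2)$: the Cartesian product $\Gamma_1\times\Gamma_2$ has vertex set $V(G_1)\times V(G_2)$, with $(u_i,v_j)\sim(u_k,v_l)$ of sign $\sigma_1(u_iu_k)$ if $j=l$ and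 $u_iu_k\in E(G_1)$, and of sign $\sigma_2(v_jv_l)$ if $i=k$ and $v_jv_l\in E(G_2)$. The Kronecker product $\Gamma_1\otimes\Gamma_2$ has vertex set $V(G_1)\times V(G_2)$, with $(u_i,v_j)\sim(u_k,v_l)$ iff $u_iu_k\in E(G_1)$ and $v_jv_l\in E(G_2)$, of sign $\sigma_1(u_iu_k)\sigma_2(v_jv_l)$. -}

module Defs where

open import Level using (Level; _⊔_; 0ℓ) renaming (suc to lsuc)
open import Algebra.Apartness.Bundles using (HeytingField; HeytingCommutativeRing)
open import Algebra.Bundles using (CommutativeRing)
import Algebra.Definitions.RawMonoid as RawMonoidDefs
open import Data.Bool.Base using (Bool; T; if_then_else_; _∨_)
open import Data.Bool.Properties using (T?)
open import Data.Fin.Base using (Fin; zero; suc; toℕ; punchIn; splitAt; remQuot)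
import Data.Fin.Base as Fin
import Data.Fin.Properties as Fin
open import Data.List.Base using (List; length; lookup; filter; cartesianProduct)
import Data.List.Base as List
open import Data.Maybe.Base using (Maybe; just; nothing; is-just; zipWith)
import Data.Maybe.Base as Maybe
import Data.Maybe.Properties as Maybe
open import Data.Nat.Base using (ℕ; zero; suc; parity)
import Data.Nat.Base as ℕ
open import Data.Nat.DivMod using (_mod_)
open import Data.Parity.Base using (1ℙ)
open import Data.Product.Base using (Σ; _×_; _,_; proj₁; proj₂; ∃; ∃-syntax)
open import Data.Sign.Base using (Sign)
import Data.Sign.Base as Sign
import Data.Sign.Properties as Sign
open import Data.Sum.Base using (_⊎_; inj₁; inj₂)
open import Data.Vec.Base using (count; allFin)
open import Data.Vec.Functional using (Vector)
open import Function.Bundles using (_⇔_)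
open import Relation.Binary.Construct.Closure.ReflexiveTransitive using (Star)
open import Relation.Binary.Core using (Rel)
open import Relation.Binary.Lattice.Definitions using (Supremum)
open import Relation.Binary.PropositionalEquality
  using (_≡_; refl; sym; cong; cong₂)
open import Relation.Binary.Structures using (IsStrictPartialOrder)
open import Relation.Nullary using (¬_; yes; no)
open import Relation.Nullary.Decidable using (⌊_⌋; _×-dec_)
open import Relation.Nullary.Negation using (contradiction)

-- The Cauchy-complete Archimedean ordered fields. Classically ℝ is the
-- only one up to isomorphism. The axioms are in constructive form (weak
-- order instead of trichotomy, inverses only for elements apart from 0),
-- so that they also hold for Bishop's Cauchy reals.

record RealNumbers (c ℓ₁ ℓ₂ : Level) : Set (lsuc (c ⊔ ℓ₁ ⊔ ℓ₂)) where
  infix 4 _<_ _≤_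
  infixl 6 _∨ʳ_
  field
    heytingField : HeytingField c ℓ₁ ℓ₂

  open HeytingField heytingField public
  open HeytingCommutativeRing heytingCommutativeRing public
    using (commutativeRing)
  open CommutativeRing commutativeRing public
    using (+-rawMonoid; *-rawMonoid)
  open RawMonoidDefs +-rawMonoid public
    using (sum) renaming (_×_ to _·_)
  open RawMonoidDefs *-rawMonoid public
    using () renaming (sum to product)

  field
    _<_                    : Rel Carrier ℓ₂
    <-isStrictPartialOrder : IsStrictPartialOrder _≈_ _<_
    #⇔<⊎>                  : ∀ x y → x # y ⇔ (x < y ⊎ y < x)
    +-monoˡ-<              : ∀ z {x y} → x < y → x + z < y + z
    *-pos                  : ∀ {x y} → 0# < x → 0# < y → 0# < x * y

  _≤_ : Rel Carrier ℓ₂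
  x ≤ y = ¬ (y < x)

  field
    _∨ʳ_        : Carrier → Carrier → Carrier
    ∨ʳ-supremum : Supremum _≤_ _∨ʳ_

  ∣_∣ : Carrier → Carrier
  ∣ x ∣ = x ∨ʳ (- x)

  IsCauchy : (ℕ → Carrier) → Set (c ⊔ ℓ₂)
  IsCauchy s = ∀ ε → 0# < ε → ∃[ N ] ∀ m n → N ℕ.≤ m → N ℕ.≤ n →
    ∣ s m - s n ∣ < ε

  _ConvergesTo_ : (ℕ → Carrier) → Carrier → Set (c ⊔ ℓ₂)
  s ConvergesTo x = ∀ ε → 0# < ε → ∃[ N ] ∀ n → N ℕ.≤ n →
    ∣ s n - x ∣ < ε

  field
    archimedean : ∀ x → ∃[ n ] x < n · 1#
    complete    : ∀ s → IsCauchy s → ∃[ x ] s ConvergesTo x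

-- label i j is nothing if i and j are not adjacent, and just σ(ij) if
-- they are.

record SignedGraph (n : ℕ) : Set where
  field
    label        : Fin n → Fin n → Maybe Sign
    label-sym    : ∀ i j → label i j ≡ label j i
    label-irrefl : ∀ i → label i i ≡ nothing

  adjacent? : Fin n → Fin n → Bool
  adjacent? i j = is-just (label i j)

  Adjacent : Rel (Fin n) 0ℓ
  Adjacent i j = T (adjacent? i j)

  degree : Fin n → ℕ
  degree i = count (λ j → T? (adjacent? i j)) (allFin n)

  edges : List (Fin n × Fin n)
  edges = filter
    (λ (i , j) → (i Fin.<? j) ×-dec T? (adjacent? i j))
    (cartesianProduct (List.allFin n) (List.allFin n))

  size : ℕ
  size = length edges

  source target : Fin size → Fin n
  source e = proj₁ (lookup edges e)
  target e = proj₂ (lookup edges e)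

open SignedGraph

private
  variable
    m n : ℕ

next : Fin (suc n) → Fin (suc n)
next {n} i = suc (toℕ i) mod suc n

record Cycle (Γ : SignedGraph n) : Set where
  field
    length-3  : ℕ
    vertex    : Fin (3 ℕ.+ length-3) → Fin n
    injective : ∀ {i j} → vertex i ≡ vertex j → i ≡ j
    closed    : ∀ i → Adjacent Γ (vertex i) (vertex (next i))

  HasEdge : Fin n → Fin n → Set
  HasEdge u v = ∃[ i ]
    ( (vertex i ≡ u × vertex (next i) ≡ v)
    ⊎ (vertex i ≡ v × vertex (next i) ≡ u))

  negativeEdges : ℕ
  negativeEdges = count
    (λ i → Maybe.≡-dec Sign._≟_ (label Γ (vertex i) (vertex (next i)))
                                (just Sign.-))
    (allFin (3 ℕ.+ length-3))

open Cycle

Connected : SignedGraph n → Set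
Connected Γ = ∀ u v → Star (Adjacent Γ) u v

-- Vertex sequences differing by rotation or reflection are the same cycle,
-- so cycles are compared by their edge sets.
Unicyclic : SignedGraph n → Set
Unicyclic Γ = Connected Γ ×
  (Σ (Cycle Γ) λ C → ∀ (C′ : Cycle Γ) u v → HasEdge C′ u v ⇔ HasEdge C u v)

Unbalanced : SignedGraph n → Set
Unbalanced Γ = Σ (Cycle Γ) λ C → parity (negativeEdges C) ≡ 1ℙ

K₂ : SignedGraph 2
K₂ = record
  { label        = λ where
      zero       zero       → nothing
      zero       (suc zero) → just Sign.+
      (suc zero) zero       → just Sign.+
      (suc zero) (suc zero) → nothing
  ; label-sym    = λ where
      zero       zero       → refl
      zero       (suc zero) → refl
      (suc zero) zero       → refl
      (suc zero) (suc zero) → refl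
  ; label-irrefl = λ where
      zero       → refl
      (suc zero) → refl
  }

-- The values of ϑ at non-incident pairs are irrelevant.
Signature : SignedGraph n → Set
Signature {n} Γ = Fin n → Fin (size Γ) → Sign

-- ϑ(v,e) ϑ(w,e) = - σ(e) for every edge e = vw
Compatible : (Γ : SignedGraph n) → Signature Γ → Set
Compatible Γ ϑ = ∀ e →
  just (ϑ (source Γ e) e Sign.* ϑ (target Γ e) e)
    ≡ Maybe.map Sign.opposite (label Γ (source Γ e) (target Γ e))

module _ (Γ : SignedGraph n) (ϑ : Signature Γ) where

  incidence : Fin n → Fin (size Γ) → Maybe Sign
  incidence v e = if ⌊ v Fin.≟ source Γ e ⌋ ∨ ⌊ v Fin.≟ target Γ e ⌋
    then just (ϑ v e) else nothing

  subdivisionLabel : (x y : Fin n ⊎ Fin (size Γ)) → Maybe Sign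
  subdivisionLabel (inj₁ v) (inj₂ e) = incidence v e
  subdivisionLabel (inj₂ e) (inj₁ v) = incidence v e
  subdivisionLabel (inj₁ _) (inj₁ _) = nothing
  subdivisionLabel (inj₂ _) (inj₂ _) = nothing

  subdivisionLabel-sym : ∀ x y → subdivisionLabel x y ≡ subdivisionLabel y x
  subdivisionLabel-sym (inj₁ _) (inj₁ _) = refl
  subdivisionLabel-sym (inj₁ _) (inj₂ _) = refl
  subdivisionLabel-sym (inj₂ _) (inj₁ _) = refl
  subdivisionLabel-sym (inj₂ _) (inj₂ _) = refl

  subdivisionLabel-irrefl : ∀ x → subdivisionLabel x x ≡ nothing
  subdivisionLabel-irrefl (inj₁ _) = refl
  subdivisionLabel-irrefl (inj₂ _) = refl

  -- V(G) ∪ E(G) is identified with Fin (n + size Γ), vertices first.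
  subdivision : SignedGraph (n ℕ.+ size Γ)
  subdivision = record
    { label        = λ x y → subdivisionLabel (splitAt n x) (splitAt n y)
    ; label-sym    = λ x y → subdivisionLabel-sym (splitAt n x) (splitAt n y)
    ; label-irrefl = λ x → subdivisionLabel-irrefl (splitAt n x)
    }

-- In both products V(G₁) × V(G₂) is identified with Fin (m * n) by remQuot.
module _ (Γ₁ : SignedGraph m) (Γ₂ : SignedGraph n) where

  cartesianLabel : (x y : Fin m × Fin n) → Maybe Sign
  cartesianLabel (i , j) (k , l) with j Fin.≟ l | i Fin.≟ k
  ... | yes _ | _     = label Γ₁ i k
  ... | no _  | yes _ = label Γ₂ j l
  ... | no _  | no _  = nothing

  cartesianLabel-sym : ∀ x y → cartesianLabel x y ≡ cartesianLabel y x
  cartesianLabel-sym (i , j) (k , l)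
    with j Fin.≟ l | i Fin.≟ k | l Fin.≟ j | k Fin.≟ i
  ... | yes _ | _     | yes _ | _     = label-sym Γ₁ i k
  ... | yes p | _     | no ¬p | _     = contradiction (sym p) ¬p
  ... | no ¬p | _     | yes p | _     = contradiction (sym p) ¬p
  ... | no _  | yes _ | no _  | yes _ = label-sym Γ₂ j l
  ... | no _  | yes p | no _  | no ¬p = contradiction (sym p) ¬p
  ... | no _  | no ¬p | no _  | yes p = contradiction (sym p) ¬p
  ... | no _  | no _  | no _  | no _  = refl

  cartesianLabel-irrefl : ∀ x → cartesianLabel x x ≡ nothing
  cartesianLabel-irrefl (i , j) with j Fin.≟ j | i Fin.≟ i
  ... | yes _ | _     = label-irrefl Γ₁ i
  ... | no _  | yes _ = label-irrefl Γ₂ j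
  ... | no _  | no _  = refl

  kroneckerLabel : (x y : Fin m × Fin n) → Maybe Sign
  kroneckerLabel (i , j) (k , l) = zipWith Sign._*_ (label Γ₁ i k) (label Γ₂ j l)

  infixl 7 _×ˢ_ _⊗_

  _×ˢ_ : SignedGraph (m ℕ.* n)
  _×ˢ_ = record
    { label        = λ x y → cartesianLabel (remQuot n x) (remQuot n y)
    ; label-sym    = λ x y → cartesianLabel-sym (remQuot n x) (remQuot n y)
    ; label-irrefl = λ x → cartesianLabel-irrefl (remQuot {m} n x)
    }

  _⊗_ : SignedGraph (m ℕ.* n)
  _⊗_ = record
    { label        = λ x y → kroneckerLabel (remQuot n x) (remQuot n y)
    ; label-sym    = λ x y →
        let (i , j) = remQuot n x ; (k , l) = remQuot n y in
        cong₂ (zipWith Sign._*_) (label-sym Γ₁ i k) (label-sym Γ₂ j l)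
    ; label-irrefl = λ x →
        let (i , j) = remQuot {m} n x in
        cong (λ a → zipWith Sign._*_ a (label Γ₂ j j)) (label-irrefl Γ₁ i)
    }

module Spectral {c ℓ₁ ℓ₂ : Level} (ℝ : RealNumbers c ℓ₁ ℓ₂) where

  open RealNumbers ℝ using
    (Carrier; _≈_; _+_; _*_; -_; _-_; 0#; 1#; _·_; ∣_∣; sum; product)

  Matrix : ℕ → Set c
  Matrix n = Fin n → Fin n → Carrier

  infixr 8 -1^_
  -1^_ : ℕ → Carrier
  -1^ zero    = 1#
  -1^ (suc k) = - (-1^ k)

  -- Laplace expansion along the first row
  det : Matrix n → Carrier
  det {zero}  M = 1#
  det {suc n} M = sum λ j →
    -1^ (toℕ j) * M zero j * det (λ i k → M (suc i) (punchIn j k))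

  diagonal : Vector Carrier n → Matrix n
  diagonal d i j = if ⌊ i Fin.≟ j ⌋ then d i else 0#

  infixl 6 _-ᴹ_
  _-ᴹ_ : Matrix n → Matrix n → Matrix n
  (M -ᴹ N) i j = M i j - N i j

  charPoly : Matrix n → Carrier → Carrier
  charPoly M x = det (diagonal (λ _ → x) -ᴹ M)

  -- λs lists the eigenvalues of M with multiplicity.
  IsSpectrum : Matrix n → Vector Carrier n → Set (c ⊔ ℓ₁)
  IsSpectrum M λs = ∀ x → charPoly M x ≈ product (λ i → x - λs i)

  fromLabel : Maybe Sign → Carrier
  fromLabel nothing       = 0#
  fromLabel (just Sign.+) = 1#
  fromLabel (just Sign.-) = - 1#

  adjacency : SignedGraph n → Matrix n
  adjacency Γ i j = fromLabel (label Γ i j)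

  laplacian : SignedGraph n → Matrix n
  laplacian Γ = diagonal (λ i → degree Γ i · 1#) -ᴹ adjacency Γ

  -- Two multisets are equal when some λs enumerates both of them.
  Cospectral : SignedGraph n → SignedGraph n → Set (c ⊔ ℓ₁)
  Cospectral Γ₁ Γ₂ = ∃[ λs ]
    IsSpectrum (adjacency Γ₁) λs × IsSpectrum (adjacency Γ₂) λs

  Noncospectral : SignedGraph n → SignedGraph n → Set (c ⊔ ℓ₁)
  Noncospectral Γ₁ Γ₂ = ¬ Cospectral Γ₁ Γ₂

  -- Energy as a relation: E is the energy of Γ. It is functional because
  -- the roots of charPoly are determined up to order.
  IsEnergy : SignedGraph n → Carrier → Set (c ⊔ ℓ₁)
  IsEnergy Γ E = ∃[ λs ]
    IsSpectrum (adjacency Γ) λs × E ≈ sum (λ i → ∣ λs i ∣)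

  Equienergetic : SignedGraph m → SignedGraph n → Set (c ⊔ ℓ₁)
  Equienergetic Γ₁ Γ₂ = ∃[ E ] IsEnergy Γ₁ E × IsEnergy Γ₂ E

{-# OPTIONS --safe #-}
module Submission where

{-
Let B be the signed vertex-edge incidence matrix read off from ϑ. Then
L(Γ) = B Bᵀ and S(Γ) has adjacency matrix [[0, B], [Bᵀ, 0]], so a Schur
complement gives yⁿ det(yI - A(S(Γ))) = yᵐ det(y²I - L(Γ)) for n vertices
and m edges. Removing an edge of the cycle leaves a forest, whence m ≤ n,
and m < n would force det L(Γ) = 0; so m = n and S(Γ) has the spectrum
±√μᵢ. A matrix [[P, Q], [Q, P]] has determinant det(P + Q) det(P - Q), which
turns this into the spectra ±√μᵢ ± 1 of S(Γ) × K₂ and ±√μᵢ (twice) of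
S(Γ) ⊗ K₂. The largest eigenvalues √μ₁ + 1 and √μ₁ differ. The energies are
Σ 4 max(√μᵢ, 1) and Σ 4 √μᵢ, which agree exactly when all μᵢ ≥ 1.

Determinants are handled through the uniqueness of alternating multilinear
functions of the columns, and polynomial identities in y are checked for
y > 0 only, where y can be cancelled.
-}

-- `RealNumbers` has neither decidable equality nor trichotomy, and this shapes much of the proof.
-- `≤` is the negation of `<`, and tightness makes `≈` stable under double negation, so an equality
-- may be proved by contradiction where no case can be decided. That is how the energy becomes well
-- defined: `Equienergetic` offers arbitrary lists of eigenvalues, and two lists with the same
-- product of linear factors are matched without deciding which entries coincide. Inverses exist
-- only for elements apart from 0, which cannot be tested; points above a bound can always be
-- cancelled, and a polynomial that vanishes on a half-line vanishes everywhere. For μₙ < 1 the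
-- other √μᵢ are not compared with 1 either: every absolute value is bounded below by its argument
-- with a suitable sign. As `det` is an expansion along the first row, the product rule and the
-- block formulas have to be derived, and one uniqueness statement is the source of them all.

open import Defs
open import Level using (Level; _⊔_)
open import Algebra.Bundles using (CommutativeMonoid; CommutativeRing)
import Algebra.Properties.AbelianGroup as AbelianGroupProperties
import Algebra.Properties.CommutativeMonoid.Sum as MonoidSum
import Algebra.Properties.Ring as RingProperties
import Algebra.Properties.Semiring.Mult.TCOptimised as Mult
import Algebra.Properties.Semiring.Sum as SemiringSum
import Algebra.Solver.Ring as RingSolver
open import Algebra.Solver.Ring.AlmostCommutativeRing using (fromCommutativeRing; _-Raw-AlmostCommutative⟶_)
open import Data.Bool.Base using (Bool; true; false; T; not; _∧_; if_then_else_)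
open import Data.Bool.Properties using (T?; T-∧; ∧-comm)
open import Data.Empty using (⊥; ⊥-elim)
open import Data.Fin.Base as Fin
  using (Fin; zero; suc; toℕ; fromℕ; inject₁; punchIn; punchOut; splitAt; join; remQuot; combine)
open import Data.Fin.Permutation using (↔⇒≡)
open import Data.Fin.Permutation.Components using (transpose)
import Data.Fin.Properties as Fin
import Data.Integer.Base as ℤ
import Data.Integer.Properties as ℤ
open import Data.List.Base as List using (List; []; _∷_; filter; cartesianProduct)
open import Data.List.Membership.Propositional.Properties using (∈-lookup; ∈-filter⁻)
open import Data.Maybe.Base as Maybe using (Maybe; just; nothing)
open import Data.Nat.Base as ℕ using (ℕ; zero; suc)
open import Data.Nat.DivMod using (m<n⇒m%n≡m; n%n≡0)
open import Data.Nat.Induction using (<-wellFounded)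
import Data.Nat.Properties as ℕ
open import Data.Nat.Solver using (module +-*-Solver)
open import Data.Product.Base using (∃; _×_; _,_; proj₁; proj₂)
open import Data.Sign.Base as Sign using (Sign)
open import Data.Sum.Algebra using (⊎-comm)
open import Data.Sum.Base as Sum using (_⊎_; inj₁; inj₂)
open import Data.Vec.Base as Vec using (Vec; []; _∷_; count)
open import Data.Vec.Functional using (Vector; removeAt; updateAt; _++_)
open import Data.Vec.Functional.Properties using (updateAt-updates; updateAt-minimal)
open import Function.Base using (_∘_; id)
open import Function.Bundles using (_⇔_; mk⇔; Equivalence; _↔_; mk↔ₛ′; Inverse)
open import Function.Construct.Composition using (_↔-∘_)
open import Function.Construct.Symmetry using (↔-sym)
open import Induction.WellFounded using (Acc; acc)
open import Relation.Binary.Definitions using (WeaklyDecidable; tri<; tri≈; tri>)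
open import Relation.Binary.PropositionalEquality as ≡ using (_≡_; _≢_)
import Relation.Binary.Reasoning.Setoid as SetoidReasoning
open import Relation.Binary.Structures using (IsStrictPartialOrder)
open import Relation.Nullary using (¬_; Dec; yes; no)
open import Relation.Nullary.Decidable using (⌊_⌋; does; _×-dec_; ¬?; dec⇒maybe)
open import Relation.Unary using (Pred; Decidable)

-- The library's ring solver needs a decidable coefficient ring to cancel
-- terms, so ℤ is used in place of the carrier.
module IntegerSolver {c ℓ} (R : CommutativeRing c ℓ) where

  open import Data.Integer.Base using (ℤ; +_; -[1+_]; _⊖_)
  open CommutativeRing R hiding (zero)
  open RingProperties ring
  open AbelianGroupProperties +-abelianGroup using (⁻¹-∙-comm)
  open Mult semiring using (×1-homo-*; ×-homo-+; 1+×) renaming (_×_ to _×′_)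
  open SetoidReasoning setoid

  -- With these optimised multiples the images of 0 and 1 reduce to `0#` and `1#`, so `:0` and `:1`
  -- match goals literally and the unit laws of the morphism are `refl`.
  fromℤ : ℤ → Carrier
  fromℤ (+ n)    = n ×′ 1#
  fromℤ -[1+ n ] = - (suc n ×′ 1#)

  fromℤ-neg : ∀ i → fromℤ (ℤ.- i) ≈ - fromℤ i
  fromℤ-neg (+ zero)  = sym -0#≈0#
  fromℤ-neg (+ suc n) = refl
  fromℤ-neg -[1+ n ]  = sym (-‿involutive _)

  fromℤ-⊖ : ∀ m n → fromℤ (m ⊖ n) ≈ m ×′ 1# - n ×′ 1#
  fromℤ-⊖ m       zero    = sym (trans (+-congˡ -0#≈0#) (+-identityʳ _))
  fromℤ-⊖ zero    (suc n) = sym (+-identityˡ _)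
  fromℤ-⊖ (suc m) (suc n) = begin
    fromℤ (suc m ⊖ suc n)                   ≡⟨ ≡.cong fromℤ (ℤ.[1+m]⊖[1+n]≡m⊖n m n) ⟩
    fromℤ (m ⊖ n)                           ≈⟨ fromℤ-⊖ m n ⟩
    m′ - n′                                 ≈⟨ +-congʳ (+-identityʳ m′) ⟨
    (m′ + 0#) - n′                          ≈⟨ +-congʳ (+-congˡ (-‿inverseʳ 1#)) ⟨
    (m′ + (1# - 1#)) - n′                   ≈⟨ +-congʳ (+-assoc m′ 1# (- 1#)) ⟨
    ((m′ + 1#) - 1#) - n′                   ≈⟨ +-assoc _ _ _ ⟩
    (m′ + 1#) + (- 1# - n′)                 ≈⟨ +-cong (+-comm _ _) (⁻¹-∙-comm 1# n′) ⟩
    (1# + m′) - (1# + n′)                   ≈⟨ +-cong (1+× m 1#) (-‿cong (1+× n 1#)) ⟨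
    suc m ×′ 1# - suc n ×′ 1#               ∎
    where m′ = m ×′ 1# ; n′ = n ×′ 1#

  fromℤ-+ : ∀ i j → fromℤ (i ℤ.+ j) ≈ fromℤ i + fromℤ j
  fromℤ-+ (+ m)    (+ n)    = ×-homo-+ 1# m n
  fromℤ-+ (+ m)    -[1+ n ] = fromℤ-⊖ m (suc n)
  fromℤ-+ -[1+ m ] (+ n)    = trans (fromℤ-⊖ n (suc m)) (+-comm _ _)
  fromℤ-+ -[1+ m ] -[1+ n ] = begin
    - (suc (suc (m ℕ.+ n)) ×′ 1#)     ≡⟨ ≡.cong (λ k → - (suc k ×′ 1#)) (≡.sym (ℕ.+-suc m n)) ⟩
    - ((suc m ℕ.+ suc n) ×′ 1#)       ≈⟨ -‿cong (×-homo-+ 1# (suc m) (suc n)) ⟩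
    - (suc m ×′ 1# + suc n ×′ 1#)     ≈⟨ ⁻¹-∙-comm _ _ ⟨
    - (suc m ×′ 1#) - (suc n ×′ 1#)   ∎

  fromℤ-*-pos : ∀ i n → fromℤ (i ℤ.* + n) ≈ fromℤ i * fromℤ (+ n)
  fromℤ-*-pos (+ m)    n = trans (reflexive (≡.cong fromℤ (≡.sym (ℤ.pos-* m n)))) (×1-homo-* m n)
  fromℤ-*-pos -[1+ m ] n = begin
    fromℤ (ℤ.- (+ suc m) ℤ.* + n)     ≡⟨ ≡.cong fromℤ (ℤ.neg-distribˡ-* (+ suc m) (+ n)) ⟨
    fromℤ (ℤ.- (+ suc m ℤ.* + n))     ≈⟨ fromℤ-neg (+ suc m ℤ.* + n) ⟩
    - fromℤ (+ suc m ℤ.* + n)         ≈⟨ -‿cong (fromℤ-*-pos (+ suc m) n) ⟩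
    - (fromℤ (+ suc m) * fromℤ (+ n)) ≈⟨ -‿distribˡ-* _ _ ⟩
    - fromℤ (+ suc m) * fromℤ (+ n)   ∎

  fromℤ-* : ∀ i j → fromℤ (i ℤ.* j) ≈ fromℤ i * fromℤ j
  fromℤ-* i (+ n)    = fromℤ-*-pos i n
  fromℤ-* i -[1+ n ] = begin
    fromℤ (i ℤ.* ℤ.- (+ suc n))   ≡⟨ ≡.cong fromℤ (ℤ.neg-distribʳ-* i (+ suc n)) ⟨
    fromℤ (ℤ.- (i ℤ.* + suc n))   ≈⟨ fromℤ-neg (i ℤ.* + suc n) ⟩
    - fromℤ (i ℤ.* + suc n)       ≈⟨ -‿cong (fromℤ-*-pos i (suc n)) ⟩
    - (fromℤ i * fromℤ (+ suc n)) ≈⟨ -‿distribʳ-* _ _ ⟩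
    fromℤ i * - fromℤ (+ suc n)   ∎

  ℤ-morphism : ℤ.+-*-rawRing -Raw-AlmostCommutative⟶ fromCommutativeRing R
  ℤ-morphism = record
    { ⟦_⟧ = fromℤ ; +-homo = fromℤ-+ ; *-homo = fromℤ-* ; -‿homo = fromℤ-neg
    ; 0-homo = refl ; 1-homo = refl }

  fromℤ-≟ : WeaklyDecidable (λ i j → fromℤ i ≈ fromℤ j)
  fromℤ-≟ i j = Maybe.map (λ i≡j → reflexive (≡.cong fromℤ i≡j)) (dec⇒maybe (i ℤ.≟ j))

  open RingSolver ℤ.+-*-rawRing (fromCommutativeRing R) ℤ-morphism fromℤ-≟ public
    using (solve; _:+_; _:*_; _:-_; :-_; _:=_; con)

  :0 :1 : ∀ {n} → RingSolver.Polynomial ℤ.+-*-rawRing (fromCommutativeRing R) ℤ-morphism fromℤ-≟ n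
  :0 = con (+ 0)
  :1 = con (+ 1)

-- Laplace determinants: multilinearity, alternation, triangular matrices.

module Determinants {c ℓ₁ ℓ₂} (ℝ : RealNumbers c ℓ₁ ℓ₂) where
  open RealNumbers ℝ hiding (zero)
  open Spectral ℝ
  open CommutativeRing commutativeRing using (semiring; ring)
  open RingProperties ring using (-0#≈0#; -‿involutive)
  open SemiringSum semiring hiding (sum)
  open IntegerSolver commutativeRing
  open SetoidReasoning setoid

  private
    variable
      n : ℕ
      I : Set

  sum-zero : {t : Vector Carrier n} → (∀ i → t i ≈ 0#) → sum t ≈ 0#
  sum-zero {n} t≈0 = trans (sum-cong-≋ t≈0) (sum-replicate-zero n)

  sum-single : ∀ {t : Vector Carrier n} a → (∀ i → i ≢ a → t i ≈ 0#) → sum t ≈ t a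
  sum-single {suc n} {t} a t≈0 = begin
    sum t                      ≈⟨ sum-remove {i = a} t ⟩
    t a + sum (removeAt t a)   ≈⟨ +-congˡ (sum-zero (λ i → t≈0 _ (Fin.punchInᵢ≢i a i))) ⟩
    t a + 0#                   ≈⟨ +-identityʳ _ ⟩
    t a                        ∎

  sum-pair : ∀ {t : Vector Carrier n} {a b} → a ≢ b →
    (∀ i → i ≢ a → i ≢ b → t i ≈ 0#) → sum t ≈ t a + t b
  sum-pair {suc n} {t} {a} {b} a≢b t≈0 = begin
    sum t                      ≈⟨ sum-remove {i = a} t ⟩
    t a + sum (removeAt t a)   ≈⟨ +-congˡ (sum-single (punchOut a≢b) λ i i≢ → t≈0 _ (Fin.punchInᵢ≢i a i)
                                     (λ eq → i≢ (Fin.punchIn-injective a _ _ (≡.trans eq (≡.sym (Fin.punchIn-punchOut a≢b)))))) ⟩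
    t a + t (punchIn a (punchOut a≢b)) ≡⟨ ≡.cong (λ k → t a + t k) (Fin.punchIn-punchOut a≢b) ⟩
    t a + t b                  ∎

  -- Read by columns, `δ j` is the j-th standard basis vector; most uses below are in this sense.
  δ : Fin n → Fin n → Carrier
  δ = diagonal (λ _ → 1#)

  diagonal-≡ : ∀ (d : Vector Carrier n) i → diagonal d i i ≈ d i
  diagonal-≡ d i with i Fin.≟ i
  ... | yes _ = refl
  ... | no i≢i = ⊥-elim (i≢i ≡.refl)

  diagonal-≢ : ∀ (d : Vector Carrier n) {i j} → i ≢ j → diagonal d i j ≈ 0#
  diagonal-≢ d {i} {j} i≢j with i Fin.≟ j
  ... | yes i≡j = ⊥-elim (i≢j i≡j)
  ... | no _    = refl

  -- A family u : J → I → Carrier is read as the list of columns of a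
  -- matrix: u j i is the entry in row i and column j.
  record Alternating {I J : Set} (G : (J → I → Carrier) → Carrier) : Set (c ⊔ ℓ₁) where
    field
      cong   : ∀ {u v} → (∀ j i → u j i ≈ v j i) → G u ≈ G v
      linear : ∀ j a b {u v w} →
        (∀ k → k ≢ j → ∀ i → u k i ≈ w k i) →
        (∀ k → k ≢ j → ∀ i → v k i ≈ w k i) →
        (∀ i → w j i ≈ a * u j i + b * v j i) →
        G w ≈ a * G u + b * G v
      alternating : ∀ {j k} {u} → j ≢ k → (∀ i → u j i ≈ u k i) → G u ≈ 0#

  transpose-left : ∀ (a b : Fin n) → transpose a b a ≡ b
  transpose-left a b with a Fin.≟ a
  ... | yes _ = ≡.refl
  ... | no a≢a = ⊥-elim (a≢a ≡.refl)

  transpose-right : ∀ {a b : Fin n} → transpose a b b ≡ a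
  transpose-right {a = a} {b} with b Fin.≟ a
  ... | yes b≡a = b≡a
  ... | no _ with b Fin.≟ b
  ...   | yes _ = ≡.refl
  ...   | no b≢b = ⊥-elim (b≢b ≡.refl)

  transpose-other : ∀ {a b k : Fin n} → k ≢ a → k ≢ b → transpose a b k ≡ k
  transpose-other {a = a} {b} {k} k≢a k≢b with k Fin.≟ a
  ... | yes k≡a = ⊥-elim (k≢a k≡a)
  ... | no _ with k Fin.≟ b
  ...   | yes k≡b = ⊥-elim (k≢b k≡b)
  ...   | no _ = ≡.refl

  -- The `linear` field of `Alternating` on its own, because alternation of `det` is derived with
  -- the help of its linearity. Three families that agree off one column are compared, so that no
  -- updated family has to be identified up to equality of functions.
  Multilinear : ((Fin n → I → Carrier) → Carrier) → Set (c ⊔ ℓ₁)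
  Multilinear {n} {I} G = ∀ (j : Fin n) a b {u v w : Fin n → I → Carrier} →
    (∀ k → k ≢ j → ∀ i → u k i ≈ w k i) →
    (∀ k → k ≢ j → ∀ i → v k i ≈ w k i) →
    (∀ i → w j i ≈ a * u j i + b * v j i) →
    G w ≈ a * G u + b * G v

  module _ {G : (Fin n → I → Carrier) → Carrier}
    (G-cong : ∀ {u v} → (∀ j i → u j i ≈ v j i) → G u ≈ G v)
    (G-linear : Multilinear G)
    {a b : Fin n} (a≢b : a ≢ b)
    (G-alt : ∀ {u} → (∀ i → u a i ≈ u b i) → G u ≈ 0#) where

    -- Polarisation: put x + y into both columns, expand, and let the two terms with equal columns
    -- vanish. Alternation is assumed for this one pair only, so the lemma already applies to
    -- neighbouring columns before general alternation is known.
    swap-columns : ∀ v → G (v ∘ transpose a b) ≈ - G v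
    swap-columns v = begin
      G (v ∘ transpose a b) ≈⟨ G-cong swapped ⟩
      P y x                 ≈⟨ solve 2 (λ p q → q := (p :+ q) :- p) refl (P x y) (P y x) ⟩
      (P x y + P y x) - P x y ≈⟨ +-congʳ P-sum ⟨
      0# - P x y            ≈⟨ +-identityˡ _ ⟩
      - P x y               ≈⟨ -‿cong (G-cong unswapped) ⟩
      - G v                 ∎
      where
      x = v a
      y = v b
      put : (s t : I → Carrier) → Fin n → I → Carrier
      put s t k with k Fin.≟ a | k Fin.≟ b
      ... | yes _ | _     = s
      ... | no _  | yes _ = t
      ... | no _  | no _  = v k
      put-a : ∀ {s t} i → put s t a i ≈ s i
      put-a i with a Fin.≟ a | a Fin.≟ b
      ... | yes _ | _ = refl
      ... | no a≢a | _ = ⊥-elim (a≢a ≡.refl)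
      put-b : ∀ {s t} i → put s t b i ≈ t i
      put-b i with b Fin.≟ a | b Fin.≟ b
      ... | yes b≡a | _ = ⊥-elim (a≢b (≡.sym b≡a))
      ... | no _ | yes _ = refl
      ... | no _ | no b≢b = ⊥-elim (b≢b ≡.refl)
      put-other-a : ∀ {s t s′ t′} → (∀ i → t i ≈ t′ i) → ∀ k → k ≢ a → ∀ i → put s t k i ≈ put s′ t′ k i
      put-other-a t≈ k k≢a i with k Fin.≟ a | k Fin.≟ b
      ... | yes k≡a | _ = ⊥-elim (k≢a k≡a)
      ... | no _ | yes _ = t≈ i
      ... | no _ | no _  = refl
      put-other-b : ∀ {s t s′ t′} → (∀ i → s i ≈ s′ i) → ∀ k → k ≢ b → ∀ i → put s t k i ≈ put s′ t′ k i
      put-other-b s≈ k k≢b i with k Fin.≟ a | k Fin.≟ b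
      ... | yes _ | _ = s≈ i
      ... | no _ | yes k≡b = ⊥-elim (k≢b k≡b)
      ... | no _ | no _  = refl
      P : (s t : I → Carrier) → Carrier
      P s t = G (put s t)
      s+t : (s t : I → Carrier) → I → Carrier
      s+t s t i = s i + t i
      P-addˡ : ∀ s s′ t → P (s+t s s′) t ≈ P s t + P s′ t
      P-addˡ s s′ t = trans
        (G-linear a 1# 1# (put-other-a (λ _ → refl)) (put-other-a (λ _ → refl))
          (λ i → trans (put-a i) (trans (sym (+-cong (put-a i) (put-a i))) (sym (+-cong (*-identityˡ _) (*-identityˡ _))))))
        (+-cong (*-identityˡ _) (*-identityˡ _))
      P-addʳ : ∀ s t t′ → P s (s+t t t′) ≈ P s t + P s t′
      P-addʳ s t t′ = trans
        (G-linear b 1# 1# (put-other-b (λ _ → refl)) (put-other-b (λ _ → refl))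
          (λ i → trans (put-b i) (trans (sym (+-cong (put-b i) (put-b i))) (sym (+-cong (*-identityˡ _) (*-identityˡ _))))))
        (+-cong (*-identityˡ _) (*-identityˡ _))
      P-diag : ∀ s → P s s ≈ 0#
      P-diag s = G-alt (λ i → trans (put-a i) (sym (put-b i)))
      P-sum : 0# ≈ P x y + P y x
      P-sum = begin
        0#                                         ≈⟨ P-diag (s+t x y) ⟨
        P (s+t x y) (s+t x y)                      ≈⟨ P-addˡ x y _ ⟩
        P x (s+t x y) + P y (s+t x y)              ≈⟨ +-cong (P-addʳ x x y) (P-addʳ y x y) ⟩
        (P x x + P x y) + (P y x + P y y)          ≈⟨ +-cong (+-congʳ (P-diag x)) (+-congˡ (P-diag y)) ⟩
        (0# + P x y) + (P y x + 0#)                ≈⟨ +-cong (+-identityˡ _) (+-identityʳ _) ⟩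
        P x y + P y x                              ∎
      swapped : ∀ k i → v (transpose a b k) i ≈ put y x k i
      swapped k i with k Fin.≟ a
      ... | yes _ = refl
      ... | no _ with k Fin.≟ b
      ...   | yes _ = refl
      ...   | no _ = refl
      unswapped : ∀ k i → put x y k i ≈ v k i
      unswapped k i with k Fin.≟ a | k Fin.≟ b
      ... | yes ≡.refl | _ = refl
      ... | no _ | yes ≡.refl = refl
      ... | no _ | no _ = refl

  module _ {G : (Fin (suc n) → I → Carrier) → Carrier}
    (G-cong : ∀ {u v} → (∀ j i → u j i ≈ v j i) → G u ≈ G v) (G-linear : Multilinear G)
    (G-adj : ∀ (j : Fin n) {u} → (∀ i → u (inject₁ j) i ≈ u (suc j) i) → G u ≈ 0#) where

    private
      -- Induction on the position of the right column. Unless the two equal columns are neighbours,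
      -- swapping the right one with its left neighbour costs a sign and brings them one step
      -- closer.
      ordered : ∀ d a b {u} → toℕ b ≡ d → a Fin.< b → (∀ i → u a i ≈ u b i) → G u ≈ 0#
      ordered (suc d) a (suc b) {u} eq a<b u≈ with a Fin.≟ inject₁ b
      ... | yes ≡.refl = G-adj b u≈
      ... | no a≢b = begin
        G u                                           ≈⟨ -‿involutive _ ⟨
        - (- G u)                                     ≈⟨ -‿cong (swap-columns G-cong G-linear b≢sb (λ {v} → G-adj b {v}) u) ⟨
        - G (u ∘ transpose (inject₁ b) (suc b))       ≈⟨ -‿cong (ordered d a (inject₁ b) (≡.trans (Fin.toℕ-inject₁ b) (ℕ.suc-injective eq)) a<b′ λ i →
             trans (reflexive (≡.cong (λ k → u k i) (transpose-other a≢b (λ a≡sb → ℕ.<-irrefl (≡.cong toℕ a≡sb) a<b))))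
            (trans (u≈ i) (reflexive (≡.cong (λ k → u k i) (≡.sym (transpose-left (inject₁ b) (suc b))))))) ⟩
        - 0#                                          ≈⟨ -0#≈0# ⟩
        0#                                            ∎
        where
        b≢sb : inject₁ b ≢ suc b
        b≢sb eq = ℕ.1+n≢n (≡.trans (≡.cong toℕ (≡.sym eq)) (Fin.toℕ-inject₁ b))
        a<b′ : a Fin.< inject₁ b
        a<b′ = ℕ.≤∧≢⇒< (≡.subst (toℕ a ℕ.≤_) (≡.sym (Fin.toℕ-inject₁ b)) (ℕ.≤-pred a<b)) (a≢b ∘ Fin.toℕ-injective)

    adjacent⇒alternating : ∀ {a b u} → a ≢ b → (∀ i → u a i ≈ u b i) → G u ≈ 0#
    adjacent⇒alternating {a} {b} a≢b u≈ with Fin.<-cmp a b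
    ... | tri< a<b _ _ = ordered _ a b ≡.refl a<b u≈
    ... | tri≈ _ a≡b _ = ⊥-elim (a≢b a≡b)
    ... | tri> _ _ b<a = ordered _ b a ≡.refl b<a (sym ∘ u≈)

  sum-linear : ∀ a b {t u v : Vector Carrier n} → (∀ k → t k ≈ a * u k + b * v k) →
    sum t ≈ a * sum u + b * sum v
  sum-linear a b {t} {u} {v} t≈ = begin
    sum t                                          ≈⟨ sum-cong-≋ t≈ ⟩
    sum (λ k → a * u k + b * v k)                  ≈⟨ ∑-distrib-+ (λ k → a * u k) (λ k → b * v k) ⟩
    sum (λ k → a * u k) + sum (λ k → b * v k)      ≈⟨ +-cong (*-distribˡ-sum a u) (*-distribˡ-sum b v) ⟨
    a * sum u + b * sum v                          ∎

  det-cong : {M N : Matrix n} → (∀ i j → M i j ≈ N i j) → det M ≈ det N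
  det-cong {zero}  M≈N = refl
  det-cong {suc n} M≈N = sum-cong-≋ λ j →
    *-cong (*-congˡ {x = -1^ (toℕ j)} (M≈N zero j)) (det-cong λ i k → M≈N (suc i) (punchIn j k))

  detᶜ : (Fin n → Fin n → Carrier) → Carrier
  detᶜ u = det (λ i j → u j i)

  private
    term : (Fin (suc n) → Fin (suc n) → Carrier) → Vector Carrier (suc n)
    term u k = -1^ (toℕ k) * u k zero * detᶜ (λ j i → u (punchIn k j) (suc i))

  -- Deleting column j or column j + 1 leaves the same list, except for the one place where the
  -- survivor of the pair stands. If the two columns agree, so do the two minors.
  punchIn-adjacent : ∀ (j c : Fin n) →
    punchIn (inject₁ j) c ≡ punchIn (suc j) c ⊎
    (punchIn (inject₁ j) c ≡ suc j × punchIn (suc j) c ≡ inject₁ j)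
  punchIn-adjacent zero    zero    = inj₂ (≡.refl , ≡.refl)
  punchIn-adjacent zero    (suc c) = inj₁ ≡.refl
  punchIn-adjacent (suc j) zero    = inj₁ ≡.refl
  punchIn-adjacent (suc j) (suc c) with punchIn-adjacent j c
  ... | inj₁ eq        = inj₁ (≡.cong suc eq)
  ... | inj₂ (eq , eq′) = inj₂ (≡.cong suc eq , ≡.cong suc eq′)

  -- Column j enters the j-th term of the expansion through its first entry and every other term
  -- through the minor, so exactly one factor of each term is linear in it.
  det-linear : Multilinear (detᶜ {n})
  det-linear {suc n} j a b {u} {v} {w} u≈w v≈w w≈ = sum-linear a b linear-term
    where
    linear-term : ∀ k → term w k ≈ a * term u k + b * term v k
    linear-term k with k Fin.≟ j
    ... | yes ≡.refl = begin
      -1^ (toℕ k) * w k zero * D w ≈⟨ *-congʳ (*-congˡ (w≈ zero)) ⟩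
      -1^ (toℕ k) * (a * u k zero + b * v k zero) * D w
        ≈⟨ solve 6 (λ s a b x y d → s :* (a :* x :+ b :* y) :* d := a :* (s :* x :* d) :+ b :* (s :* y :* d))
                   refl (-1^ (toℕ k)) a b (u k zero) (v k zero) (D w) ⟩
      a * (-1^ (toℕ k) * u k zero * D w) + b * (-1^ (toℕ k) * v k zero * D w)
        ≈⟨ +-cong (*-congˡ (*-congˡ (det-cong λ i l → u≈w _ (Fin.punchInᵢ≢i k l) (suc i))))
                  (*-congˡ (*-congˡ (det-cong λ i l → v≈w _ (Fin.punchInᵢ≢i k l) (suc i)))) ⟨
      a * term u k + b * term v k ∎
      where
      D : (Fin (suc n) → Fin (suc n) → Carrier) → Carrier
      D u = detᶜ (λ j i → u (punchIn k j) (suc i))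
    ... | no k≢j = begin
      -1^ (toℕ k) * w k zero * D w ≈⟨ *-congˡ (det-linear (punchOut k≢j) a b (off u u≈w) (off v v≈w) on) ⟩
      -1^ (toℕ k) * w k zero * (a * D u + b * D v)
        ≈⟨ solve 6 (λ s x a b d e → s :* x :* (a :* d :+ b :* e) := a :* (s :* x :* d) :+ b :* (s :* x :* e))
                   refl (-1^ (toℕ k)) (w k zero) a b (D u) (D v) ⟩
      a * (-1^ (toℕ k) * w k zero * D u) + b * (-1^ (toℕ k) * w k zero * D v)
        ≈⟨ +-cong (*-congˡ (*-congʳ (*-congˡ (u≈w k k≢j zero)))) (*-congˡ (*-congʳ (*-congˡ (v≈w k k≢j zero)))) ⟨
      a * term u k + b * term v k ∎
      where
      D : (Fin (suc n) → Fin (suc n) → Carrier) → Carrier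
      D u = detᶜ (λ j i → u (punchIn k j) (suc i))
      off : ∀ u → (∀ l → l ≢ j → ∀ i → u l i ≈ w l i) →
        ∀ l → l ≢ punchOut k≢j → ∀ i → u (punchIn k l) (suc i) ≈ w (punchIn k l) (suc i)
      off u u≈w l l≢ i = u≈w _ (λ eq → l≢ (Fin.punchIn-injective k _ _
        (≡.trans eq (≡.sym (Fin.punchIn-punchOut k≢j))))) (suc i)
      on : ∀ i → w (punchIn k (punchOut k≢j)) (suc i) ≈
        a * u (punchIn k (punchOut k≢j)) (suc i) + b * v (punchIn k (punchOut k≢j)) (suc i)
      on i rewrite Fin.punchIn-punchOut k≢j = w≈ (suc i)

  DetAlternating : ℕ → Set (c ⊔ ℓ₁)
  DetAlternating n = ∀ {j k : Fin n} {u} → j ≢ k → (∀ i → u j i ≈ u k i) → detᶜ u ≈ 0#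

  -- The terms of the two equal columns have the same entry, the same minor and opposite signs.
  -- Every other minor still contains both columns, no longer necessarily as neighbours for the
  -- argument at hand, which is why the induction hypothesis is full alternation one size down.
  det-adjacent : DetAlternating (suc n) →
    ∀ (j : Fin (suc n)) {u} → (∀ i → u (inject₁ j) i ≈ u (suc j) i) → detᶜ u ≈ 0#
  det-adjacent IH j {u} u≈ = begin
    sum (term u)                            ≈⟨ sum-pair a≢b others ⟩
    term u (inject₁ j) + term u (suc j)     ≈⟨ +-cong (*-cong (*-cong (reflexive (≡.cong -1^_ (Fin.toℕ-inject₁ j))) (u≈ zero)) (det-cong minors)) refl ⟩
    s * x * d + - s * x * d                 ≈⟨ solve 3 (λ s x d → s :* x :* d :+ :- s :* x :* d := :0) refl s x d ⟩
    0#                                      ∎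
    where
    s = -1^ (toℕ j)
    x = u (suc j) zero
    d = detᶜ (λ k i → u (punchIn (suc j) k) (suc i))
    a≢b : inject₁ j ≢ suc j
    a≢b eq = ℕ.1+n≢n (≡.trans (≡.cong toℕ (≡.sym eq)) (Fin.toℕ-inject₁ j))
    minors : ∀ i k → u (punchIn (inject₁ j) k) (suc i) ≈ u (punchIn (suc j) k) (suc i)
    minors i k with punchIn-adjacent j k
    ... | inj₁ eq         = reflexive (≡.cong (λ l → u l (suc i)) eq)
    ... | inj₂ (eq , eq′) rewrite eq | eq′ = sym (u≈ (suc i))
    others : ∀ k → k ≢ inject₁ j → k ≢ suc j → term u k ≈ 0#
    others k k≢a k≢b = trans (*-congˡ (IH
        {j = punchOut k≢a} {k = punchOut k≢b} {λ l i → u (punchIn k l) (suc i)}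
        (a≢b ∘ Fin.punchOut-injective k≢a k≢b)
        (λ i → trans (reflexive (≡.cong (λ l → u l (suc i)) (Fin.punchIn-punchOut k≢a)))
          (trans (u≈ (suc i)) (reflexive (≡.cong (λ l → u l (suc i)) (≡.sym (Fin.punchIn-punchOut k≢b)))))) ))
      (zeroʳ _)

  det-alternating : ∀ n → DetAlternating n
  det-alternating (suc zero)    {zero} {zero} j≢k _ = ⊥-elim (j≢k ≡.refl)
  det-alternating (suc (suc n)) = adjacent⇒alternating (λ u≈v → det-cong λ i j → u≈v j i) det-linear
    (det-adjacent (det-alternating (suc n)))

  detᶜ-Alternating : Alternating (detᶜ {n})
  detᶜ-Alternating = record
    { cong = λ u≈v → det-cong λ i j → u≈v j i ; linear = det-linear ; alternating = det-alternating _ }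

  det-triangular : {M : Matrix n} → (∀ i j → i Fin.< j → M i j ≈ 0#) → det M ≈ product (λ i → M i i)
  det-triangular {zero}  _ = refl
  det-triangular {suc n} {M} upper≈0 = begin
    det M                                              ≈⟨ sum-single {t = λ j → -1^ (toℕ j) * M zero j * det (λ i k → M (suc i) (punchIn j k))} zero
         (λ { zero 0≢0 → ⊥-elim (0≢0 ≡.refl)
            ; (suc j) _ → trans (*-congʳ (trans (*-congˡ (upper≈0 zero (suc j) ℕ.z<s)) (zeroʳ _))) (zeroˡ _) }) ⟩
    1# * M zero zero * det (λ i k → M (suc i) (suc k)) ≈⟨ *-cong (*-identityˡ _) (det-triangular (λ i j i<j → upper≈0 _ _ (ℕ.s<s i<j))) ⟩
    product (λ i → M i i)                              ∎

-- Uniqueness of alternating multilinear functions up to a scalar.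

module DeterminantProduct {c ℓ₁ ℓ₂} (ℝ : RealNumbers c ℓ₁ ℓ₂) where
  open RealNumbers ℝ hiding (zero)
  open Spectral ℝ
  open CommutativeRing commutativeRing using (ring)
  open RingProperties ring using (-0#≈0#; -‿involutive)
  open IntegerSolver commutativeRing
  open SetoidReasoning setoid

  open Determinants ℝ

  private
    variable
      n : ℕ

  -- A self-map that misses a value has only n - 1 values left, so by the pigeonhole principle two
  -- columns are the same basis vector.
  collision : {G : (Fin n → Fin n → Carrier) → Carrier} → Alternating G →
    ∀ {a} (f : Fin n → Fin n) → ¬ ∃ (λ c → f c ≡ a) → G (λ j → δ (f j)) ≈ 0#
  collision {suc n} G-alternating {a} f ∄c
    with i , j , i<j , eq ← Fin.pigeonhole ℕ.≤-refl (λ j → punchOut {i = a} {j = f j} (λ a≡fj → ∄c (j , ≡.sym a≡fj)))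
    = Alternating.alternating G-alternating (λ i≡j → ℕ.<-irrefl (≡.cong toℕ i≡j) i<j)
        (λ r → reflexive (≡.cong (λ l → δ l r) (Fin.punchOut-injective (λ a≡fi → ∄c (i , ≡.sym a≡fi)) (λ a≡fj → ∄c (j , ≡.sym a≡fj)) eq)))

  module _ {G : (Fin n → Fin n → Carrier) → Carrier} (G-alternating : Alternating G) (Gδ≈0 : G δ ≈ 0#) where
    open Alternating G-alternating

    -- Sorting by transpositions: `k` bounds the indices that `f` may still move. If some `c` is
    -- sent to the topmost of them, exchanging the two columns fixes that index at the cost of a
    -- sign; if none is, `f` misses a value.
    vanishes-on-maps : ∀ k → k ℕ.≤ n → (f : Fin n → Fin n) → (∀ j → k ℕ.≤ toℕ j → f j ≡ j) →
      G (λ j → δ (f j)) ≈ 0#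
    vanishes-on-maps zero    _   f f≡id = trans (cong λ j i → reflexive (≡.cong (λ l → δ l i) (f≡id j ℕ.z≤n))) Gδ≈0
    vanishes-on-maps (suc k) k<n f f≡id with Fin.any? (λ c → f c Fin.≟ Fin.fromℕ< k<n)
    ... | no ∄c = collision G-alternating f ∄c
    ... | yes (c , fc≡a) with c Fin.≟ Fin.fromℕ< k<n
    ...   | yes ≡.refl = vanishes-on-maps k (ℕ.<⇒≤ k<n) f fixes
      where
      fixes : ∀ j → k ℕ.≤ toℕ j → f j ≡ j
      fixes j k≤j with j Fin.≟ c
      ... | yes ≡.refl = fc≡a
      ... | no j≢c = f≡id j (ℕ.≤∧≢⇒< k≤j (λ k≡j → j≢c (Fin.toℕ-injective (≡.trans (≡.sym k≡j) (≡.sym (Fin.toℕ-fromℕ< k<n))))))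
    ...   | no c≢a = begin
      G e                       ≈⟨ -‿involutive _ ⟨
      - (- G e)                 ≈⟨ -‿cong (swap-columns cong linear c≢a (alternating c≢a) e) ⟨
      - G (e ∘ transpose c a)   ≈⟨ -‿cong (vanishes-on-maps k (ℕ.<⇒≤ k<n) (f ∘ transpose c a) fixes) ⟩
      - 0#                      ≈⟨ -0#≈0# ⟩
      0#                        ∎
      where
      e : Fin n → Fin n → Carrier
      e j = δ (f j)
      a = Fin.fromℕ< k<n
      fixes : ∀ j → k ℕ.≤ toℕ j → f (transpose c a j) ≡ j
      fixes j k≤j with j Fin.≟ a
      ... | yes ≡.refl = ≡.trans (≡.cong f (transpose-right {a = c} {a})) fc≡a
      ... | no j≢a = ≡.trans (≡.cong f (transpose-other j≢c j≢a)) (f≡id j k<j)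
        where
        k<j : k ℕ.< toℕ j
        k<j = ℕ.≤∧≢⇒< k≤j (λ k≡j → j≢a (Fin.toℕ-injective (≡.trans (≡.sym k≡j) (≡.sym (Fin.toℕ-fromℕ< k<n)))))
        -- `c` is not among the indices fixed earlier, for `f` sends it to `a`.
        j≢c : j ≢ c
        j≢c ≡.refl = j≢a (≡.trans (≡.sym (f≡id j k<j)) fc≡a)

    vanishes-on-sum : ∀ {t} a (x : Vector Carrier t) (w : Fin t → Fin n → Carrier) (u : Fin n → Fin n → Carrier) →
      (∀ i → u a i ≈ sum (λ s → x s * w s i)) →
      (∀ s (v : Fin n → Fin n → Carrier) → (∀ k → k ≢ a → v k ≡ u k) → v a ≡ w s → G v ≈ 0#) →
      G u ≈ 0#
    -- An empty combination is the zero column, expressed for `linear` as 0 times the column itself,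
    -- taken twice.
    vanishes-on-sum {zero}  a x w u ua≈ G≈0 = begin
      G u                  ≈⟨ linear a 0# 0# {u} {u} (λ _ _ _ → refl) (λ _ _ _ → refl)
                                (λ i → trans (ua≈ i) (sym (trans (+-cong (zeroˡ _) (zeroˡ _)) (+-identityˡ _)))) ⟩
      0# * G u + 0# * G u  ≈⟨ trans (+-cong (zeroˡ _) (zeroˡ _)) (+-identityˡ _) ⟩
      0#                   ∎
    vanishes-on-sum {suc t} a x w u ua≈ G≈0 = begin
      G u                     ≈⟨ linear a (x zero) 1# {u₀} {u₁} (off _) (off _) at-a ⟩
      x zero * G u₀ + 1# * G u₁ ≈⟨ +-cong (*-congˡ (G≈0 zero u₀ (λ k k≢a → updateAt-minimal k a u k≢a) (updateAt-updates a u)))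
                                        (*-congˡ (vanishes-on-sum a (x ∘ suc) (w ∘ suc) u₁ (λ i → reflexive (≡.cong (λ g → g i) (updateAt-updates a u)))
                                           λ s v off-a on-a → G≈0 (suc s) v (λ k k≢a → ≡.trans (off-a k k≢a) (updateAt-minimal k a u k≢a)) on-a)) ⟩
      x zero * 0# + 1# * 0#   ≈⟨ trans (+-cong (zeroʳ _) (zeroʳ _)) (+-identityˡ _) ⟩
      0#                      ∎
      where
      rest : Fin n → Carrier
      rest i = sum (λ s → x (suc s) * w (suc s) i)
      u₀ = updateAt u a (λ _ → w zero)
      u₁ = updateAt u a (λ _ → rest)
      off : ∀ (y : Fin n → Carrier) k → k ≢ a → ∀ i → updateAt u a (λ _ → y) k i ≈ u k i
      off y k k≢a i = reflexive (≡.cong (λ g → g i) (updateAt-minimal k a u k≢a))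
      at-a : ∀ i → u a i ≈ x zero * u₀ a i + 1# * u₁ a i
      at-a i rewrite updateAt-updates a {λ _ → w zero} u | updateAt-updates a {λ _ → rest} u =
        trans (ua≈ i) (+-congˡ (sym (*-identityˡ _)))

    -- `k` counts the columns that are not yet known to be basis vectors. The last of them is
    -- expanded in the basis, and multilinearity passes to families with one such column fewer; at 0
    -- only a map of indices is left.
    vanishes : ∀ k → k ℕ.≤ n → ∀ u → (∀ j → k ℕ.≤ toℕ j → ∃ λ l → u j ≡ δ l) → G u ≈ 0#
    vanishes zero    _   u basis = trans (cong λ j i → reflexive (≡.cong (λ g → g i) (proj₂ (basis j ℕ.z≤n))))
      (vanishes-on-maps n ℕ.≤-refl (λ j → proj₁ (basis j ℕ.z≤n)) λ j n≤j → ⊥-elim (ℕ.<⇒≱ (Fin.toℕ<n j) n≤j))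
    vanishes (suc k) k<n u basis = vanishes-on-sum a (u a) δ u expand
      λ s v off on → vanishes k (ℕ.<⇒≤ k<n) v (basis′ s v off on)
      where
      a = Fin.fromℕ< k<n
      expand : ∀ i → u a i ≈ sum (λ s → u a s * δ s i)
      expand i = sym (trans (sum-single {t = λ s → u a s * δ s i} i (λ s s≢i → trans (*-congˡ (diagonal-≢ (λ _ → 1#) s≢i)) (zeroʳ _)))
        (trans (*-congˡ (diagonal-≡ (λ _ → 1#) i)) (*-identityʳ _)))
      basis′ : ∀ s v → (∀ k → k ≢ a → v k ≡ u k) → v a ≡ δ s → ∀ j → k ℕ.≤ toℕ j → ∃ λ l → v j ≡ δ l
      basis′ s v off on j k≤j with j Fin.≟ a
      ... | yes ≡.refl = s , on
      ... | no j≢a with l , eq ← basis j (ℕ.≤∧≢⇒< k≤j (λ k≡j → j≢a (Fin.toℕ-injective (≡.trans (≡.sym k≡j) (≡.sym (Fin.toℕ-fromℕ< k<n))))))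
        = l , ≡.trans (off j j≢a) eq

  product-ones : ∀ {t : Vector Carrier n} → (∀ i → t i ≈ 1#) → product t ≈ 1#
  product-ones {zero}  _   = refl
  product-ones {suc n} t≈1 = trans (*-cong (t≈1 zero) (product-ones (t≈1 ∘ suc))) (*-identityˡ 1#)

  det-δ : det (λ i j → δ {n} j i) ≈ 1#
  det-δ {n} = trans (det-triangular {n} (λ i j i<j → diagonal-≢ (λ _ → 1#) (λ j≡i → ℕ.<-irrefl (≡.cong toℕ (≡.sym j≡i)) i<j)))
    (product-ones (diagonal-≡ {n} (λ _ → 1#)))

  -- The difference of the two sides is alternating in `u` and vanishes at the identity, hence
  -- everywhere. Later determinant formulas arise by freezing all but one factor or block and
  -- evaluating at the identity.
  alternating-unique : {G : (Fin n → Fin n → Carrier) → Carrier} → Alternating G →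
    ∀ u → G u ≈ G δ * detᶜ u
  alternating-unique {n} {G} G-alt u = begin
    G u                                           ≈⟨ solve 2 (λ x y → x := (x :- y) :+ y) refl (G u) (G δ * detᶜ u) ⟩
    H u + G δ * detᶜ u                            ≈⟨ +-congʳ (vanishes H-alt Hδ n ℕ.≤-refl u λ j n≤j → ⊥-elim (ℕ.<⇒≱ (Fin.toℕ<n j) n≤j)) ⟩
    0# + G δ * detᶜ u                             ≈⟨ +-identityˡ _ ⟩
    G δ * detᶜ u                                  ∎
    where
    open Alternating
    H : (Fin n → Fin n → Carrier) → Carrier
    H u = G u - G δ * detᶜ u
    H-alt : Alternating H
    H-alt = record
      { cong = λ u≈v → +-cong (cong G-alt u≈v) (-‿cong (*-congˡ (cong detᶜ-Alternating u≈v)))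
      ; linear = λ j a b {u} {v} u≈ v≈ w≈ → trans
          (+-cong (linear G-alt j a b u≈ v≈ w≈) (-‿cong (*-congˡ (linear detᶜ-Alternating j a b u≈ v≈ w≈))))
          (solve 7 (λ a b gu gv g du dv → (a :* gu :+ b :* gv) :- g :* (a :* du :+ b :* dv)
             := a :* (gu :- g :* du) :+ b :* (gv :- g :* dv)) refl a b (G u) (G v) (G δ) (detᶜ u) (detᶜ v))
      ; alternating = λ j≢k u≈ → trans (+-cong (alternating G-alt j≢k u≈)
          (-‿cong (trans (*-congˡ (alternating detᶜ-Alternating j≢k u≈)) (zeroʳ _))))
          (-‿inverseʳ 0#)
      }
    Hδ : H δ ≈ 0#
    Hδ = trans (+-congˡ (-‿cong (trans (*-congˡ (det-δ {n})) (*-identityʳ _)))) (-‿inverseʳ _)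

-- Sums over a disjoint union, for the additive and the multiplicative monoid alike.

module ConcatenatedSum {c ℓ} (M : CommutativeMonoid c ℓ) where
  open CommutativeMonoid M
  open MonoidSum M

  sum-splitAt : ∀ a {b} (t : Fin a ⊎ Fin b → Carrier) →
    sum (t ∘ splitAt a) ≈ sum (t ∘ inj₁) ∙ sum (t ∘ inj₂)
  sum-splitAt zero    t = sym (identityˡ _)
  sum-splitAt (suc a) t = trans (∙-congˡ (sum-splitAt a (t ∘ Sum.map₁ suc))) (sym (assoc _ _ _))

-- Product rule, reindexing and block triangular determinants.

module BlockDeterminants {c ℓ₁ ℓ₂} (ℝ : RealNumbers c ℓ₁ ℓ₂) where
  open RealNumbers ℝ hiding (zero)
  open Spectral ℝ
  open CommutativeRing commutativeRing using (semiring; +-commutativeMonoid)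
  open SemiringSum semiring hiding (sum)
  open IntegerSolver commutativeRing
  open SetoidReasoning setoid

  open Determinants ℝ

  open DeterminantProduct ℝ
  open ConcatenatedSum +-commutativeMonoid using (sum-splitAt)

  private
    variable
      a b m n : ℕ
      I J I′ J′ X : Set

  -- Column `j` of `u` may influence only column `e j` of `W u`, and that linearly. As `e` is
  -- injective, distinct columns stay distinct, and both axioms are inherited from `G`.
  pullback-alternating : {G : (J → I → Carrier) → Carrier} → Alternating G →
    (e : J′ → J) → (∀ {j k} → e j ≡ e k → j ≡ k) →
    (W : (J′ → I′ → Carrier) → J → I → Carrier) →
    (∀ {u v} → (∀ j i → u j i ≈ v j i) → ∀ j i → W u j i ≈ W v j i) →
    (∀ j {u w} → (∀ k → k ≢ j → ∀ i → u k i ≈ w k i) → ∀ k → k ≢ e j → ∀ i → W u k i ≈ W w k i) →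
    (∀ j x y {u v w} → (∀ i → w j i ≈ x * u j i + y * v j i) →
      ∀ i → W w (e j) i ≈ x * W u (e j) i + y * W v (e j) i) →
    (∀ j k {u} → (∀ i → u j i ≈ u k i) → ∀ i → W u (e j) i ≈ W u (e k) i) →
    Alternating (λ u → G (W u))
  pullback-alternating G-alt e e-injective W W-cong W-off W-linear W-equal = record
    { cong        = λ u≈v → cong (W-cong u≈v)
    ; linear      = λ j x y u≈w v≈w w≈ → linear (e j) x y (W-off j u≈w) (W-off j v≈w) (W-linear j x y w≈)
    ; alternating = λ {j} {k} j≢k u≈ → alternating (λ eq → j≢k (e-injective eq)) (W-equal j k u≈)
    }
    where open Alternating G-alt

  -- For fixed `M` the columns of the product are the images of the columns of `N`, so the
  -- determinant alternates in `N`; at the identity its value is `det M`.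
  det-* : (M N : Matrix n) → det (λ i j → sum (λ k → M i k * N k j)) ≈ det M * det N
  det-* {n} M N = begin
    det (λ i j → sum (λ k → M i k * N k j)) ≈⟨ alternating-unique alt (λ j i → N i j) ⟩
    det (λ i j → sum (λ k → M i k * δ j k)) * det N ≈⟨ *-congʳ (det-cong λ i j →
      trans (sum-single {t = λ k → M i k * δ j k} j (λ k k≢j → trans (*-congˡ (diagonal-≢ (λ _ → 1#) (k≢j ∘ ≡.sym))) (zeroʳ _)))
        (trans (*-congˡ (diagonal-≡ (λ _ → 1#) j)) (*-identityʳ _))) ⟩
    det M * det N ∎
    where
    W : (Fin n → Fin n → Carrier) → Fin n → Fin n → Carrier
    W u j i = sum (λ k → M i k * u j k)
    alt : Alternating (λ u → detᶜ (W u))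
    alt = pullback-alternating detᶜ-Alternating (λ j → j) (λ eq → eq) W
      (λ u≈v j i → sum-cong-≋ λ k → *-congˡ (u≈v j k))
      (λ j u≈w k k≢j i → sum-cong-≋ λ l → *-congˡ (u≈w k k≢j l))
      (λ j x y {u} {v} w≈ i → sum-linear x y λ k → trans (*-congˡ (w≈ k))
        (solve 5 (λ m x y u v → m :* (x :* u :+ y :* v) := x :* (m :* u) :+ y :* (m :* v)) refl (M i k) x y (u j k) (v j k)))
      (λ j k u≈ i → sum-cong-≋ λ l → *-congˡ (u≈ l))

  private
    -- Two enumerations of one index set differ by a permutation applied to rows and columns at
    -- once. It carries the identity matrix to itself, so no sign of a permutation has to be
    -- computed.
    det-reindex-≡ : m ≡ n → (e : Fin m ↔ X) (f : Fin n ↔ X) (M : X → X → Carrier) →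
      det (λ i j → M (Inverse.to e i) (Inverse.to e j)) ≈ det (λ i j → M (Inverse.to f i) (Inverse.to f j))
    det-reindex-≡ {n = n} ≡.refl e f M = begin
      det (λ i j → M (E.to i) (E.to j)) ≡⟨⟩
      detᶜ (λ j i → M (E.to i) (E.to j)) ≈⟨ det-cong (λ i j → reflexive (≡.cong₂ M (≡.sym (f-π i)) (≡.sym (f-π j)))) ⟩
      detᶜ (W u)                        ≈⟨ alternating-unique alt u ⟩
      detᶜ (W δ) * detᶜ u               ≈⟨ *-congʳ (trans (det-cong Wδ) (det-δ {n})) ⟩
      1# * detᶜ u                       ≈⟨ *-identityˡ _ ⟩
      detᶜ u                            ∎
      where
      module E = Inverse e
      module F = Inverse f
      π ρ : Fin n → Fin n
      π i = F.from (E.to i)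
      ρ i = E.from (F.to i)
      f-π : ∀ i → F.to (π i) ≡ E.to i
      f-π i = F.strictlyInverseˡ (E.to i)
      ρ-π : ∀ i → ρ (π i) ≡ i
      ρ-π i = ≡.trans (≡.cong E.from (f-π i)) (E.strictlyInverseʳ i)
      π-ρ : ∀ i → π (ρ i) ≡ i
      π-ρ i = ≡.trans (≡.cong F.from (E.strictlyInverseˡ (F.to i))) (F.strictlyInverseʳ i)
      u : Fin n → Fin n → Carrier
      u j i = M (F.to i) (F.to j)
      W : (Fin n → Fin n → Carrier) → Fin n → Fin n → Carrier
      W u j i = u (π j) (π i)
      alt : Alternating (λ u → detᶜ (W u))
      alt = pullback-alternating detᶜ-Alternating ρ
        (λ {j} {k} eq → ≡.trans (≡.sym (π-ρ j)) (≡.trans (≡.cong π eq) (π-ρ k))) W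
        (λ u≈v j i → u≈v (π j) (π i))
        (λ j u≈w k k≢ρj i → u≈w (π k) (λ πk≡j → k≢ρj (≡.trans (≡.sym (ρ-π k)) (≡.cong ρ πk≡j))) (π i))
        (λ j x y {u} {v} {w} w≈ i → ≡.subst (λ l → w l (π i) ≈ x * u l (π i) + y * v l (π i)) (≡.sym (π-ρ j)) (w≈ (π i)))
        (λ j k {u} u≈ i → ≡.subst₂ (λ l l′ → u l (π i) ≈ u l′ (π i)) (≡.sym (π-ρ j)) (≡.sym (π-ρ k)) (u≈ (π i)))
      Wδ : ∀ i j → W δ j i ≈ δ j i
      Wδ i j with j Fin.≟ i
      ... | yes ≡.refl = diagonal-≡ (λ _ → 1#) (π i)
      ... | no j≢i = diagonal-≢ (λ _ → 1#) (λ eq → j≢i (≡.trans (≡.sym (ρ-π j)) (≡.trans (≡.cong ρ eq) (ρ-π i))))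

  det-reindex : (e : Fin m ↔ X) (f : Fin n ↔ X) (M : X → X → Carrier) →
    det (λ i j → M (Inverse.to e i) (Inverse.to e j)) ≈ det (λ i j → M (Inverse.to f i) (Inverse.to f j))
  det-reindex e f = det-reindex-≡ (↔⇒≡ (e′ ↔-∘ e)) e f
    where e′ = ↔-sym f

  det⊎ : (Fin a ⊎ Fin b → Fin a ⊎ Fin b → Carrier) → Carrier
  det⊎ {a} M = det (λ i j → M (splitAt a i) (splitAt a j))

  det⊎-cong : {M N : Fin a ⊎ Fin b → Fin a ⊎ Fin b → Carrier} → (∀ i j → M i j ≈ N i j) → det⊎ M ≈ det⊎ N
  det⊎-cong {a} {b} M≈N = det-cong {a ℕ.+ b} λ i j → M≈N (splitAt a i) (splitAt a j)

  det⊎-* : (M N : Fin a ⊎ Fin b → Fin a ⊎ Fin b → Carrier) →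
    det⊎ (λ i j → sum (λ k → M i (inj₁ k) * N (inj₁ k) j) + sum (λ k → M i (inj₂ k) * N (inj₂ k) j)) ≈ det⊎ M * det⊎ N
  det⊎-* {a} M N = trans
    (det-cong λ i j → sym (sum-splitAt a (λ k → M (splitAt a i) k * N k (splitAt a j))))
    (det-* (λ i j → M (splitAt a i) (splitAt a j)) (λ i j → N (splitAt a i) (splitAt a j)))

  det⊎-alternating : Alternating (λ (u : Fin a ⊎ Fin b → Fin a ⊎ Fin b → Carrier) → det⊎ (λ i j → u j i))
  det⊎-alternating {a} {b} = pullback-alternating detᶜ-Alternating (join a b)
    (λ {j} {k} eq → ≡.trans (≡.sym (Fin.splitAt-join a b j)) (≡.trans (≡.cong (splitAt a) eq) (Fin.splitAt-join a b k)))
    (λ u j i → u (splitAt a j) (splitAt a i))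
    (λ u≈v j i → u≈v _ _)
    (λ j u≈w k k≢ i → u≈w _ (λ eq → k≢ (≡.trans (≡.sym (Fin.join-splitAt a b k)) (≡.cong (join a b) eq))) _)
    (λ j x y {u} {v} {w} w≈ i → ≡.subst (λ l → w l (splitAt a i) ≈ x * u l (splitAt a i) + y * v l (splitAt a i))
      (≡.sym (Fin.splitAt-join a b j)) (w≈ _))
    (λ j k {u} u≈ i → ≡.subst₂ (λ l l′ → u l (splitAt a i) ≈ u l′ (splitAt a i))
      (≡.sym (Fin.splitAt-join a b j)) (≡.sym (Fin.splitAt-join a b k)) (u≈ _))

  block : (Fin a → Fin a → Carrier) → (Fin a → Fin b → Carrier) →
          (Fin b → Fin a → Carrier) → (Fin b → Fin b → Carrier) →
          Fin a ⊎ Fin b → Fin a ⊎ Fin b → Carrier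
  block A B C D (inj₁ i) (inj₁ j) = A i j
  block A B C D (inj₁ i) (inj₂ j) = B i j
  block A B C D (inj₂ i) (inj₁ j) = C i j
  block A B C D (inj₂ i) (inj₂ j) = D i j

  𝟘 : Fin a → Fin b → Carrier
  𝟘 _ _ = 0#

  det-lower-unitriangular : (C : Fin b → Fin a → Carrier) → det⊎ (block δ 𝟘 C δ) ≈ 1#
  det-lower-unitriangular {b} {a} C = trans
    (det-triangular λ i j i<j → upper i j i<j (splitAt a i) (splitAt a j) ≡.refl ≡.refl)
    (product-ones {a ℕ.+ b} λ i → ones (splitAt a i))
    where
    ones : ∀ x → block δ 𝟘 C δ x x ≈ 1#
    ones (inj₁ i) = diagonal-≡ (λ _ → 1#) i
    ones (inj₂ i) = diagonal-≡ (λ _ → 1#) i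
    upper : ∀ i j → i Fin.< j → ∀ x y → splitAt a i ≡ x → splitAt a j ≡ y → block δ 𝟘 C δ x y ≈ 0#
    upper i j i<j (inj₁ x) (inj₁ y) p q = diagonal-≢ (λ _ → 1#) λ { ≡.refl → ℕ.<-irrefl
      (≡.cong toℕ (≡.trans (≡.sym (Fin.splitAt⁻¹-↑ˡ p)) (Fin.splitAt⁻¹-↑ˡ q))) i<j }
    upper i j i<j (inj₁ x) (inj₂ y) p q = refl
    upper i j i<j (inj₂ x) (inj₁ y) p q = ⊥-elim (ℕ.<⇒≱ i<j (ℕ.≤-trans (ℕ.<⇒≤ j<a) a≤i))
      where
      j<a : toℕ j ℕ.< a
      j<a = ≡.subst (ℕ._< a) (≡.trans (≡.sym (Fin.toℕ-↑ˡ y b)) (≡.cong toℕ (Fin.splitAt⁻¹-↑ˡ q))) (Fin.toℕ<n y)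
      a≤i : a ℕ.≤ toℕ i
      a≤i = ≡.subst (a ℕ.≤_) (≡.trans (≡.sym (Fin.toℕ-↑ʳ a x)) (≡.cong toℕ (Fin.splitAt⁻¹-↑ʳ p))) (ℕ.m≤m+n a (toℕ x))
    upper i j i<j (inj₂ x) (inj₂ y) p q = diagonal-≢ (λ _ → 1#) λ { ≡.refl → ℕ.<-irrefl
      (≡.cong toℕ (≡.trans (≡.sym (Fin.splitAt⁻¹-↑ʳ p)) (Fin.splitAt⁻¹-↑ʳ q))) i<j }

  private
    δ-sym : (i j : Fin n) → δ i j ≈ δ j i
    δ-sym i j with j Fin.≟ i
    ... | yes ≡.refl = diagonal-≡ (λ _ → 1#) i
    ... | no j≢i = diagonal-≢ (λ _ → 1#) (j≢i ∘ ≡.sym)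

    -- Above `D` stands a zero block, so each of the last columns is linear in the corresponding
    -- column of `D` and uniqueness applies with `A` and `C` frozen.
    det-lower-right : (A : Fin a → Fin a → Carrier) (C : Fin b → Fin a → Carrier) (D : Fin b → Fin b → Carrier) →
      det⊎ (block A 𝟘 C D) ≈ det⊎ (block A 𝟘 C δ) * det D
    det-lower-right {a} {b} A C D = begin
      det⊎ (block A 𝟘 C D)                    ≈⟨ det⊎-cong (λ i j → same (λ j i → D i j) i j) ⟩
      det⊎ (λ i j → W (λ j i → D i j) j i)    ≈⟨ alternating-unique alt (λ j i → D i j) ⟩
      det⊎ (λ i j → W δ j i) * det D          ≈⟨ *-congʳ (det⊎-cong λ i j → sym (trans (δ-flip i j) (same δ i j))) ⟩
      det⊎ (block A 𝟘 C δ) * det D            ∎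
      where
      W : (Fin b → Fin b → Carrier) → Fin a ⊎ Fin b → Fin a ⊎ Fin b → Carrier
      W u (inj₁ j) (inj₁ i) = A i j
      W u (inj₁ j) (inj₂ i) = C i j
      W u (inj₂ j) (inj₁ i) = 0#
      W u (inj₂ j) (inj₂ i) = u j i
      same : ∀ u i j → block A 𝟘 C (λ i j → u j i) i j ≈ W u j i
      same u (inj₁ i) (inj₁ j) = refl
      same u (inj₁ i) (inj₂ j) = refl
      same u (inj₂ i) (inj₁ j) = refl
      same u (inj₂ i) (inj₂ j) = refl
      δ-flip : ∀ i j → block A 𝟘 C δ i j ≈ block A 𝟘 C (λ i j → δ j i) i j
      δ-flip (inj₁ i) (inj₁ j) = refl
      δ-flip (inj₁ i) (inj₂ j) = refl
      δ-flip (inj₂ i) (inj₁ j) = refl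
      δ-flip (inj₂ i) (inj₂ j) = δ-sym i j
      alt : Alternating (λ u → det⊎ (λ i j → W u j i))
      alt = pullback-alternating det⊎-alternating inj₂ (λ { ≡.refl → ≡.refl }) W
        (λ { u≈v (inj₁ j) (inj₁ i) → refl ; u≈v (inj₁ j) (inj₂ i) → refl
           ; u≈v (inj₂ j) (inj₁ i) → refl ; u≈v (inj₂ j) (inj₂ i) → u≈v j i })
        (λ { j u≈w (inj₁ k) k≢ (inj₁ i) → refl ; j u≈w (inj₁ k) k≢ (inj₂ i) → refl
           ; j u≈w (inj₂ k) k≢ (inj₁ i) → refl ; j u≈w (inj₂ k) k≢ (inj₂ i) → u≈w k (k≢ ∘ ≡.cong inj₂) i })
        (λ { j x y w≈ (inj₁ i) → sym (trans (+-cong (zeroʳ x) (zeroʳ y)) (+-identityˡ 0#)) ; j x y w≈ (inj₂ i) → w≈ i })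
        (λ { j k u≈ (inj₁ i) → refl ; j k u≈ (inj₂ i) → u≈ i })

    det-upper-left : (A : Fin a → Fin a → Carrier) → det⊎ {a} {b} (block A 𝟘 𝟘 δ) ≈ det A
    det-upper-left {a} {b} A = begin
      det⊎ (block A 𝟘 𝟘 δ)                    ≈⟨ det⊎-cong (λ i j → same (λ j i → A i j) i j) ⟩
      det⊎ (λ i j → W (λ j i → A i j) j i)    ≈⟨ alternating-unique alt (λ j i → A i j) ⟩
      det⊎ (λ i j → W δ j i) * det A          ≈⟨ *-congʳ (trans (det⊎-cong λ i j → sym (trans (δ-flip i j) (same δ i j))) (det-lower-unitriangular {b} {a} 𝟘)) ⟩
      1# * det A                              ≈⟨ *-identityˡ _ ⟩
      det A                                   ∎
      where
      W : (Fin a → Fin a → Carrier) → Fin a ⊎ Fin b → Fin a ⊎ Fin b → Carrier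
      W u (inj₁ j) (inj₁ i) = u j i
      W u (inj₁ j) (inj₂ i) = 0#
      W u (inj₂ j) (inj₁ i) = 0#
      W u (inj₂ j) (inj₂ i) = δ i j
      same : ∀ u i j → block (λ i j → u j i) 𝟘 𝟘 δ i j ≈ W u j i
      same u (inj₁ i) (inj₁ j) = refl
      same u (inj₁ i) (inj₂ j) = refl
      same u (inj₂ i) (inj₁ j) = refl
      same u (inj₂ i) (inj₂ j) = refl
      δ-flip : ∀ i j → block δ 𝟘 𝟘 δ i j ≈ block (λ i j → δ j i) 𝟘 𝟘 δ i j
      δ-flip (inj₁ i) (inj₁ j) = δ-sym i j
      δ-flip (inj₁ i) (inj₂ j) = refl
      δ-flip (inj₂ i) (inj₁ j) = refl
      δ-flip (inj₂ i) (inj₂ j) = refl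
      alt : Alternating (λ u → det⊎ (λ i j → W u j i))
      alt = pullback-alternating det⊎-alternating inj₁ (λ { ≡.refl → ≡.refl }) W
        (λ { u≈v (inj₁ j) (inj₁ i) → u≈v j i ; u≈v (inj₁ j) (inj₂ i) → refl
           ; u≈v (inj₂ j) (inj₁ i) → refl ; u≈v (inj₂ j) (inj₂ i) → refl })
        (λ { j u≈w (inj₁ k) k≢ (inj₁ i) → u≈w k (k≢ ∘ ≡.cong inj₁) i ; j u≈w (inj₁ k) k≢ (inj₂ i) → refl
           ; j u≈w (inj₂ k) k≢ (inj₁ i) → refl ; j u≈w (inj₂ k) k≢ (inj₂ i) → refl })
        (λ { j x y w≈ (inj₁ i) → w≈ i ; j x y w≈ (inj₂ i) → sym (trans (+-cong (zeroʳ x) (zeroʳ y)) (+-identityˡ 0#)) })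
        (λ { j k u≈ (inj₁ i) → u≈ i ; j k u≈ (inj₂ i) → refl })

  sum-*δ : (t : Vector Carrier n) → ∀ j → sum (λ k → t k * δ k j) ≈ t j
  sum-*δ t j = trans (sum-single {t = λ k → t k * δ k j} j λ k k≢j → trans (*-congˡ (diagonal-≢ (λ _ → 1#) k≢j)) (zeroʳ _))
    (trans (*-congˡ (diagonal-≡ (λ _ → 1#) j)) (*-identityʳ _))

  sum-δ* : (t : Vector Carrier n) → ∀ j → sum (λ k → δ j k * t k) ≈ t j
  sum-δ* t j = trans (sum-cong-≋ λ k → trans (*-comm _ _) (*-congˡ (δ-sym j k))) (sum-*δ t j)

  sum-0* : (t : Vector Carrier n) → sum (λ k → 0# * t k) ≈ 0#
  sum-0* t = sum-zero (λ k → zeroˡ (t k))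

  sum-*0 : (t : Vector Carrier n) → sum (λ k → t k * 0#) ≈ 0#
  sum-*0 t = sum-zero (λ k → zeroʳ (t k))

  -- Once `D` has been split off, `C` shares its columns with `A` and spoils linearity in `A`. The
  -- factorisation [[A, 0], [C, I]] = [[A, 0], [0, I]] [[I, 0], [C, I]] separates the two.
  det-lower-block : (A : Fin a → Fin a → Carrier) (C : Fin b → Fin a → Carrier) (D : Fin b → Fin b → Carrier) →
    det⊎ (block A 𝟘 C D) ≈ det A * det D
  det-lower-block {a} {b} A C D = begin
    det⊎ (block A 𝟘 C D)                                    ≈⟨ det-lower-right A C D ⟩
    det⊎ (block A 𝟘 C δ) * det D                            ≈⟨ *-congʳ (det⊎-cong factor) ⟩
    det⊎ (λ i j → sum (λ k → block A 𝟘 𝟘 δ i (inj₁ k) * block δ 𝟘 C δ (inj₁ k) j)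
                + sum (λ k → block A 𝟘 𝟘 δ i (inj₂ k) * block δ 𝟘 C δ (inj₂ k) j)) * det D
                                                            ≈⟨ *-congʳ (det⊎-* {a} {b} (block A 𝟘 𝟘 δ) (block δ 𝟘 C δ)) ⟩
    det⊎ {a} {b} (block A 𝟘 𝟘 δ) * det⊎ (block δ 𝟘 C δ) * det D
                                                            ≈⟨ *-congʳ (*-cong (det-upper-left {a} {b} A) (det-lower-unitriangular C)) ⟩
    det A * 1# * det D                                      ≈⟨ *-congʳ (*-identityʳ _) ⟩
    det A * det D                                           ∎
    where
    factor : ∀ i j → block A 𝟘 C δ i j ≈
      sum (λ k → block A 𝟘 𝟘 δ i (inj₁ k) * block δ 𝟘 C δ (inj₁ k) j)
      + sum (λ k → block A 𝟘 𝟘 δ i (inj₂ k) * block δ 𝟘 C δ (inj₂ k) j)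
    factor (inj₁ i) (inj₁ j) = sym (trans (+-cong (sum-*δ (A i) j) (sum-0* (λ k → C k j))) (+-identityʳ _))
    factor (inj₁ i) (inj₂ j) = sym (trans (+-cong (sum-*0 (A i)) (sum-0* (λ k → δ k j))) (+-identityʳ _))
    factor (inj₂ i) (inj₁ j) = sym (trans (+-cong (sum-0* (λ k → δ k j)) (sum-δ* (λ k → C k j) i)) (+-identityˡ _))
    factor (inj₂ i) (inj₂ j) = sym (trans (+-cong (sum-0* {a} (λ k → 0#)) (sum-δ* (λ k → δ k j) i)) (+-identityˡ _))

  -- Listing the second group of indices first turns the matrix into a lower triangular one.
  det-upper-block : (A : Fin a → Fin a → Carrier) (B : Fin a → Fin b → Carrier) (D : Fin b → Fin b → Carrier) →
    det⊎ (block A B 𝟘 D) ≈ det A * det D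
  det-upper-block {a} {b} A B D = begin
    det⊎ (block A B 𝟘 D)          ≈⟨ det-reindex Fin.+↔⊎ (⊎-comm _ _ ↔-∘ Fin.+↔⊎) (block A B 𝟘 D) ⟩
    det (λ i j → block A B 𝟘 D (Sum.swap (splitAt b i)) (Sum.swap (splitAt b j))) ≈⟨ det⊎-cong swapped ⟩
    det⊎ (block D 𝟘 B A)          ≈⟨ det-lower-block D B A ⟩
    det D * det A                 ≈⟨ *-comm _ _ ⟩
    det A * det D                 ∎
    where
    swapped : ∀ i j → block A B 𝟘 D (Sum.swap i) (Sum.swap j) ≈ block D 𝟘 B A i j
    swapped (inj₁ i) (inj₁ j) = refl
    swapped (inj₁ i) (inj₂ j) = refl
    swapped (inj₂ i) (inj₁ j) = refl
    swapped (inj₂ i) (inj₂ j) = refl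

-- Determinants of [[P, Q], [Q, P]] and of bipartite matrices.

module SchurDeterminants {c ℓ₁ ℓ₂} (ℝ : RealNumbers c ℓ₁ ℓ₂) where
  open RealNumbers ℝ hiding (zero)
  open Spectral ℝ
  open CommutativeRing commutativeRing using (semiring; ring; *-commutativeMonoid)
  open RingProperties ring using (-‿distribˡ-*; -‿distribʳ-*)
  open SemiringSum semiring hiding (sum)
  open IntegerSolver commutativeRing
  open SetoidReasoning setoid
  open MonoidSum *-commutativeMonoid using () renaming (sum-cong-≋ to product-cong)

  open Determinants ℝ

  open DeterminantProduct ℝ

  open BlockDeterminants ℝ

  private
    variable
      a b n : ℕ

  sum-diagonal* : (d t : Vector Carrier n) → ∀ i → sum (λ k → diagonal d i k * t k) ≈ d i * t i
  sum-diagonal* d t i = trans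
    (sum-single {t = λ k → diagonal d i k * t k} i λ k k≢i → trans (*-congʳ (diagonal-≢ d (k≢i ∘ ≡.sym))) (zeroˡ _))
    (*-congʳ (diagonal-≡ d i))

  sum-*diagonal : (d t : Vector Carrier n) → ∀ j → sum (λ k → t k * diagonal d k j) ≈ t j * d j
  sum-*diagonal d t j = trans
    (sum-single {t = λ k → t k * diagonal d k j} j λ k k≢j → trans (*-congˡ (diagonal-≢ d k≢j)) (zeroʳ _))
    (*-congˡ (diagonal-≡ d j))

  diagonal-* : ∀ x y (i j : Fin n) → x * diagonal (λ _ → y) i j ≈ diagonal (λ _ → x * y) i j
  diagonal-* x y i j with i Fin.≟ j
  ... | yes _ = refl
  ... | no _  = zeroʳ x

  det-diagonal : (d : Vector Carrier n) → det (diagonal d) ≈ product d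
  det-diagonal d = trans (det-triangular λ i j i<j → diagonal-≢ d (λ i≡j → ℕ.<-irrefl (≡.cong toℕ i≡j) i<j))
    (product-cong (diagonal-≡ d))

  block-* : (A A′ : Matrix a) (B B′ : Fin a → Fin b → Carrier) (C C′ : Fin b → Fin a → Carrier) (D D′ : Matrix b) →
    det⊎ (block (λ i j → sum (λ k → A i k * A′ k j) + sum (λ k → B i k * C′ k j))
                (λ i j → sum (λ k → A i k * B′ k j) + sum (λ k → B i k * D′ k j))
                (λ i j → sum (λ k → C i k * A′ k j) + sum (λ k → D i k * C′ k j))
                (λ i j → sum (λ k → C i k * B′ k j) + sum (λ k → D i k * D′ k j)))
    ≈ det⊎ (block A B C D) * det⊎ (block A′ B′ C′ D′)
  block-* {a} {b} A A′ B B′ C C′ D D′ = trans (det⊎-cong {a} {b} {block (λ i j → P (inj₁ i) (inj₁ j)) (λ i j → P (inj₁ i) (inj₂ j)) (λ i j → P (inj₂ i) (inj₁ j)) (λ i j → P (inj₂ i) (inj₂ j))} {P} λ where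
      (inj₁ i) (inj₁ j) → refl
      (inj₁ i) (inj₂ j) → refl
      (inj₂ i) (inj₁ j) → refl
      (inj₂ i) (inj₂ j) → refl)
    (det⊎-* {a} {b} M N)
    where
    M = block A B C D
    N = block A′ B′ C′ D′
    P : Fin a ⊎ Fin b → Fin a ⊎ Fin b → Carrier
    P i j = sum (λ k → M i (inj₁ k) * N (inj₁ k) j) + sum (λ k → M i (inj₂ k) * N (inj₂ k) j)

  block-cong : {A A′ : Matrix a} {B B′ : Fin a → Fin b → Carrier} {C C′ : Fin b → Fin a → Carrier} {D D′ : Matrix b} →
    (∀ i j → A i j ≈ A′ i j) → (∀ i j → B i j ≈ B′ i j) → (∀ i j → C i j ≈ C′ i j) → (∀ i j → D i j ≈ D′ i j) →
    det⊎ (block A B C D) ≈ det⊎ (block A′ B′ C′ D′)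
  block-cong {a} {b} {A} {A′} {B} {B′} {C} {C′} {D} {D′} A≈ B≈ C≈ D≈ = det⊎-cong {a} {b} {block A B C D} {block A′ B′ C′ D′} λ where
    (inj₁ i) (inj₁ j) → A≈ i j
    (inj₁ i) (inj₂ j) → B≈ i j
    (inj₂ i) (inj₁ j) → C≈ i j
    (inj₂ i) (inj₂ j) → D≈ i j

  -- Conjugation by [[I, I], [0, I]] makes the matrix block triangular.
  det-circulant : (P Q : Matrix n) →
    det⊎ (block P Q Q P) ≈ det (λ i j → P i j + Q i j) * det (λ i j → P i j - Q i j)
  det-circulant {n} P Q = begin
    det⊎ (block P Q Q P)                             ≈⟨ *-identityˡ _ ⟨
    1# * det⊎ (block P Q Q P)                        ≈⟨ *-congʳ (det-shear δ) ⟨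
    det⊎ {n} {n} (block δ δ 𝟘 δ) * det⊎ (block P Q Q P) ≈⟨ block-* δ P δ Q 𝟘 Q δ P ⟨
    _                                                ≈⟨ block-cong
                                                          (λ i j → +-cong (sum-δ* (λ k → P k j) i) (sum-δ* (λ k → Q k j) i))
                                                          (λ i j → trans (+-comm _ _) (+-cong (sum-δ* (λ k → P k j) i) (sum-δ* (λ k → Q k j) i)))
                                                          (λ i j → trans (+-cong (sum-0* (λ k → P k j)) (sum-δ* (λ k → Q k j) i)) (+-identityˡ _))
                                                          (λ i j → trans (+-cong (sum-0* (λ k → Q k j)) (sum-δ* (λ k → P k j) i)) (+-identityˡ _)) ⟩
    det⊎ (block S S Q P)                             ≈⟨ *-identityʳ _ ⟨
    det⊎ (block S S Q P) * 1#                        ≈⟨ *-congˡ {det⊎ (block S S Q P)} (det-shear -δ) ⟨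
    det⊎ (block S S Q P) * det⊎ {n} {n} (block δ -δ 𝟘 δ)    ≈⟨ block-* S δ S -δ Q 𝟘 P δ ⟨
    _                                                ≈⟨ block-cong
                                                          (λ i j → trans (+-cong (sum-*δ (S i) j) (sum-*0 (S i))) (+-identityʳ _))
                                                          (λ i j → trans (+-cong (sum-*-δ (S i) j) (sum-*δ (S i) j)) (-‿inverseˡ _))
                                                          (λ i j → trans (+-cong (sum-*δ (Q i) j) (sum-*0 (P i))) (+-identityʳ _))
                                                          (λ i j → trans (+-cong (sum-*-δ (Q i) j) (sum-*δ (P i) j)) (+-comm _ _)) ⟩
    det⊎ (block S 𝟘 Q (λ i j → P i j - Q i j))       ≈⟨ det-lower-block S Q _ ⟩
    det S * det (λ i j → P i j - Q i j)              ∎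
    where
    S -δ : Matrix n
    S i j = P i j + Q i j
    -δ i j = - δ i j
    det-shear : ∀ B → det⊎ (block δ B 𝟘 δ) ≈ 1#
    det-shear B = trans (det-upper-block {n} {n} δ B δ)
      (trans (*-cong (det-diagonal {n} (λ _ → 1#)) (det-diagonal {n} (λ _ → 1#)))
        (trans (*-cong (product-ones {n} (λ _ → refl)) (product-ones {n} (λ _ → refl))) (*-identityˡ _)))
    sum-*-δ : (t : Vector Carrier n) → ∀ j → sum (λ k → t k * -δ k j) ≈ - t j
    sum-*-δ t j = begin
      sum (λ k → t k * -δ k j)    ≈⟨ sum-cong-≋ (λ k → trans (sym (-‿distribʳ-* (t k) (δ k j))) (-‿distribˡ-* (t k) (δ k j))) ⟩
      sum (λ k → - t k * δ k j)   ≈⟨ sum-*δ (λ k → - t k) j ⟩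
      - t j                       ∎

  -- Multiplication by [[y I, B], [0, I]] on the left clears the upper right block.
  det-bipartite : (B : Fin a → Fin b → Carrier) (L : Matrix a) → (∀ i j → L i j ≈ sum (λ k → B i k * B j k)) → ∀ y →
    product {a} (λ _ → y) * det⊎ (block (diagonal (λ _ → y)) (λ i j → - B i j) (λ i j → - B j i) (diagonal (λ _ → y)))
    ≈ charPoly L (y * y) * product {b} (λ _ → y)
  det-bipartite {a} {b} B L L≈ y = begin
    product {a} (λ _ → y) * det⊎ N                   ≈⟨ *-congʳ (trans (det-upper-block {a} {b} Y B δ)
                                                          (trans (*-cong (det-diagonal {a} (λ _ → y)) (trans (det-diagonal {b} (λ _ → 1#)) (product-ones {b} (λ _ → refl)))) (*-identityʳ _))) ⟨
    det⊎ (block Y B 𝟘 δ) * det⊎ N                    ≈⟨ block-* Y Y B (λ i j → - B i j) 𝟘 (λ i j → - B j i) δ Y ⟨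
    _                                                ≈⟨ block-cong upper-left upper-right
                                                          (λ i j → trans (+-cong (sum-0* (λ k → Y k j)) (sum-δ* (λ k → - B j k) i)) (+-identityˡ _))
                                                          (λ i j → trans (+-cong (sum-0* (λ k → - B k j)) (sum-δ* (λ k → Y k j) i)) (+-identityˡ _)) ⟩
    det⊎ (block (diagonal (λ _ → y * y) -ᴹ L) 𝟘 (λ i j → - B j i) Y) ≈⟨ det-lower-block {a} {b} _ _ _ ⟩
    charPoly L (y * y) * det {b} Y                   ≈⟨ *-congˡ (det-diagonal {b} (λ _ → y)) ⟩
    charPoly L (y * y) * product {b} (λ _ → y)       ∎
    where
    Y : ∀ {n} → Matrix n
    Y = diagonal (λ _ → y)
    N : Fin a ⊎ Fin b → Fin a ⊎ Fin b → Carrier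
    N = block Y (λ i j → - B i j) (λ i j → - B j i) Y
    upper-left : ∀ i j → sum (λ k → Y i k * Y k j) + sum (λ k → B i k * - B j k) ≈ diagonal (λ _ → y * y) i j - L i j
    upper-left i j = +-cong (trans (sum-diagonal* (λ _ → y) (λ k → Y k j) i) (diagonal-* y y i j)) (begin
      sum (λ k → B i k * - B j k)      ≈⟨ sum-cong-≋ (λ k → solve 2 (λ x y → x :* :- y := con (ℤ.-[1+ 0 ]) :* (x :* y)) refl (B i k) (B j k)) ⟩
      sum (λ k → - 1# * (B i k * B j k)) ≈⟨ *-distribˡ-sum (- 1#) (λ k → B i k * B j k) ⟨
      - 1# * sum (λ k → B i k * B j k) ≈⟨ *-congˡ (L≈ i j) ⟨
      - 1# * L i j                     ≈⟨ solve 1 (λ x → con (ℤ.-[1+ 0 ]) :* x := :- x) refl (L i j) ⟩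
      - L i j                          ∎)
    upper-right : ∀ i j → sum (λ k → Y i k * - B k j) + sum (λ k → B i k * Y k j) ≈ 0#
    upper-right i j = begin
      sum (λ k → Y i k * - B k j) + sum (λ k → B i k * Y k j) ≈⟨ +-cong (sum-diagonal* (λ _ → y) (λ k → - B k j) i) (sum-*diagonal (λ _ → y) (B i) j) ⟩
      y * - B i j + B i j * y          ≈⟨ solve 2 (λ x y → y :* :- x :+ x :* y := :0) refl (B i j) y ⟩
      0#                               ∎

-- Constructive order arithmetic and absolute values.

module OrderedField {c ℓ₁ ℓ₂} (ℝ : RealNumbers c ℓ₁ ℓ₂) where
  open RealNumbers ℝ hiding (zero)
  open CommutativeRing commutativeRing using (ring)
  open RingProperties ring using (-‿involutive)
  open IntegerSolver commutativeRing
  open IsStrictPartialOrder <-isStrictPartialOrder public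
    using () renaming (trans to <-trans; irrefl to <-irrefl; <-respˡ-≈ to <-respˡ; <-respʳ-≈ to <-respʳ)

  private
    variable
      x y z w : Carrier
      n : ℕ

  <-resp : x ≈ y → z ≈ w → x < z → y < w
  <-resp x≈y z≈w x<z = <-respʳ z≈w (<-respˡ x≈y x<z)

  -- Apartness is cotransitive, and if `z` turns out to lie on the wrong side of one end,
  -- transitivity places it with respect to the other. This is the substitute for trichotomy.
  <-cotrans : x < y → ∀ z → x < z ⊎ z < y
  <-cotrans {x} {y} x<y z with #-cotrans (Equivalence.from (#⇔<⊎> x y) (inj₁ x<y)) z
  ... | inj₁ x#z with Equivalence.to (#⇔<⊎> x z) x#z
  ...   | inj₁ x<z = inj₁ x<z
  ...   | inj₂ z<x = inj₂ (<-trans z<x x<y)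
  <-cotrans {x} {y} x<y z | inj₂ z#y with Equivalence.to (#⇔<⊎> z y) z#y
  ...   | inj₁ z<y = inj₂ z<y
  ...   | inj₂ y<z = inj₁ (<-trans x<y y<z)

  ≤-antisym : x ≤ y → y ≤ x → x ≈ y
  ≤-antisym {x} {y} x≤y y≤x = proj₁ (tight x y) λ x#y → case (Equivalence.to (#⇔<⊎> x y) x#y)
    where
    case : x < y ⊎ y < x → ⊥
    case (inj₁ x<y) = y≤x x<y
    case (inj₂ y<x) = x≤y y<x

  -- By tightness an equality is a negated apartness. It permits case distinctions under a
  -- contradiction, notably in matching the roots of two products.
  ≈-stable : ¬ ¬ (x ≈ y) → x ≈ y
  ≈-stable ¬¬x≈y = proj₁ (tight _ _) λ x#y → ¬¬x≈y λ x≈y → proj₂ (tight _ _) x≈y x#y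

  ≤-reflexive : x ≈ y → x ≤ y
  ≤-reflexive x≈y y<x = <-irrefl (sym x≈y) y<x

  ≤-refl : x ≤ x
  ≤-refl = ≤-reflexive refl

  <⇒≤ : x < y → x ≤ y
  <⇒≤ x<y y<x = <-irrefl refl (<-trans x<y y<x)

  <-≤-trans : x < y → y ≤ z → x < z
  <-≤-trans {z = z} x<y y≤z with <-cotrans x<y z
  ... | inj₁ x<z = x<z
  ... | inj₂ z<y = ⊥-elim (y≤z z<y)

  ≤-<-trans : x ≤ y → y < z → x < z
  ≤-<-trans {x} x≤y y<z with <-cotrans y<z x
  ... | inj₁ y<x = ⊥-elim (x≤y y<x)
  ... | inj₂ x<z = x<z

  ≤-trans : x ≤ y → y ≤ z → x ≤ z
  ≤-trans x≤y y≤z z<x = x≤y (≤-<-trans y≤z z<x)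

  ≤-resp : x ≈ y → z ≈ w → x ≤ z → y ≤ w
  ≤-resp x≈y z≈w x≤z w<y = x≤z (<-resp (sym z≈w) (sym x≈y) w<y)

  diff-pos : x < y → 0# < y - x
  diff-pos {x} {y} x<y = <-respˡ (-‿inverseʳ x) (+-monoˡ-< (- x) x<y)

  pos-diff : 0# < y - x → x < y
  pos-diff {y} {x} 0<y-x = <-resp (+-identityˡ x) (solve 2 (λ x y → (y :- x) :+ x := y) refl x y) (+-monoˡ-< x 0<y-x)

  diff-nonneg : x ≤ y → 0# ≤ y - x
  diff-nonneg {x} {y} x≤y y-x<0 = x≤y
    (<-resp (solve 2 (λ x y → (y :- x) :+ x := y) refl x y) (+-identityˡ x) (+-monoˡ-< x y-x<0))

  nonneg-diff : 0# ≤ y - x → x ≤ y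
  nonneg-diff {y} {x} 0≤y-x y<x = 0≤y-x (<-respʳ (-‿inverseʳ x) (+-monoˡ-< (- x) y<x))

  +-pos-nonneg : 0# < x → 0# ≤ y → 0# < x + y
  +-pos-nonneg {x} {y} 0<x 0≤y = ≤-<-trans 0≤y (<-respˡ (+-identityˡ y) (+-monoˡ-< y 0<x))

  +-nonneg : 0# ≤ x → 0# ≤ y → 0# ≤ x + y
  +-nonneg {x} {y} 0≤x 0≤y x+y<0 = 0≤x (<-≤-trans (pos-diff (<-respʳ
    (solve 2 (λ x y → :0 :- (x :+ y) := :- y :- x) refl x y) (diff-pos x+y<0)))
    (nonneg-diff (≤-resp refl (solve 1 (λ y → y := :0 :- :- y) refl y) 0≤y)))

  +-mono-≤ : x ≤ y → z ≤ w → x + z ≤ y + w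
  +-mono-≤ {x} {y} {z} {w} x≤y z≤w = nonneg-diff (≤-resp refl
    (solve 4 (λ x y z w → (y :- x) :+ (w :- z) := (y :+ w) :- (x :+ z)) refl x y z w)
    (+-nonneg (diff-nonneg x≤y) (diff-nonneg z≤w)))

  +-mono-<-≤ : x < y → z ≤ w → x + z < y + w
  +-mono-<-≤ {x} {y} {z} {w} x<y z≤w = pos-diff (<-respʳ
    (solve 4 (λ x y z w → (y :- x) :+ (w :- z) := (y :+ w) :- (x :+ z)) refl x y z w)
    (+-pos-nonneg (diff-pos x<y) (diff-nonneg z≤w)))

  -- Assume the product is negative. If x were positive, y could not be, so y and the product would
  -- be 0; hence x is 0 and the product is 0 again.
  *-nonneg : 0# ≤ x → 0# ≤ y → 0# ≤ x * y
  *-nonneg {x} {y} 0≤x 0≤y xy<0 = <-irrefl (trans (*-congʳ x≈0) (zeroˡ y)) xy<0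
    where
    x≈0 : x ≈ 0#
    x≈0 = ≤-antisym (λ 0<x → <-irrefl (trans (*-congˡ (≤-antisym (λ 0<y → <⇒≤ xy<0 (*-pos 0<x 0<y)) 0≤y)) (zeroʳ x)) xy<0) 0≤x

  0<1 : 0# < 1#
  0<1 with Equivalence.to (#⇔<⊎> 1# 0#) 1#0
    where
    1#0 : 1# # 0#
    1#0 = invertible⇒# (1# , solve 0 (:1 :* (:1 :- :0) := :1) refl , solve 0 ((:1 :- :0) :* :1 := :1) refl)
  ... | inj₂ 0<1 = 0<1
  ... | inj₁ 1<0 = <-respʳ (solve 0 ((:0 :- :1) :* (:0 :- :1) := :1) refl) (*-pos (diff-pos 1<0) (diff-pos 1<0))

  0≤n·1 : ∀ n → 0# ≤ n · 1#
  0≤n·1 zero    = ≤-refl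
  0≤n·1 (suc n) = +-nonneg (<⇒≤ 0<1) (0≤n·1 n)

  0<1+n·1 : ∀ n → 0# < suc n · 1#
  0<1+n·1 n = +-pos-nonneg 0<1 (0≤n·1 n)

  ·1-mono-≤ : ∀ {m n} → m ℕ.≤ n → m · 1# ≤ n · 1#
  ·1-mono-≤ {n = n} ℕ.z≤n = 0≤n·1 n
  ·1-mono-≤ (ℕ.s≤s m≤n) = +-mono-≤ ≤-refl (·1-mono-≤ m≤n)

  inverse : 0# < x → ∃ λ y → 0# < y × x * y ≈ 1#
  inverse {x} 0<x with #⇒invertible (Equivalence.from (#⇔<⊎> x 0#) (inj₂ 0<x))
  ... | y , left , right with Equivalence.to (#⇔<⊎> y 0#) (invertible⇒# (x , trans (+-zeroʳ′ x y) xy≈1 , trans (*-comm _ _) (trans (+-zeroʳ′ x y) xy≈1)))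
    where
    xy≈1 : x * y ≈ 1#
    xy≈1 = trans (solve 2 (λ x y → x :* y := (x :- :0) :* y) refl x y) right
    +-zeroʳ′ : ∀ x y → x * (y - 0#) ≈ x * y
    +-zeroʳ′ = solve 2 (λ x y → x :* (y :- :0) := x :* y) refl
  ...   | inj₂ 0<y = y , 0<y , trans (solve 2 (λ x y → x :* y := (x :- :0) :* y) refl x y) right
  -- A negative inverse would make x times -y, which is -1, positive.
  ...   | inj₁ y<0 = ⊥-elim (<⇒≤ 0<1 (pos-diff (<-respʳ
          (trans (solve 2 (λ x y → x :* (:0 :- y) := :0 :- (x :- :0) :* y) refl x y) (+-congˡ (-‿cong right)))
          (*-pos 0<x (diff-pos y<0)))))

  *-cancel-pos : 0# < x → 0# < x * y → 0# < y
  *-cancel-pos {x} {y} 0<x 0<xy with z , 0<z , xz≈1 ← inverse 0<x =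
    <-respʳ (trans (solve 3 (λ x y z → z :* (x :* y) := (x :* z) :* y) refl x y z) (trans (*-congʳ xz≈1) (*-identityˡ y)))
      (*-pos 0<z 0<xy)

  *-cancel-<ˡ : 0# < x → x * y < x * z → y < z
  *-cancel-<ˡ {x} {y} {z} 0<x xy<xz = pos-diff (*-cancel-pos 0<x
    (<-respʳ (solve 3 (λ x y z → x :* z :- x :* y := x :* (z :- y)) refl x y z) (diff-pos xy<xz)))

  *-monoˡ-< : 0# < x → y < z → x * y < x * z
  *-monoˡ-< {x} {y} {z} 0<x y<z = pos-diff
    (<-respʳ (solve 3 (λ x y z → x :* (z :- y) := x :* z :- x :* y) refl x y z) (*-pos 0<x (diff-pos y<z)))

  *-monoˡ-≤ : 0# ≤ x → y ≤ z → x * y ≤ x * z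
  *-monoˡ-≤ {x} {y} {z} 0≤x y≤z = nonneg-diff
    (≤-resp refl (solve 3 (λ x y z → x :* (z :- y) := x :* z :- x :* y) refl x y z) (*-nonneg 0≤x (diff-nonneg y≤z)))

  *-cancel-≤ˡ : 0# < x → x * y ≤ x * z → y ≤ z
  *-cancel-≤ˡ 0<x xy≤xz z<y = xy≤xz (*-monoˡ-< 0<x z<y)

  *-mono-≤ : 0# ≤ x → x ≤ y → 0# ≤ z → z ≤ w → x * z ≤ y * w
  *-mono-≤ 0≤x x≤y 0≤z z≤w = ≤-trans (*-monoˡ-≤ 0≤x z≤w)
    (≤-resp (*-comm _ _) (*-comm _ _) (*-monoˡ-≤ (≤-trans 0≤z z≤w) x≤y))

  square-mono-< : 0# ≤ x → x < y → x * x < y * y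
  square-mono-< 0≤x x<y = ≤-<-trans (*-monoˡ-≤ 0≤x (<⇒≤ x<y))
    (<-respˡ (*-comm _ _) (*-monoˡ-< (≤-<-trans 0≤x x<y) x<y))

  square-cancel-≤ : 0# ≤ y → x * x ≤ y * y → x ≤ y
  square-cancel-≤ 0≤y xx≤yy y<x = xx≤yy (square-mono-< 0≤y y<x)

  square-cancel-< : 0# < x → 0# < y → x * x < y * y → x < y
  square-cancel-< {x} {y} 0<x 0<y xx<yy = pos-diff (*-cancel-pos (+-pos-nonneg 0<x (<⇒≤ 0<y))
    (<-respʳ (solve 2 (λ x y → y :* y :- x :* x := (x :+ y) :* (y :- x)) refl x y) (diff-pos xx<yy)))

  ≤-∣∣ : ∀ x → x ≤ ∣ x ∣
  ≤-∣∣ x = proj₁ (∨ʳ-supremum x (- x))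

  -≤-∣∣ : ∀ x → - x ≤ ∣ x ∣
  -≤-∣∣ x = proj₁ (proj₂ (∨ʳ-supremum x (- x)))

  ∣∣-least : x ≤ y → - x ≤ y → ∣ x ∣ ≤ y
  ∣∣-least {x} {y} = proj₂ (proj₂ (∨ʳ-supremum x (- x))) y

  -- The supremum is specified through `≤` alone. Strictness follows because the absolute value
  -- cannot exceed both x and -x: exceeding x forces x ≤ -x, and then -x is already an upper bound.
  ∣∣-< : x < y → - x < y → ∣ x ∣ < y
  ∣∣-< {x} {y} x<y -x<y with <-cotrans x<y ∣ x ∣ | <-cotrans -x<y ∣ x ∣
  ... | inj₂ ∣x∣<y | _          = ∣x∣<y
  ... | inj₁ _     | inj₂ ∣x∣<y = ∣x∣<y
  ... | inj₁ x<∣x∣ | inj₁ -x<∣x∣ = ⊥-elim (∣∣-least (λ -x<x → ∣∣-least ≤-refl (<⇒≤ -x<x) x<∣x∣) ≤-refl -x<∣x∣)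

  ∣∣-nonneg : 0# ≤ x → ∣ x ∣ ≈ x
  ∣∣-nonneg {x} 0≤x = ≤-antisym (∣∣-least ≤-refl (nonneg-diff (≤-resp refl (solve 1 (λ x → x :+ x := x :- :- x) refl x) (+-nonneg 0≤x 0≤x)))) (≤-∣∣ x)

  ∣∣-cong : x ≈ y → ∣ x ∣ ≈ ∣ y ∣
  ∣∣-cong {x} {y} x≈y = ≤-antisym
    (∣∣-least (≤-resp (sym x≈y) refl (≤-∣∣ y)) (≤-resp (-‿cong (sym x≈y)) refl (-≤-∣∣ y)))
    (∣∣-least (≤-resp x≈y refl (≤-∣∣ x)) (≤-resp (-‿cong x≈y) refl (-≤-∣∣ x)))

  ∣∣-neg : ∀ x → ∣ - x ∣ ≈ ∣ x ∣
  ∣∣-neg x = ≤-antisym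
    (∣∣-least (-≤-∣∣ x) (≤-resp (sym (-‿involutive x)) refl (≤-∣∣ x)))
    (∣∣-least (≤-resp (-‿involutive x) refl (-≤-∣∣ (- x))) (≤-∣∣ (- x)))

-- Square roots of positive reals by Heron's method.

module SquareRoot {c ℓ₁ ℓ₂} (ℝ : RealNumbers c ℓ₁ ℓ₂) where
  open RealNumbers ℝ hiding (zero)
  open IntegerSolver commutativeRing
  open OrderedField ℝ

  -- The properties of the nested intervals that the limit argument consumes, apart from how they
  -- are computed: the ends multiply to `a`, and the widths at least halve.
  module HalvingIntervals (a : Carrier) (s r : ℕ → Carrier)
    (0<r : ∀ n → 0# < r n) (r≤s : ∀ n → r n ≤ s n) (sr≈a : ∀ n → s n * r n ≈ a)
    (s-decreasing : ∀ n → s (suc n) ≤ s n) (r-increasing : ∀ n → r n ≤ r (suc n))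
    (width-halves : ∀ n → (1# + 1#) * (s (suc n) - r (suc n)) ≤ s n - r n) where

    width : ℕ → Carrier
    width n = s n - r n

    0<s : ∀ n → 0# < s n
    0<s n = <-≤-trans (0<r n) (r≤s n)

    0≤width : ∀ n → 0# ≤ width n
    0≤width n = diff-nonneg (r≤s n)

    s-antitone′ : ∀ n k → s (k ℕ.+ n) ≤ s n
    s-antitone′ n zero    = ≤-refl
    s-antitone′ n (suc k) = ≤-trans (s-decreasing (k ℕ.+ n)) (s-antitone′ n k)

    r-monotone′ : ∀ n k → r n ≤ r (k ℕ.+ n)
    r-monotone′ n zero    = ≤-refl
    r-monotone′ n (suc k) = ≤-trans (r-monotone′ n k) (r-increasing (k ℕ.+ n))

    s-antitone : ∀ {m n} → m ℕ.≤ n → s n ≤ s m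
    s-antitone {m} m≤n = ≡.subst (λ k → s k ≤ s m) (ℕ.m∸n+n≡m m≤n) (s-antitone′ m _)

    r-monotone : ∀ {m n} → m ℕ.≤ n → r m ≤ r n
    r-monotone {m} m≤n = ≡.subst (λ k → r m ≤ r k) (ℕ.m∸n+n≡m m≤n) (r-monotone′ m _)

    -- Halving is weakened to decay like 1/(n + 1), the form that the Archimedean axiom meets
    -- directly. The induction step is (n + 2) w ≤ (n + 1) 2w.
    width-bound : ∀ n → (suc n · 1#) * width n ≤ width 0
    width-bound zero    = ≤-reflexive (solve 1 (λ w → (:1 :+ :0) :* w := w) refl (width 0))
    width-bound (suc n) = ≤-trans
      (nonneg-diff (≤-resp refl (solve 2 (λ m w → m :* w := (:1 :+ m) :* ((:1 :+ :1) :* w) :- (:1 :+ (:1 :+ m)) :* w) refl (n · 1#) (width (suc n)))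
        (*-nonneg (0≤n·1 n) (0≤width (suc n)))))
      (≤-trans (*-monoˡ-≤ (0≤n·1 (suc n)) (width-halves n)) (width-bound n))

    width-small : ∀ ε → 0# < ε → ∃ λ n → width n < ε
    width-small ε 0<ε with η , 0<η , εη≈1 ← inverse 0<ε with n , w<n ← archimedean (width 0 * η) =
      n , *-cancel-<ˡ (0<1+n·1 n) (≤-<-trans (width-bound n) (<-≤-trans
        (<-respˡ (trans (solve 3 (λ w e i → e :* (w :* i) := w :* (e :* i)) refl (width 0) ε η) (trans (*-congˡ εη≈1) (*-identityʳ _))) (*-monoˡ-< 0<ε w<n))
        (≤-resp refl (*-comm _ _) (*-monoˡ-≤ (<⇒≤ 0<ε) (·1-mono-≤ (ℕ.n≤1+n n))))))

    s-cauchy : IsCauchy s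
    s-cauchy ε 0<ε = N , λ m n N≤m N≤n →
      ∣∣-< (close m n N≤m N≤n) (<-respˡ (solve 2 (λ x y → y :- x := :- (x :- y)) refl (s m) (s n)) (close n m N≤n N≤m))
      where
      N = proj₁ (width-small ε 0<ε)
      difference : ∀ x y z w → (x - y) + (z - w) ≈ (x - w) - (y - z)
      difference = solve 4 (λ x y z w → (x :- y) :+ (z :- w) := (x :- w) :- (y :- z)) refl
      close : ∀ m n → N ℕ.≤ m → N ℕ.≤ n → s m - s n < ε
      close m n N≤m N≤n = ≤-<-trans (nonneg-diff (≤-resp refl (difference (s N) (s m) (s n) (r N))
          (+-nonneg (diff-nonneg (s-antitone N≤m)) (diff-nonneg (≤-trans (r-monotone N≤n) (r≤s n))))))
        (proj₂ (width-small ε 0<ε))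

    root : Carrier
    root = proj₁ (complete s s-cauchy)

    converges : s ConvergesTo root
    converges = proj₂ (complete s s-cauchy)

    r≤root : ∀ n → r n ≤ root
    r≤root n x<r = let N , close = converges (r n - root) (diff-pos x<r) in
      ≤-trans (r-monotone (ℕ.m≤m⊔n n N)) (r≤s (n ℕ.⊔ N))
        (pos-diff (<-respʳ (solve 3 (λ r x s → (r :- x) :- (s :- x) := r :- s) refl (r n) root (s (n ℕ.⊔ N)))
          (diff-pos (≤-<-trans (≤-∣∣ _) (close (n ℕ.⊔ N) (ℕ.m≤n⊔m n N))))))

    root≤s : ∀ n → root ≤ s n
    root≤s n s<x = let N , close = converges (root - s n) (diff-pos s<x) in
      s-antitone (ℕ.m≤m⊔n n N)
        (pos-diff (<-respʳ (solve 3 (λ t x s → (x :- t) :- :- (s :- x) := s :- t) refl (s n) root (s (n ℕ.⊔ N)))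
          (diff-pos (≤-<-trans (-≤-∣∣ _) (close (n ℕ.⊔ N) (ℕ.m≤n⊔m n N))))))

    0<root : 0# < root
    0<root = <-≤-trans (0<r 0) (r≤root 0)

    -- s² - r² = (s - r)(s + r), and s + r never exceeds twice the initial upper bound, so a width
    -- below ε / (2 s₀) is enough.
    squares-close : ∀ ε → 0# < ε → ∃ λ n → s n * s n - r n * r n < ε
    squares-close ε 0<ε = n , ≤-<-trans
      (nonneg-diff (≤-resp refl (difference (s 0) (s n) (r n))
        (*-nonneg (0≤width n) (+-nonneg (diff-nonneg (s-antitone ℕ.z≤n)) (diff-nonneg (≤-trans (r≤s n) (s-antitone ℕ.z≤n)))))))
      (<-respʳ (trans (rearrange (s 0 + s 0) ε t) (trans (*-congˡ 2s₀t≈1) (*-identityʳ ε)))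
        (*-monoˡ-< 0<2s₀ (proj₂ small)))
      where
      0<2s₀ : 0# < s 0 + s 0
      0<2s₀ = +-pos-nonneg (0<s 0) (<⇒≤ (0<s 0))
      t = proj₁ (inverse 0<2s₀)
      2s₀t≈1 : (s 0 + s 0) * t ≈ 1#
      2s₀t≈1 = proj₂ (proj₂ (inverse 0<2s₀))
      small : ∃ λ n → width n < ε * t
      small = width-small (ε * t) (*-pos 0<ε (proj₁ (proj₂ (inverse 0<2s₀))))
      n = proj₁ small
      difference : ∀ s₀ s r → (s - r) * ((s₀ - s) + (s₀ - r)) ≈ (s₀ + s₀) * (s - r) - (s * s - r * r)
      difference = solve 3 (λ s₀ s r → (s :- r) :* ((s₀ :- s) :+ (s₀ :- r)) := (s₀ :+ s₀) :* (s :- r) :- (s :* s :- r :* r)) refl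
      rearrange : ∀ d e t → d * (e * t) ≈ e * (d * t)
      rearrange = solve 3 (λ d e t → d :* (e :* t) := e :* (d :* t)) refl

    r²≤a : ∀ n → r n * r n ≤ a
    r²≤a n = ≤-resp refl (trans (*-comm _ _) (sr≈a n)) (*-monoˡ-≤ (<⇒≤ (0<r n)) (r≤s n))

    a≤s² : ∀ n → a ≤ s n * s n
    a≤s² n = ≤-resp (sr≈a n) refl (*-monoˡ-≤ (<⇒≤ (0<s n)) (r≤s n))

    -- Both numbers lie between r² and s² at every stage. Were they a positive distance apart, some
    -- stage would have s² - r² smaller than that distance.
    root²≈a : root * root ≈ a
    root²≈a = ≤-antisym above below
      where
      above : root * root ≤ a
      above a<x² = let n , close = squares-close _ (diff-pos a<x²) in
        +-mono-≤ (*-mono-≤ (<⇒≤ 0<root) (root≤s n) (<⇒≤ 0<root) (root≤s n))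
          (nonneg-diff (≤-resp refl (solve 2 (λ a r → a :- r := :- r :- :- a) refl a (r n * r n)) (diff-nonneg (r²≤a n)))) close
      below : a ≤ root * root
      below x²<a = let n , close = squares-close _ (diff-pos x²<a) in
        +-mono-≤ (a≤s² n)
          (nonneg-diff (≤-resp refl (solve 2 (λ a r → a :- r := :- r :- :- a) refl (root * root) (r n * r n))
            (diff-nonneg (*-mono-≤ (<⇒≤ (0<r n)) (r≤root n) (<⇒≤ (0<r n)) (r≤root n))))) close

  module _ (a : Carrier) (0<a : 0# < a) where

    record Bracket : Set (c ⊔ ℓ₁ ⊔ ℓ₂) where
      field
        upper lower : Carrier
        0<upper     : 0# < upper
        0<lower     : 0# < lower
        lower≤upper : lower ≤ upper
        product≈a   : upper * lower ≈ a

    open Bracket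

    private
      half-inverse : ∃ λ h → 0# < h × (1# + 1#) * h ≈ 1#
      half-inverse = inverse (+-pos-nonneg 0<1 (<⇒≤ 0<1))
      h = proj₁ half-inverse
      0<h = proj₁ (proj₂ half-inverse)
      2h≈1 : (1# + 1#) * h ≈ 1#
      2h≈1 = proj₂ (proj₂ half-inverse)

      -- The lower end is a/s. Every s with a ≤ s² is admissible; `1# + a` always is, which starts
      -- the iteration, and means are by the arithmetic-geometric inequality.
      bracket : ∀ s → 0# < s → a ≤ s * s → Bracket
      bracket s 0<s a≤ss with t , 0<t , st≈1 ← inverse 0<s = record
        { upper = s ; lower = a * t ; 0<upper = 0<s ; 0<lower = *-pos 0<a 0<t
        ; lower≤upper = *-cancel-≤ˡ 0<s (≤-resp (sym s*at≈a) refl a≤ss)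
        ; product≈a = s*at≈a }
        where
        s*at≈a : s * (a * t) ≈ a
        s*at≈a = trans (solve 3 (λ s a t → s :* (a :* t) := a :* (s :* t)) refl s a t) (trans (*-congˡ st≈1) (*-identityʳ a))

      module Step (b : Bracket) where
        s = upper b
        r = lower b
        mean : Carrier
        mean = h * (s + r)
        0<mean : 0# < mean
        0<mean = *-pos 0<h (+-pos-nonneg (0<upper b) (<⇒≤ (0<lower b)))
        a≤mean² : a ≤ mean * mean
        a≤mean² = nonneg-diff (≤-resp refl eq (*-nonneg 0≤q 0≤q))
          where
          0≤q : 0# ≤ h * (s - r)
          0≤q = *-nonneg (<⇒≤ 0<h) (diff-nonneg (lower≤upper b))
          -- With h = 1/2 and sr = a, the excess of mean² over `a` is the square of half the width.
          eq : (h * (s - r)) * (h * (s - r)) ≈ mean * mean - a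
          eq = begin
            (h * (s - r)) * (h * (s - r)) ≈⟨ solve 3 (λ h s r → (h :* (s :- r)) :* (h :* (s :- r)) := (h :* (s :+ r)) :* (h :* (s :+ r)) :- (((:1 :+ :1) :* h) :* ((:1 :+ :1) :* h)) :* (s :* r)) refl h s r ⟩
            mean * mean - (((1# + 1#) * h) * ((1# + 1#) * h)) * (s * r) ≈⟨ +-congˡ (-‿cong (*-cong (*-cong 2h≈1 2h≈1) (product≈a b))) ⟩
            mean * mean - (1# * 1#) * a ≈⟨ solve 2 (λ m a → m :* m :- (:1 :* :1) :* a := m :* m :- a) refl mean a ⟩
            mean * mean - a ∎
            where open SetoidReasoning setoid
        refined : Bracket
        refined = bracket mean 0<mean a≤mean²
        s-mean : s - mean ≈ h * (s - r)
        s-mean = begin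
          s - h * (s + r)                       ≈⟨ +-congʳ (*-identityˡ s) ⟨
          1# * s - h * (s + r)                  ≈⟨ +-congʳ (*-congʳ 2h≈1) ⟨
          (1# + 1#) * h * s - h * (s + r)       ≈⟨ solve 3 (λ h s r → (:1 :+ :1) :* h :* s :- h :* (s :+ r) := h :* (s :- r)) refl h s r ⟩
          h * (s - r)                           ∎
          where open SetoidReasoning setoid
        upper-decreasing : mean ≤ s
        upper-decreasing = nonneg-diff (≤-resp refl (sym s-mean) (*-nonneg (<⇒≤ 0<h) (diff-nonneg (lower≤upper b))))
        lower-increasing : r ≤ lower refined
        lower-increasing = *-cancel-≤ˡ 0<mean (≤-resp refl (trans (product≈a b) (sym (product≈a refined)))
          (≤-resp (*-comm _ _) (*-comm _ _) (*-monoˡ-≤ (<⇒≤ (0<lower b)) upper-decreasing)))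
        width-halves : (1# + 1#) * (mean - lower refined) ≤ s - r
        width-halves = nonneg-diff (≤-resp refl eq (+-nonneg (diff-nonneg lower-increasing) (diff-nonneg lower-increasing)))
          where
          r′ = lower refined
          -- Twice the mean is s + r, so the slack in the halving is exactly twice the rise of the
          -- lower end.
          eq : (r′ - r) + (r′ - r) ≈ (s - r) - (1# + 1#) * (mean - r′)
          eq = begin
            (r′ - r) + (r′ - r) ≈⟨ solve 3 (λ s r r′ → (r′ :- r) :+ (r′ :- r) := (s :- r) :- (:1 :* (s :+ r) :- (:1 :+ :1) :* r′)) refl s r r′ ⟩
            (s - r) - (1# * (s + r) - (1# + 1#) * r′) ≈⟨ +-congˡ (-‿cong (+-congʳ (*-congʳ 2h≈1))) ⟨
            (s - r) - ((1# + 1#) * h * (s + r) - (1# + 1#) * r′) ≈⟨ solve 4 (λ h s r r′ → (s :- r) :- ((:1 :+ :1) :* h :* (s :+ r) :- (:1 :+ :1) :* r′) := (s :- r) :- (:1 :+ :1) :* (h :* (s :+ r) :- r′)) refl h s r r′ ⟩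
            (s - r) - (1# + 1#) * (mean - r′) ∎
            where open SetoidReasoning setoid

      -- Heron's iteration: the arithmetic mean of the two bounds becomes the new upper bound.
      heron : ℕ → Bracket
      heron zero    = bracket (1# + a) (+-pos-nonneg 0<1 (<⇒≤ 0<a)) (nonneg-diff (≤-resp refl
        (solve 1 (λ a → :1 :+ a :+ a :* a := (:1 :+ a) :* (:1 :+ a) :- a) refl a)
        (+-nonneg (+-nonneg (<⇒≤ 0<1) (<⇒≤ 0<a)) (*-nonneg (<⇒≤ 0<a) (<⇒≤ 0<a)))))
      heron (suc n) = Step.refined (heron n)

    square-root : ∃ λ x → 0# < x × x * x ≈ a
    square-root = root , 0<root , root²≈a
      where
      open HalvingIntervals a (upper ∘ heron) (lower ∘ heron) (0<lower ∘ heron) (lower≤upper ∘ heron) (product≈a ∘ heron)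
        (Step.upper-decreasing ∘ heron) (Step.lower-increasing ∘ heron) (Step.width-halves ∘ heron)

-- Polynomial functions, identity on a half-line, and multisets of roots.

module Polynomials {c ℓ₁ ℓ₂} (ℝ : RealNumbers c ℓ₁ ℓ₂) where
  open RealNumbers ℝ hiding (zero)
  open CommutativeRing commutativeRing using (ring; semiring; *-commutativeMonoid)
  open RingProperties ring using (-0#≈0#)
  open IntegerSolver commutativeRing
  open OrderedField ℝ
  open Spectral ℝ
  open SemiringSum semiring hiding (sum)
  open MonoidSum *-commutativeMonoid using () renaming (sum-remove to product-remove)
  open SetoidReasoning setoid

  private
    variable
      x y : Carrier
      m n : ℕ
      f g : Carrier → Carrier

  -- Coefficients in increasing order of degree.
  eval : Vec Carrier n → Carrier → Carrier
  eval []       x = 0#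
  eval (c ∷ cs) x = c + x * eval cs x

  -- The length of `cs` only bounds the degree: whether a leading coefficient vanishes cannot be
  -- decided.
  IsPolynomial : (Carrier → Carrier) → Set (c ⊔ ℓ₁)
  IsPolynomial f = ∃ λ n → ∃ λ (cs : Vec Carrier n) → ∀ x → f x ≈ eval cs x

  polynomial-cong : (∀ x → f x ≈ g x) → IsPolynomial g → IsPolynomial f
  polynomial-cong f≈g (n , cs , g≈) = n , cs , λ x → trans (f≈g x) (g≈ x)

  polynomial-constant : ∀ c → IsPolynomial (λ _ → c)
  polynomial-constant c = 1 , c ∷ [] , λ x → sym (trans (+-congˡ (zeroʳ x)) (+-identityʳ c))

  polynomial-identity : IsPolynomial (λ x → x)
  polynomial-identity = 2 , 0# ∷ 1# ∷ [] , λ x → solve 1 (λ x → x := :0 :+ x :* (:1 :+ x :* :0)) refl x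

  polynomial-+ : IsPolynomial f → IsPolynomial g → IsPolynomial (λ x → f x + g x)
  polynomial-+ (_ , cs , f≈) (_ , ds , g≈) =
    polynomial-cong (λ x → +-cong (f≈ x) (g≈ x)) (eval-+ cs ds)
    where
    eval-+ : (cs : Vec Carrier m) (ds : Vec Carrier n) → IsPolynomial (λ x → eval cs x + eval ds x)
    eval-+ []       ds       = _ , ds , λ x → +-identityˡ _
    eval-+ (c ∷ cs) []       = _ , c ∷ cs , λ x → +-identityʳ _
    eval-+ (c ∷ cs) (d ∷ ds) with _ , es , es≈ ← eval-+ cs ds = _ , (c + d) ∷ es , λ x → trans
      (solve 5 (λ c d x p q → (c :+ x :* p) :+ (d :+ x :* q) := (c :+ d) :+ x :* (p :+ q)) refl c d x (eval cs x) (eval ds x))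
      (+-congˡ (*-congˡ (es≈ x)))

  polynomial-scale : ∀ a → IsPolynomial f → IsPolynomial (λ x → a * f x)
  polynomial-scale a (_ , cs , f≈) = polynomial-cong (λ x → *-congˡ (f≈ x)) (eval-scale cs)
    where
    eval-scale : (cs : Vec Carrier n) → IsPolynomial (λ x → a * eval cs x)
    eval-scale []       = _ , [] , λ x → zeroʳ a
    eval-scale (c ∷ cs) with _ , es , es≈ ← eval-scale cs = _ , (a * c) ∷ es , λ x → trans
      (solve 4 (λ a c x p → a :* (c :+ x :* p) := a :* c :+ x :* (a :* p)) refl a c x (eval cs x))
      (+-congˡ (*-congˡ (es≈ x)))

  polynomial-shift : IsPolynomial f → IsPolynomial (λ x → x * f x)
  polynomial-shift (_ , cs , f≈) = _ , 0# ∷ cs , λ x → trans (*-congˡ (f≈ x)) (sym (+-identityˡ _))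

  polynomial-* : IsPolynomial f → IsPolynomial g → IsPolynomial (λ x → f x * g x)
  polynomial-* {g = g} (_ , cs , f≈) g-poly = polynomial-cong (λ x → *-congʳ (f≈ x)) (eval-* cs)
    where
    eval-* : (cs : Vec Carrier n) → IsPolynomial (λ x → eval cs x * g x)
    eval-* []       = _ , [] , λ x → zeroˡ _
    eval-* (c ∷ cs) = polynomial-cong
      (λ x → solve 4 (λ c x p q → (c :+ x :* p) :* q := c :* q :+ x :* (p :* q)) refl c x (eval cs x) (g x))
      (polynomial-+ (polynomial-scale c g-poly) (polynomial-shift (eval-* cs)))

  polynomial-neg : IsPolynomial f → IsPolynomial (λ x → - f x)
  polynomial-neg {f} f-poly = polynomial-cong (λ x → solve 1 (λ p → :- p := (:- :1) :* p) refl (f x)) (polynomial-scale (- 1#) f-poly)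

  polynomial-sum : {F : Carrier → Vector Carrier n} → (∀ i → IsPolynomial (λ x → F x i)) → IsPolynomial (λ x → sum (F x))
  polynomial-sum {zero}  _      = polynomial-constant 0#
  polynomial-sum {suc n} F-poly = polynomial-+ (F-poly zero) (polynomial-sum (F-poly ∘ suc))

  polynomial-product : {F : Carrier → Vector Carrier n} → (∀ i → IsPolynomial (λ x → F x i)) → IsPolynomial (λ x → product (F x))
  polynomial-product {zero}  _      = polynomial-constant 1#
  polynomial-product {suc n} F-poly = polynomial-* (F-poly zero) (polynomial-product (F-poly ∘ suc))

  polynomial-det : {M : Carrier → Matrix n} → (∀ i j → IsPolynomial (λ x → M x i j)) → IsPolynomial (λ x → det (M x))
  polynomial-det {zero}  _      = polynomial-constant 1#
  polynomial-det {suc n} M-poly = polynomial-sum λ j →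
    polynomial-* (polynomial-* (polynomial-constant (-1^ (toℕ j))) (M-poly zero j))
      (polynomial-det λ i k → M-poly (suc i) (punchIn j k))

  polynomial-charPoly : (M : Matrix n) → IsPolynomial (charPoly M)
  polynomial-charPoly {n} M = polynomial-det λ i j → polynomial-+ (entry i j) (polynomial-neg (polynomial-constant (M i j)))
    where
    entry : ∀ i j → IsPolynomial (λ x → diagonal (λ _ → x) i j)
    entry i j with i Fin.≟ j
    ... | yes _ = polynomial-identity
    ... | no _  = polynomial-constant 0#

  -- Synthetic division by x - a: by Horner's scheme the coefficients of the quotient are the values
  -- at `a` of the successive tails.
  divide : Carrier → Vec Carrier (suc n) → Vec Carrier n
  divide a (c ∷ [])         = []
  divide a (c ∷ cs@(_ ∷ _)) = eval cs a ∷ divide a cs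

  eval-divide : ∀ a (cs : Vec Carrier (suc n)) x → eval cs x ≈ eval cs a + (x - a) * eval (divide a cs) x
  eval-divide a (c ∷ []) x = solve 3 (λ a c x → c :+ x :* :0 := c :+ a :* :0 :+ (x :- a) :* :0) refl a c x
  eval-divide a (c ∷ cs@(_ ∷ _)) x = trans (+-congˡ (*-congˡ (eval-divide a cs x)))
    (solve 5 (λ a c x p q → c :+ x :* (p :+ (x :- a) :* q) := c :+ a :* p :+ (x :- a) :* (p :+ x :* q)) refl
      a c x (eval cs a) (eval (divide a cs) x))

  *-cancel-zero : 0# < x → x * y ≈ 0# → y ≈ 0#
  *-cancel-zero {x} {y} 0<x xy≈0 with z , 0<z , xz≈1 ← inverse 0<x = begin
    y             ≈⟨ *-identityˡ y ⟨
    1# * y        ≈⟨ *-congʳ xz≈1 ⟨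
    x * z * y     ≈⟨ solve 3 (λ x y z → x :* z :* y := z :* (x :* y)) refl x y z ⟩
    z * (x * y)   ≈⟨ *-congˡ xy≈0 ⟩
    z * 0#        ≈⟨ zeroʳ z ⟩
    0#            ∎

  -- Split off the root b + 1. Beyond it x - (b + 1) is positive and can be cancelled, so the
  -- shorter quotient vanishes there; moving the bound up keeps later points apart from the root
  -- just used.
  eval-zero : (cs : Vec Carrier n) → ∀ b → (∀ x → b < x → eval cs x ≈ 0#) → ∀ x → eval cs x ≈ 0#
  eval-zero []               b zero-above x = refl
  eval-zero {suc n} cs@(_ ∷ _) b zero-above x = begin
    eval cs x                                   ≈⟨ eval-divide a cs x ⟩
    eval cs a + (x - a) * eval (divide a cs) x  ≈⟨ +-cong (zero-above a b<a) (*-congˡ (eval-zero (divide a cs) a quotient-zero x)) ⟩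
    0# + (x - a) * 0#                           ≈⟨ trans (+-identityˡ _) (zeroʳ _) ⟩
    0#                                          ∎
    where
    a = b + 1#
    b<a : b < a
    b<a = pos-diff (<-respʳ (solve 1 (λ b → :1 := b :+ :1 :- b) refl b) 0<1)
    quotient-zero : ∀ x → a < x → eval (divide a cs) x ≈ 0#
    quotient-zero x a<x = *-cancel-zero (diff-pos a<x) (begin
      (x - a) * eval (divide a cs) x                          ≈⟨ solve 2 (λ p q → q := p :+ q :- p) refl (eval cs a) _ ⟩
      eval cs a + (x - a) * eval (divide a cs) x - eval cs a  ≈⟨ +-cong (sym (eval-divide a cs x)) (-‿cong (zero-above a b<a)) ⟩
      eval cs x - 0#                                          ≈⟨ +-cong (zero-above x (<-trans b<a a<x)) -0#≈0# ⟩
      0# + 0#                                                 ≈⟨ +-identityˡ 0# ⟩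
      0#                                                      ∎)

  polynomial-ext : IsPolynomial f → IsPolynomial g → ∀ b → (∀ x → b < x → f x ≈ g x) → ∀ x → f x ≈ g x
  polynomial-ext {f} {g} f-poly g-poly b f≈g x with polynomial-+ f-poly (polynomial-neg g-poly)
  ... | _ , cs , f-g≈ = begin
    f x               ≈⟨ solve 2 (λ p q → p := (p :- q) :+ q) refl (f x) (g x) ⟩
    (f x - g x) + g x ≈⟨ +-congʳ (trans (f-g≈ x) (eval-zero cs b (λ y b<y → trans (sym (f-g≈ y)) (trans (+-congʳ (f≈g y b<y)) (-‿inverseʳ _))) x)) ⟩
    0# + g x          ≈⟨ +-identityˡ _ ⟩
    g x               ∎

  polynomial-roots : (a : Vector Carrier n) → IsPolynomial (λ x → product (λ i → x - a i))
  polynomial-roots a = polynomial-product λ i → polynomial-+ polynomial-identity (polynomial-constant (- a i))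

  -- Which factor vanishes cannot be told. If the remaining product were apart from 0 it could be
  -- cancelled and the first factor would be 0; so it is not apart, hence equal to 0, and induction
  -- applies.
  product-nonzero : (t : Vector Carrier n) → (∀ i → ¬ (t i ≈ 0#)) → ¬ (product t ≈ 0#)
  product-nonzero {zero}  t t≉0 1≈0 = <-irrefl (sym 1≈0) 0<1
  product-nonzero {suc n} t t≉0 p≈0 = product-nonzero (t ∘ suc) (t≉0 ∘ suc) (proj₁ (tight _ _) λ rest#0 →
    t≉0 zero (cancel (#⇒invertible rest#0)))
    where
    rest = product (t ∘ suc)
    cancel : ∃ (λ y → y * (rest - 0#) ≈ 1# × (rest - 0#) * y ≈ 1#) → t zero ≈ 0#
    cancel (y , _ , ry≈1) = begin
      t zero                       ≈⟨ *-identityʳ _ ⟨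
      t zero * 1#                  ≈⟨ *-congˡ ry≈1 ⟨
      t zero * ((rest - 0#) * y)   ≈⟨ solve 3 (λ t r y → t :* ((r :- :0) :* y) := t :* r :* y) refl (t zero) rest y ⟩
      t zero * rest * y            ≈⟨ *-congʳ p≈0 ⟩
      0# * y                       ≈⟨ zeroˡ y ⟩
      0#                           ∎

  -- Makes the energy independent of the chosen list of eigenvalues. Suppose the sums differ. Then
  -- `a zero` equals no `b j`, since a match would give equal sums by induction; but the product of
  -- all differences `a zero - b j` is 0.
  same-roots⇒same-sum : (F : Carrier → Carrier) → (∀ {x y} → x ≈ y → F x ≈ F y) →
    (a b : Vector Carrier n) → (∀ x → product (λ i → x - a i) ≈ product (λ i → x - b i)) →
    sum (F ∘ a) ≈ sum (F ∘ b)
  same-roots⇒same-sum {zero}  F F-cong a b a≈b = refl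
  same-roots⇒same-sum {suc n} F F-cong a b a≈b = ≈-stable λ sums≉ →
    product-nonzero (λ j → a zero - b j)
      (λ j a₀-bj≈0 → sums≉ (match j (begin
        a zero                  ≈⟨ solve 2 (λ x y → x := (x :- y) :+ y) refl (a zero) (b j) ⟩
        (a zero - b j) + b j    ≈⟨ +-congʳ a₀-bj≈0 ⟩
        0# + b j                ≈⟨ +-identityˡ _ ⟩
        b j                     ∎)))
      (trans (sym (a≈b (a zero))) (trans (*-congʳ (-‿inverseʳ _)) (zeroˡ _)))
    where
    match : ∀ j → a zero ≈ b j → sum (F ∘ a) ≈ sum (F ∘ b)
    match j a₀≈bj = begin
      F (a zero) + sum (F ∘ a ∘ suc)        ≈⟨ +-cong (F-cong a₀≈bj) (same-roots⇒same-sum F F-cong (a ∘ suc) (removeAt b j) rest) ⟩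
      F (b j) + sum (F ∘ removeAt b j)      ≈⟨ sum-remove {i = j} (F ∘ b) ⟨
      sum (F ∘ b)                           ∎
      where
      -- The common linear factor is cancelled where it is positive, above `a zero`; agreement there
      -- extends to all x.
      rest : ∀ x → product (λ i → x - a (suc i)) ≈ product (λ i → x - removeAt b j i)
      rest = polynomial-ext (polynomial-roots (a ∘ suc)) (polynomial-roots (removeAt b j)) (a zero) λ x a₀<x → begin
        P x                       ≈⟨ solve 2 (λ p q → p := q :+ (p :- q)) refl (P x) (Q x) ⟩
        Q x + (P x - Q x)         ≈⟨ +-congˡ (*-cancel-zero (diff-pos a₀<x) (difference x)) ⟩
        Q x + 0#                  ≈⟨ +-identityʳ _ ⟩
        Q x                       ∎
        where
        P Q : Carrier → Carrier
        P x = product (λ i → x - a (suc i))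
        Q x = product (λ i → x - removeAt b j i)
        difference : ∀ x → (x - a zero) * (P x - Q x) ≈ 0#
        difference x = begin
          (x - a zero) * (P x - Q x)                 ≈⟨ solve 3 (λ d p q → d :* (p :- q) := d :* p :- d :* q) refl (x - a zero) (P x) (Q x) ⟩
          (x - a zero) * P x - (x - a zero) * Q x    ≈⟨ +-congˡ (-‿cong (*-congʳ (+-congˡ (-‿cong a₀≈bj)))) ⟩
          (x - a zero) * P x - (x - b j) * Q x       ≈⟨ +-cong (a≈b x) (-‿cong (sym (product-remove {i = j} (λ i → x - b i)))) ⟩
          product (λ i → x - b i) - product (λ i → x - b i) ≈⟨ -‿inverseʳ _ ⟩
          0#                                         ∎

-- Counting edges in forests and unicyclic graphs.

module Cycles where

  open import Data.Nat.Base using (_+_; _*_; _<_; _≤_; z≤n; s≤s)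
  open ≡ using (refl; sym; trans; cong; cong₂; subst; subst₂; module ≡-Reasoning)
  open SemiringSum ℕ.+-*-semiring

  private
    variable
      n : ℕ

  sum-mono-≤ : {f g : Vector ℕ n} → (∀ i → f i ≤ g i) → sum f ≤ sum g
  sum-mono-≤ {zero}  f≤g = z≤n
  sum-mono-≤ {suc n} f≤g = ℕ.+-mono-≤ (f≤g zero) (sum-mono-≤ (f≤g ∘ suc))

  𝟙 : Bool → ℕ
  𝟙 b = if b then 1 else 0

  sum-indicator : ∀ (a : Fin n) → sum (λ i → 𝟙 ⌊ i Fin.≟ a ⌋) ≡ 1
  sum-indicator {suc n} a = trans (sum-remove {i = a} (λ i → 𝟙 ⌊ i Fin.≟ a ⌋)) (cong₂ _+_ at-a (trans (sum-cong-≗ off-a) (sum-replicate-zero n)))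
    where
    at-a : 𝟙 ⌊ a Fin.≟ a ⌋ ≡ 1
    at-a with a Fin.≟ a
    ... | yes _ = refl
    ... | no a≢a = ⊥-elim (a≢a refl)
    off-a : ∀ i → 𝟙 ⌊ punchIn a i Fin.≟ a ⌋ ≡ 0
    off-a i with punchIn a i Fin.≟ a
    ... | yes eq = ⊥-elim (Fin.punchInᵢ≢i a i eq)
    ... | no _ = refl

  sum-indicator₂ : ∀ (a b : Fin n) → sum (λ i → sum λ j → 𝟙 (⌊ i Fin.≟ a ⌋ ∧ ⌊ j Fin.≟ b ⌋)) ≡ 1
  sum-indicator₂ {n} a b = trans (sum-cong-≗ row) (sum-indicator a)
    where
    row : ∀ i → sum (λ j → 𝟙 (⌊ i Fin.≟ a ⌋ ∧ ⌊ j Fin.≟ b ⌋)) ≡ 𝟙 ⌊ i Fin.≟ a ⌋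
    row i with i Fin.≟ a
    ... | yes _ = sum-indicator b
    ... | no _  = sum-replicate-zero n

  BoolRel : ℕ → Set
  BoolRel n = Fin n → Fin n → Bool

  -- Ordered pairs are counted, so for a symmetric irreflexive relation this is twice the number of
  -- edges.
  total : BoolRel n → ℕ
  total R = sum λ i → sum λ j → 𝟙 (R i j)

  -- `Cycle` for a bare Boolean relation: vertices and edges get deleted in the count, and signs are
  -- irrelevant to it.
  record RelCycle (R : BoolRel n) : Set where
    field
      length-3  : ℕ
      vertex    : Fin (3 + length-3) → Fin n
      injective : ∀ {i j} → vertex i ≡ vertex j → i ≡ j
      closed    : ∀ i → T (R (vertex i) (vertex (next i)))

  next-step : ∀ (f : ℕ → Fin n) {m} (t : Fin (suc m)) → f (suc m) ≡ f 0 → f (toℕ (next t)) ≡ f (suc (toℕ t))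
  next-step f {m} t closes with ℕ.m≤n⇒m<n∨m≡n (Fin.toℕ<n t)
  ... | inj₁ lt = cong f (trans (Fin.toℕ-fromℕ< _) (m<n⇒m%n≡m lt))
  ... | inj₂ eq = trans (cong f (trans (Fin.toℕ-fromℕ< _) (trans (cong (ℕ._% suc m) eq) (n%n≡0 (suc m))))) (trans (sym closes) (cong f (sym eq)))

  module _ {R : BoolRel n} (R-sym : ∀ i j → R i j ≡ R j i) (R-irrefl : ∀ i → R i i ≡ false) where

    -- A non-backtracking walk closes up; at its shortest closed segment it is a cycle.
    walk⇒cycle : (w : ℕ → Fin n) → (∀ k → T (R (w k) (w (suc k)))) → (∀ k → w k ≢ w (2 + k)) → RelCycle R
    walk⇒cycle w w-adjacent w-forward with i , j , i<j , eq ← Fin.pigeonhole {n} {suc n} ℕ.≤-refl (w ∘ toℕ) =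
      shortest _ (<-wellFounded (toℕ j ℕ.∸ toℕ i)) (toℕ i) (ℕ.m<n⇒0<n∸m i<j)
        (trans (cong w (ℕ.m∸n+n≡m (ℕ.<⇒≤ i<j))) (sym eq))
      where
      shortest : ∀ d → Acc _<_ d → ∀ i → 0 < d → w (d + i) ≡ w i → RelCycle R
      shortest d (acc rec) i 0<d eq
        with Fin.any? {d} (λ a → Fin.any? {d} λ b → (a Fin.<? b) ×-dec (w (toℕ a + i) Fin.≟ w (toℕ b + i)))
      ... | yes (a , b , a<b , eq′) = shortest (toℕ b ℕ.∸ toℕ a) (rec (ℕ.≤-<-trans (ℕ.m∸n≤m (toℕ b) (toℕ a)) (Fin.toℕ<n b))) (toℕ a + i)
        (ℕ.m<n⇒0<n∸m a<b)
        (trans (cong w (trans (sym (ℕ.+-assoc (toℕ b ℕ.∸ toℕ a) (toℕ a) i)) (cong (_+ i) (ℕ.m∸n+n≡m (ℕ.<⇒≤ a<b))))) (sym eq′))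
      -- Length 1 would be a loop and length 2 an immediate return, so the shortest closed segment
      -- has length at least 3.
      shortest 1 (acc rec) i 0<d eq | no _ = ⊥-elim (subst T (trans (cong (R (w i)) eq) (R-irrefl (w i))) (w-adjacent i))
      shortest 2 (acc rec) i 0<d eq | no _ = ⊥-elim (w-forward i (sym eq))
      shortest (suc (suc (suc l))) (acc rec) i 0<d eq | no distinct = record
        { length-3  = l
        ; vertex    = λ t → w (toℕ t + i)
        ; injective = λ {a} {b} → inj a b
        ; closed    = λ t → subst (T ∘ R (w (toℕ t + i))) (sym (next-step (λ k → w (k + i)) t eq)) (w-adjacent (toℕ t + i))
        }
        where
        inj : ∀ a b → w (toℕ a + i) ≡ w (toℕ b + i) → a ≡ b
        inj a b wa≡wb with Fin.<-cmp a b
        ... | tri< a<b _ _ = ⊥-elim (distinct (a , b , a<b , wa≡wb))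
        ... | tri≈ _ a≡b _ = a≡b
        ... | tri> _ _ b<a = ⊥-elim (distinct (b , a , b<a , sym wa≡wb))

    -- With two neighbours at every vertex, the walk can always leave by a neighbour other than the
    -- one it came from.
    min-degree-2⇒cycle : Fin n → (∀ v → 2 ≤ sum (λ j → 𝟙 (R v j))) → RelCycle R
    min-degree-2⇒cycle v₀ degree≥2 = walk⇒cycle (λ k → proj₁ (walk k)) adjacent forward
      where
      onward : ∀ u v → ∃ λ w → T (R v w) × u ≢ w
      onward u v with Fin.any? (λ w → T? (R v w) ×-dec ¬? (u Fin.≟ w))
      ... | yes found = found
      ... | no ∄w = ⊥-elim (ℕ.<⇒≱ (degree≥2 v) (ℕ.≤-trans (sum-mono-≤ only-u) (ℕ.≤-reflexive (sum-indicator u))))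
        where
        only-u : ∀ j → 𝟙 (R v j) ≤ 𝟙 ⌊ j Fin.≟ u ⌋
        only-u j with R v j in Rvj | j Fin.≟ u
        ... | false | _      = z≤n
        ... | true  | yes _  = ℕ.≤-refl
        ... | true  | no j≢u = ⊥-elim (∄w (j , subst T (sym Rvj) _ , j≢u ∘ sym))
      walk : ℕ → Fin n × Fin n
      -- The state is a vertex with its successor. At the start there is no predecessor to avoid,
      -- and `v₀` itself is passed in its place.
      walk zero    = v₀ , proj₁ (onward v₀ v₀)
      walk (suc k) = proj₂ (walk k) , proj₁ (onward (proj₁ (walk k)) (proj₂ (walk k)))
      adjacent : ∀ k → T (R (proj₁ (walk k)) (proj₁ (walk (suc k))))
      adjacent zero    = proj₁ (proj₂ (onward v₀ v₀))
      adjacent (suc k) = proj₁ (proj₂ (onward (proj₁ (walk k)) (proj₂ (walk k))))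
      forward : ∀ k → proj₁ (walk k) ≢ proj₁ (walk (2 + k))
      forward k = proj₂ (proj₂ (onward (proj₁ (walk k)) (proj₂ (walk k))))

  total-removeVertex : (R : BoolRel (suc n)) → (∀ i j → R i j ≡ R j i) → (∀ i → R i i ≡ false) → ∀ v →
    total R ≡ 2 * sum (λ j → 𝟙 (R v j)) + total (λ i j → R (punchIn v i) (punchIn v j))
  total-removeVertex {n} R R-sym R-irrefl v = begin
    total R                                                            ≡⟨ sum-remove {i = v} (λ i → sum λ j → 𝟙 (R i j)) ⟩
    d + sum (λ i → sum λ j → 𝟙 (R (punchIn v i) j))                    ≡⟨ cong (d +_) (sum-cong-≗ λ i → sum-remove {i = v} (λ j → 𝟙 (R (punchIn v i) j))) ⟩
    d + sum (λ i → 𝟙 (R (punchIn v i) v) + sum (λ j → 𝟙 (R′ i j)))     ≡⟨ cong (d +_) (∑-distrib-+ (λ i → 𝟙 (R (punchIn v i) v)) (λ i → sum (λ j → 𝟙 (R′ i j)))) ⟩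
    d + (sum (λ i → 𝟙 (R (punchIn v i) v)) + total R′)                 ≡⟨ cong (λ k → d + (k + total R′)) column ⟩
    d + (d + total R′)                                                 ≡⟨ sym (trans (cong (_+ total R′) (cong (d +_) (ℕ.+-identityʳ d))) (ℕ.+-assoc d d (total R′))) ⟩
    2 * d + total R′                                                   ∎
    where
    open ≡-Reasoning
    d = sum (λ j → 𝟙 (R v j))
    R′ : BoolRel n
    R′ i j = R (punchIn v i) (punchIn v j)
    column : sum (λ i → 𝟙 (R (punchIn v i) v)) ≡ d
    column = sym (trans (sum-remove {i = v} (λ j → 𝟙 (R v j)))
      (cong₂ _+_ (cong 𝟙 (R-irrefl v)) (sum-cong-≗ λ i → cong 𝟙 (R-sym v (punchIn v i)))))

  -- A forest has fewer edges than vertices: without cycles some vertex has degree at most 1, and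
  -- deleting it lowers the doubled edge count by at most 2.
  acyclic⇒total< : (R : BoolRel (suc n)) → (∀ i j → R i j ≡ R j i) → (∀ i → R i i ≡ false) →
    ¬ RelCycle R → total R < 2 * suc n
  acyclic⇒total< {zero}  R R-sym R-irrefl acyclic rewrite R-irrefl zero = s≤s z≤n
  acyclic⇒total< {suc n} R R-sym R-irrefl acyclic with Fin.any? (λ v → sum (λ j → 𝟙 (R v j)) ℕ.≤? 1)
  ... | no high = ⊥-elim (acyclic (min-degree-2⇒cycle R-sym R-irrefl zero λ v → ℕ.≰⇒> (high ∘ (v ,_))))
  ... | yes (v , d≤1) = subst₂ _<_ (sym (total-removeVertex R R-sym R-irrefl v)) (sym (ℕ.*-suc 2 (suc n)))
        (ℕ.+-mono-≤-< (ℕ.*-monoʳ-≤ 2 d≤1) (acyclic⇒total< (λ i j → R (punchIn v i) (punchIn v j))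
          (λ i j → R-sym _ _) (λ i → R-irrefl _) (acyclic ∘ lift)))
    where
    lift : RelCycle (λ i j → R (punchIn v i) (punchIn v j)) → RelCycle R
    lift C = record
      { length-3  = RelCycle.length-3 C
      ; vertex    = λ i → punchIn v (RelCycle.vertex C i)
      ; injective = λ eq → RelCycle.injective C (Fin.punchIn-injective v _ _ eq)
      ; closed    = RelCycle.closed C
      }

  module _ {n} (Γ : SignedGraph (suc n)) where
    open SignedGraph Γ

    adjacent?-sym : ∀ i j → adjacent? i j ≡ adjacent? j i
    adjacent?-sym i j = cong Maybe.is-just (label-sym i j)

    adjacent?-irrefl : ∀ i → adjacent? i i ≡ false
    adjacent?-irrefl i = cong Maybe.is-just (label-irrefl i)

    -- Deleting an edge uv of the cycle leaves an acyclic graph.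
    unicyclic⇒total≤ : Unicyclic Γ → total adjacent? < 2 + 2 * suc n
    unicyclic⇒total≤ (_ , C , unique) = ℕ.≤-<-trans total≤ (ℕ.+-monoʳ-< 2 (acyclic⇒total< R R-sym R-irrefl acyclic))
      where
      u = Cycle.vertex C zero
      v = Cycle.vertex C (next zero)
      e₁ e₂ R : BoolRel (suc n)
      e₁ i j = ⌊ i Fin.≟ u ⌋ ∧ ⌊ j Fin.≟ v ⌋
      e₂ i j = ⌊ i Fin.≟ v ⌋ ∧ ⌊ j Fin.≟ u ⌋
      R i j = adjacent? i j ∧ (not (e₁ i j) ∧ not (e₂ i j))
      R-sym : ∀ i j → R i j ≡ R j i
      R-sym i j = cong₂ _∧_ (adjacent?-sym i j)
        (trans (∧-comm (not (e₁ i j)) _) (cong₂ (λ x y → not x ∧ not y) (∧-comm _ ⌊ j Fin.≟ u ⌋) (∧-comm _ ⌊ j Fin.≟ v ⌋)))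
      R-irrefl : ∀ i → R i i ≡ false
      R-irrefl i rewrite adjacent?-irrefl i = refl
      -- A cycle that avoids uv is a cycle of `Γ`, and every cycle of `Γ` has the edges of `C`,
      -- among them uv.
      acyclic : ¬ RelCycle R
      acyclic C′ = contradict (Equivalence.from (unique Γ-cycle u v) (zero , inj₁ (refl , refl)))
        where
        open RelCycle C′
        Γ-cycle : Cycle Γ
        Γ-cycle = record { length-3 = length-3 ; vertex = vertex ; injective = injective
                         ; closed = λ i → proj₁ (Equivalence.to T-∧ (closed i)) }
        ≟∧≟ : ∀ {a b c d : Fin (suc n)} → a ≡ b → c ≡ d → ⌊ a Fin.≟ b ⌋ ∧ ⌊ c Fin.≟ d ⌋ ≡ true
        ≟∧≟ {a} {b} {c} {d} a≡b c≡d with a Fin.≟ b | c Fin.≟ d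
        ... | yes _   | yes _   = refl
        ... | no a≢b  | _       = ⊥-elim (a≢b a≡b)
        ... | yes _   | no c≢d  = ⊥-elim (c≢d c≡d)
        contradict : Cycle.HasEdge Γ-cycle u v → ⊥
        contradict (i , edge) with edge | Equivalence.to (T-∧ {adjacent? (vertex i) (vertex (next i))}) (closed i)
        ... | inj₁ (p , q) | _ , kept = subst (T ∘ not) (≟∧≟ p q) (proj₁ (Equivalence.to (T-∧ {not (e₁ (vertex i) (vertex (next i)))}) kept))
        ... | inj₂ (p , q) | _ , kept = subst (T ∘ not) (≟∧≟ p q) (proj₂ (Equivalence.to (T-∧ {not (e₁ (vertex i) (vertex (next i)))}) kept))
      pointwise : ∀ i j → 𝟙 (adjacent? i j) ≤ (𝟙 (e₁ i j) + 𝟙 (e₂ i j)) + 𝟙 (R i j)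
      pointwise i j with adjacent? i j | e₁ i j | e₂ i j
      ... | false | _ | _ = z≤n
      ... | true | true | _ = s≤s z≤n
      ... | true | false | true = s≤s z≤n
      ... | true | false | false = s≤s z≤n
      total≤ : total adjacent? ≤ 2 + total R
      total≤ = ℕ.≤-trans (sum-mono-≤ λ i → sum-mono-≤ (pointwise i)) (ℕ.≤-reflexive (begin
        sum (λ i → sum λ j → (𝟙 (e₁ i j) + 𝟙 (e₂ i j)) + 𝟙 (R i j))  ≡⟨ sum-cong-≗ (λ i → ∑-distrib-+ (λ j → 𝟙 (e₁ i j) + 𝟙 (e₂ i j)) (λ j → 𝟙 (R i j))) ⟩
        sum (λ i → sum (λ j → 𝟙 (e₁ i j) + 𝟙 (e₂ i j)) + sum (λ j → 𝟙 (R i j))) ≡⟨ ∑-distrib-+ (λ i → sum (λ j → 𝟙 (e₁ i j) + 𝟙 (e₂ i j))) (λ i → sum (λ j → 𝟙 (R i j))) ⟩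
        sum (λ i → sum (λ j → 𝟙 (e₁ i j) + 𝟙 (e₂ i j))) + total R     ≡⟨ cong (_+ total R) (sum-cong-≗ (λ i → ∑-distrib-+ (λ j → 𝟙 (e₁ i j)) (λ j → 𝟙 (e₂ i j)))) ⟩
        sum (λ i → sum (λ j → 𝟙 (e₁ i j)) + sum (λ j → 𝟙 (e₂ i j))) + total R ≡⟨ cong (_+ total R) (∑-distrib-+ (λ i → sum (λ j → 𝟙 (e₁ i j))) (λ i → sum (λ j → 𝟙 (e₂ i j)))) ⟩
        total e₁ + total e₂ + total R                                 ≡⟨ cong₂ (λ x y → x + y + total R) (sum-indicator₂ u v) (sum-indicator₂ v u) ⟩
        2 + total R                                                   ∎))
        where open ≡-Reasoning

-- Sums over the edge list, in ℕ for the handshake count and in the reals for the Laplacian.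

module EdgeSum {c ℓ} (M : CommutativeMonoid c ℓ) where
  open CommutativeMonoid M
  open MonoidSum M
  open SetoidReasoning setoid

  private
    variable
      n : ℕ
      p : Level
      A B : Set

  restrict : Bool → Carrier → Carrier
  restrict b x = if b then x else ε

  listSum : (xs : List A) → (A → Carrier) → Carrier
  listSum xs F = sum (F ∘ List.lookup xs)

  listSum-++ : ∀ (xs ys : List A) F → listSum (xs List.++ ys) F ≈ listSum xs F ∙ listSum ys F
  listSum-++ []       ys F = sym (identityˡ _)
  listSum-++ (x ∷ xs) ys F = trans (∙-congˡ (listSum-++ xs ys F)) (sym (assoc _ _ _))

  listSum-map : ∀ (f : A → B) xs F → listSum (List.map f xs) F ≈ listSum xs (F ∘ f)
  listSum-map f []       F = refl
  listSum-map f (x ∷ xs) F = ∙-congˡ (listSum-map f xs F)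

  listSum-filter : ∀ {P : Pred A p} (P? : Decidable P) xs F →
    listSum (filter P? xs) F ≈ listSum xs (λ x → restrict (does (P? x)) (F x))
  listSum-filter P? []       F = refl
  listSum-filter P? (x ∷ xs) F with does (P? x)
  ... | true  = ∙-congˡ (listSum-filter P? xs F)
  ... | false = trans (listSum-filter P? xs F) (sym (identityˡ _))

  listSum-cartesianProduct : ∀ (xs : List A) (ys : List B) F →
    listSum (cartesianProduct xs ys) F ≈ listSum xs (λ x → listSum ys (λ y → F (x , y)))
  listSum-cartesianProduct []       ys F = refl
  listSum-cartesianProduct (x ∷ xs) ys F = trans (listSum-++ (List.map (x ,_) ys) _ F)
    (∙-cong (listSum-map (x ,_) ys F) (listSum-cartesianProduct xs ys F))

  listSum-tabulate : ∀ (f : Fin n → A) F → listSum (List.tabulate f) F ≈ sum (F ∘ f)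
  listSum-tabulate {zero}  f F = refl
  listSum-tabulate {suc n} f F = ∙-congˡ (listSum-tabulate (f ∘ suc) F)

  module _ (Γ : SignedGraph n) where
    open SignedGraph Γ

    edge-sum : ∀ (F : Fin n × Fin n → Carrier) →
      sum (F ∘ List.lookup edges) ≈ sum λ i → sum λ j → restrict (does (i Fin.<? j) ∧ adjacent? i j) (F (i , j))
    edge-sum F = begin
      listSum edges F                                             ≈⟨ listSum-filter edge? (cartesianProduct (List.allFin n) (List.allFin n)) F ⟩
      listSum (cartesianProduct (List.allFin n) (List.allFin n)) G ≈⟨ listSum-cartesianProduct (List.allFin n) (List.allFin n) G ⟩
      listSum (List.allFin n) (λ i → listSum (List.allFin n) (λ j → G (i , j))) ≈⟨ listSum-tabulate id (λ i → listSum (List.allFin n) (λ j → G (i , j))) ⟩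
      sum (λ i → listSum (List.allFin n) (λ j → G (i , j)))       ≈⟨ sum-cong-≋ (λ i → listSum-tabulate id (λ j → G (i , j))) ⟩
      sum (λ i → sum λ j → G (i , j))                             ∎
      where
      edge? : Decidable (λ ((i , j) : Fin n × Fin n) → (i Fin.< j) × T (adjacent? i j))
      edge? (i , j) = (i Fin.<? j) ×-dec T? (adjacent? i j)
      G : Fin n × Fin n → Carrier
      G x = restrict (does (edge? x)) (F x)

    -- Each edge is listed once, from its smaller to its larger end.
    edge-sum-symmetric : ∀ (f : Fin n → Fin n → Carrier) →
      sum (λ e → f (source e) (target e) ∙ f (target e) (source e)) ≈ sum λ i → sum λ j → restrict (adjacent? i j) (f i j)
    edge-sum-symmetric f = begin
      sum (λ e → f (source e) (target e) ∙ f (target e) (source e))   ≈⟨ edge-sum (λ (i , j) → f i j ∙ f j i) ⟩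
      sum (λ i → sum λ j → restrict (lt i j ∧ adjacent? i j) (f i j ∙ f j i)) ≈⟨ sum-cong-≋ (λ i → sum-cong-≋ λ j → split i j) ⟩
      sum (λ i → sum λ j → restrict (lt i j) (g i j) ∙ restrict (lt i j) (g j i)) ≈⟨ sum-cong-≋ (λ i → ∑-distrib-+ (λ j → restrict (lt i j) (g i j)) (λ j → restrict (lt i j) (g j i))) ⟩
      sum (λ i → sum (λ j → restrict (lt i j) (g i j)) ∙ sum (λ j → restrict (lt i j) (g j i))) ≈⟨ ∑-distrib-+ (λ i → sum (λ j → restrict (lt i j) (g i j))) (λ i → sum (λ j → restrict (lt i j) (g j i))) ⟩
      sum (λ i → sum λ j → restrict (lt i j) (g i j)) ∙ sum (λ i → sum λ j → restrict (lt i j) (g j i)) ≈⟨ ∙-congˡ (∑-comm (λ i j → restrict (lt i j) (g j i))) ⟩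
      sum (λ i → sum λ j → restrict (lt i j) (g i j)) ∙ sum (λ i → sum λ j → restrict (lt j i) (g i j)) ≈⟨ ∑-distrib-+ (λ i → sum (λ j → restrict (lt i j) (g i j))) (λ i → sum (λ j → restrict (lt j i) (g i j))) ⟨
      sum (λ i → sum (λ j → restrict (lt i j) (g i j)) ∙ sum (λ j → restrict (lt j i) (g i j))) ≈⟨ sum-cong-≋ (λ i → ∑-distrib-+ (λ j → restrict (lt i j) (g i j)) (λ j → restrict (lt j i) (g i j))) ⟨
      sum (λ i → sum λ j → restrict (lt i j) (g i j) ∙ restrict (lt j i) (g i j)) ≈⟨ sum-cong-≋ (λ i → sum-cong-≋ λ j → merge i j) ⟩
      sum (λ i → sum λ j → g i j) ∎
      where
      lt : Fin n → Fin n → Bool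
      lt i j = does (i Fin.<? j)
      g : Fin n → Fin n → Carrier
      g i j = restrict (adjacent? i j) (f i j)
      split : ∀ i j → restrict (lt i j ∧ adjacent? i j) (f i j ∙ f j i) ≈ restrict (lt i j) (g i j) ∙ restrict (lt i j) (g j i)
      split i j rewrite ≡.cong Maybe.is-just (label-sym j i) with lt i j | adjacent? i j
      ... | false | _     = sym (identityˡ ε)
      ... | true  | true  = refl
      ... | true  | false = sym (identityˡ ε)
      merge : ∀ i j → restrict (lt i j) (g i j) ∙ restrict (lt j i) (g i j) ≈ g i j
      merge i j = by-order (i Fin.<? j) (j Fin.<? i)
        where
        by-order : (p : Dec (i Fin.< j)) (q : Dec (j Fin.< i)) → restrict (does p) (g i j) ∙ restrict (does q) (g i j) ≈ g i j
        by-order (yes i<j) (yes j<i) = ⊥-elim (ℕ.<-asym i<j j<i)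
        by-order (yes _)   (no _)    = identityʳ _
        by-order (no _)    (yes _)   = identityˡ _
        by-order (no i≮j)  (no j≮i) with Fin.<-cmp i j
        ... | tri< i<j _ _ = ⊥-elim (i≮j i<j)
        ... | tri> _ _ j<i = ⊥-elim (j≮i j<i)
        ... | tri≈ _ ≡.refl _ rewrite label-irrefl i = identityˡ ε

sum-const : ∀ n k → SemiringSum.sum ℕ.+-*-semiring {n} (λ _ → k) ≡ n ℕ.* k
sum-const zero    k = ≡.refl
sum-const (suc n) k = ≡.cong (k ℕ.+_) (sum-const n k)

-- Handshake: summing 1 over both orientations of every edge identifies `total` with twice the size.
unicyclic⇒size≤ : ∀ {k} (Γ : SignedGraph (suc k)) → Unicyclic Γ → SignedGraph.size Γ ℕ.≤ suc k
unicyclic⇒size≤ {k} Γ unicyclic = ℕ.≤-pred (ℕ.*-cancelʳ-< 2 _ _ (≡.subst₂ ℕ._<_ handshake bound (Cycles.unicyclic⇒total≤ Γ unicyclic)))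
  where
  handshake : Cycles.total (SignedGraph.adjacent? Γ) ≡ SignedGraph.size Γ ℕ.* 2
  handshake = ≡.trans (≡.sym (EdgeSum.edge-sum-symmetric ℕ.+-0-commutativeMonoid Γ (λ _ _ → 1)))
    (sum-const (SignedGraph.size Γ) 2)
  bound : 2 ℕ.+ 2 ℕ.* suc k ≡ suc (suc k) ℕ.* 2
  bound = ≡.cong (2 ℕ.+_) (ℕ.*-comm 2 (suc k))

-- The factorisation of the signed Laplacian.

module IncidenceMatrix {c ℓ₁ ℓ₂} (ℝ : RealNumbers c ℓ₁ ℓ₂) where
  open RealNumbers ℝ hiding (zero)
  open Spectral ℝ
  open CommutativeRing commutativeRing using (semiring; ring; +-commutativeMonoid)
  open RingProperties ring using (-0#≈0#; -‿involutive)
  open SemiringSum semiring hiding (sum)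
  open IntegerSolver commutativeRing
  open SetoidReasoning setoid
  open Determinants ℝ
  open BlockDeterminants ℝ
  open EdgeSum +-commutativeMonoid using (restrict; edge-sum-symmetric)

  private
    variable
      n : ℕ

  fromLabel-* : ∀ s t → fromLabel (just (s Sign.* t)) ≈ fromLabel (just s) * fromLabel (just t)
  fromLabel-* Sign.+ Sign.+ = solve 0 (:1 := :1 :* :1) refl
  fromLabel-* Sign.+ Sign.- = solve 0 (:- :1 := :1 :* :- :1) refl
  fromLabel-* Sign.- Sign.+ = solve 0 (:- :1 := :- :1 :* :1) refl
  fromLabel-* Sign.- Sign.- = solve 0 (:1 := :- :1 :* :- :1) refl

  fromLabel-square : ∀ s → fromLabel (just s) * fromLabel (just s) ≈ 1#
  fromLabel-square Sign.+ = solve 0 (:1 :* :1 := :1) refl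
  fromLabel-square Sign.- = solve 0 (:- :1 :* :- :1 := :1) refl

  fromLabel-opposite : ∀ a → fromLabel (Maybe.map Sign.opposite a) ≈ - fromLabel a
  fromLabel-opposite nothing         = sym -0#≈0#
  fromLabel-opposite (just Sign.+)   = refl
  fromLabel-opposite (just Sign.-)   = sym (-‿involutive 1#)

  module _ (Γ : SignedGraph n) where
    open SignedGraph Γ

    -- Read off from the filter that defines `edges`. It keeps the two ends distinct, so an
    -- incidence entry never gets a share from both.
    source<target : ∀ e → source e Fin.< target e
    source<target e = proj₁ (proj₂ (∈-filter⁻ (λ (i , j) → (i Fin.<? j) ×-dec T? (adjacent? i j))
      {xs = cartesianProduct (List.allFin n) (List.allFin n)} (∈-lookup {xs = edges} e)))

    degree-sum : ∀ v x → sum (λ j → restrict (adjacent? v j) x) ≈ (degree v · 1#) * x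
    degree-sum v x = count-sum (λ j → j)
      where
      -- `degree` counts along a tabulated vector, so the induction has to run over an arbitrary
      -- tabulated function.
      count-sum : ∀ {k} (f : Fin k → Fin n) → sum (λ j → restrict (adjacent? v (f j)) x) ≈
        (count (λ j → T? (adjacent? v j)) (Vec.tabulate f) · 1#) * x
      count-sum {zero}  f = sym (zeroˡ x)
      count-sum {suc k} f with adjacent? v (f zero)
      ... | true  = trans (+-congˡ (count-sum (f ∘ suc))) (solve 2 (λ x d → x :+ d :* x := (:1 :+ d) :* x) refl x _)
      ... | false = trans (+-identityˡ _) (count-sum (f ∘ suc))

    module _ (ϑ : Signature Γ) (compatible : Compatible Γ ϑ) where

      incidenceMatrix : Fin n → Fin size → Carrier
      incidenceMatrix v e = fromLabel (incidence Γ ϑ v e)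

      private
        A : Matrix n
        A = adjacency Γ

        θ : Fin n → Fin size → Carrier
        θ v e = fromLabel (just (ϑ v e))

        θθ≈-A : ∀ e → θ (source e) e * θ (target e) e ≈ - A (source e) (target e)
        θθ≈-A e = begin
          θ (source e) e * θ (target e) e                                        ≈⟨ fromLabel-* (ϑ (source e) e) (ϑ (target e) e) ⟨
          fromLabel (just (ϑ (source e) e Sign.* ϑ (target e) e))                ≡⟨ ≡.cong fromLabel (compatible e) ⟩
          fromLabel (Maybe.map Sign.opposite (label (source e) (target e)))      ≈⟨ fromLabel-opposite (label (source e) (target e)) ⟩
          - A (source e) (target e)                                              ∎

        incidence-split : ∀ v e → incidenceMatrix v e ≈ δ v (source e) * θ (source e) e + δ v (target e) * θ (target e) e
        incidence-split v e with v Fin.≟ source e | v Fin.≟ target e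
        ... | yes v≡s | yes v≡t = ⊥-elim (ℕ.<-irrefl (≡.cong toℕ (≡.trans (≡.sym v≡s) v≡t)) (source<target e))
        ... | yes ≡.refl | no _ = solve 2 (λ x y → x := :1 :* x :+ :0 :* y) refl _ _
        ... | no _ | yes ≡.refl = solve 2 (λ x y → y := :0 :* x :+ :1 :* y) refl _ _
        ... | no _ | no _       = solve 2 (λ x y → :0 := :0 :* x :+ :0 :* y) refl _ _

        -- The share of the oriented edge from i to j in the entry (v, w) of the Laplacian: one unit
        -- towards the degree of i, and minus the adjacency entry at (i, j).
        contribution : (v w i j : Fin n) → Carrier
        contribution v w i j = δ v i * δ w i - δ v i * (δ w j * A i j)

        -- Multiplying out the incidence entries leaves squares of signs, which are 1 and form the
        -- degree parts, and the product of the two signs, which compatibility makes minus the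
        -- adjacency entry.
        edge-contribution : ∀ v w e → incidenceMatrix v e * incidenceMatrix w e ≈
          contribution v w (source e) (target e) + contribution v w (target e) (source e)
        edge-contribution v w e = begin
          incidenceMatrix v e * incidenceMatrix w e                        ≈⟨ *-cong (incidence-split v e) (incidence-split w e) ⟩
          (vs * θs + vt * θt) * (ws * θs + wt * θt)
            ≈⟨ solve 6 (λ vs vt ws wt θs θt → (vs :* θs :+ vt :* θt) :* (ws :* θs :+ wt :* θt)
                 := (vs :* ws :* (θs :* θs) :+ vt :* wt :* (θt :* θt)) :+ (vs :* wt :+ vt :* ws) :* (θs :* θt)) refl vs vt ws wt θs θt ⟩
          (vs * ws * (θs * θs) + vt * wt * (θt * θt)) + (vs * wt + vt * ws) * (θs * θt)
            ≈⟨ +-cong (+-cong (*-congˡ (fromLabel-square (ϑ s e))) (*-congˡ (fromLabel-square (ϑ t e)))) (*-congˡ (θθ≈-A e)) ⟩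
          (vs * ws * 1# + vt * wt * 1#) + (vs * wt + vt * ws) * - A s t
            ≈⟨ solve 5 (λ vs vt ws wt a → (vs :* ws :* :1 :+ vt :* wt :* :1) :+ (vs :* wt :+ vt :* ws) :* :- a
                 := (vs :* ws :- vs :* (wt :* a)) :+ (vt :* wt :- vt :* (ws :* a))) refl vs vt ws wt (A s t) ⟩
          contribution v w s t + (vt * wt - vt * (ws * A s t))             ≡⟨ ≡.cong (λ l → contribution v w s t + (vt * wt - vt * (ws * fromLabel l))) (label-sym s t) ⟩
          contribution v w s t + contribution v w t s                      ∎
          where
          s = source e
          t = target e
          vs = δ v s
          vt = δ v t
          ws = δ w s
          wt = δ w t
          θs = θ s e
          θt = θ t e

      -- Each edge supplies the contributions of its two orientations. Over all adjacent ordered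
      -- pairs, the first parts add up to the degree and the second parts single out one adjacency
      -- entry.
      laplacian-factorisation : ∀ v w → laplacian Γ v w ≈ sum (λ e → incidenceMatrix v e * incidenceMatrix w e)
      laplacian-factorisation v w = sym (begin
        sum (λ e → incidenceMatrix v e * incidenceMatrix w e)        ≈⟨ sum-cong-≋ (edge-contribution v w) ⟩
        sum (λ e → contribution v w (source e) (target e) + contribution v w (target e) (source e))
                                                                     ≈⟨ edge-sum-symmetric Γ (contribution v w) ⟩
        sum (λ i → sum λ j → restrict (adjacent? i j) (contribution v w i j)) ≈⟨ sum-cong-≋ (λ i → sum-cong-≋ λ j → restricted i j) ⟩
        sum (λ i → sum λ j → δ v i * X i j)                          ≈⟨ sum-cong-≋ (λ i → *-distribˡ-sum (δ v i) (X i)) ⟨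
        sum (λ i → δ v i * sum (X i))                                ≈⟨ sum-δ* (λ i → sum (X i)) v ⟩
        sum (λ j → restrict (adjacent? v j) (δ w v) + - (δ w j * A v j)) ≈⟨ ∑-distrib-+ (λ j → restrict (adjacent? v j) (δ w v)) (λ j → - (δ w j * A v j)) ⟩
        sum (λ j → restrict (adjacent? v j) (δ w v)) + sum (λ j → - (δ w j * A v j))
                                                                     ≈⟨ +-cong (degree-sum v (δ w v)) (sum-cong-≋ λ j → solve 2 (λ d a → :- (d :* a) := d :* :- a) refl (δ w j) (A v j)) ⟩
        degree v · 1# * δ w v + sum (λ j → δ w j * - A v j)          ≈⟨ +-cong (diagonal-entry v w) (sum-δ* (λ j → - A v j) w) ⟩
        laplacian Γ v w                                              ∎)
        where
        X : (i j : Fin n) → Carrier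
        -- Only the degree part needs the restriction; the adjacency entry vanishes at non-adjacent
        -- pairs by itself.
        X i j = restrict (adjacent? i j) (δ w i) - δ w j * A i j
        restricted : ∀ i j → restrict (adjacent? i j) (contribution v w i j) ≈ δ v i * X i j
        restricted i j with label i j
        ... | just s  = solve 4 (λ vi wi wj a → vi :* wi :- vi :* (wj :* a) := vi :* (wi :- wj :* a)) refl (δ v i) (δ w i) (δ w j) (fromLabel (just s))
        ... | nothing = solve 2 (λ vi wj → :0 := vi :* (:0 :- wj :* :0)) refl (δ v i) (δ w j)
        diagonal-entry : ∀ v w → degree v · 1# * δ w v ≈ diagonal (λ i → degree i · 1#) v w
        diagonal-entry v w with v Fin.≟ w
        ... | yes ≡.refl = trans (*-congˡ (diagonal-≡ (λ _ → 1#) v)) (*-identityʳ _)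
        ... | no v≢w = trans (*-congˡ (diagonal-≢ (λ _ → 1#) (v≢w ∘ ≡.sym))) (zeroʳ _)

-- Characteristic polynomials of the two products and of the subdivision.

module ProductSpectra {c ℓ₁ ℓ₂} (ℝ : RealNumbers c ℓ₁ ℓ₂) where
  open RealNumbers ℝ hiding (zero)
  open Spectral ℝ
  open CommutativeRing commutativeRing using (semiring; ring)
  open RingProperties ring using (-0#≈0#; -‿involutive)
  open SemiringSum semiring hiding (sum)
  open IntegerSolver commutativeRing
  open SetoidReasoning setoid
  open Determinants ℝ
  open BlockDeterminants ℝ
  open SchurDeterminants ℝ
  open OrderedField ℝ
  open Polynomials ℝ
  open IncidenceMatrix ℝ

  private
    variable
      n : ℕ

  -ᴹ_ : Matrix n → Matrix n
  (-ᴹ M) i j = - M i j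

  pair↔⊎ : (Fin n ⊎ Fin n) ↔ (Fin n × Fin 2)
  pair↔⊎ {n} = mk↔ₛ′ to from to-from from-to
    where
    to : Fin n ⊎ Fin n → Fin n × Fin 2
    to (inj₁ i) = i , zero
    to (inj₂ i) = i , suc zero
    from : Fin n × Fin 2 → Fin n ⊎ Fin n
    from (i , zero)     = inj₁ i
    from (i , suc zero) = inj₂ i
    to-from : ∀ x → to (from x) ≡ x
    to-from (i , zero)     = ≡.refl
    to-from (i , suc zero) = ≡.refl
    from-to : ∀ x → from (to x) ≡ x
    from-to (inj₁ i) = ≡.refl
    from-to (inj₂ i) = ≡.refl

  -- `remQuot 2` alternates between the two copies of the first graph; relisting one whole copy
  -- after the other produces the block form.
  det-pairs : (K : Fin n × Fin 2 → Fin n × Fin 2 → Carrier) (P Q : Matrix n) →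
    (∀ i j → K (i , zero) (j , zero) ≈ P i j) → (∀ i j → K (i , suc zero) (j , suc zero) ≈ P i j) →
    (∀ i j → K (i , zero) (j , suc zero) ≈ Q i j) → (∀ i j → K (i , suc zero) (j , zero) ≈ Q i j) →
    det (λ i j → K (remQuot 2 i) (remQuot 2 j)) ≈ det (λ i j → P i j + Q i j) * det (λ i j → P i j - Q i j)
  det-pairs {n} K P Q K₀₀ K₁₁ K₀₁ K₁₀ = begin
    det (λ i j → K (remQuot {n} 2 i) (remQuot 2 j)) ≈⟨ det-reindex (Fin.*↔× {n} {2}) (pair↔⊎ ↔-∘ Fin.+↔⊎) K ⟩
    det⊎ {n} {n} (λ x y → K (to x) (to y))       ≈⟨ det⊎-cong {n} {n} {λ x y → K (to x) (to y)} {block P Q Q P} entries ⟩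
    det⊎ (block P Q Q P)                         ≈⟨ det-circulant P Q ⟩
    det (λ i j → P i j + Q i j) * det (λ i j → P i j - Q i j) ∎
    where
    open Inverse (pair↔⊎ {n}) using (to)
    entries : ∀ x y → K (to x) (to y) ≈ block P Q Q P x y
    entries (inj₁ i) (inj₁ j) = K₀₀ i j
    entries (inj₁ i) (inj₂ j) = K₀₁ i j
    entries (inj₂ i) (inj₁ j) = K₁₀ i j
    entries (inj₂ i) (inj₂ j) = K₁₁ i j

  diagonal-pairs : ∀ x (i j : Fin (n ℕ.* 2)) →
    diagonal (λ _ → x) i j ≈ diagonal (λ _ → x) (proj₁ (remQuot {n} 2 i)) (proj₁ (remQuot {n} 2 j)) * δ (proj₂ (remQuot {n} 2 i)) (proj₂ (remQuot {n} 2 j))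
  diagonal-pairs {n} x i j with i Fin.≟ j
  ... | yes ≡.refl = sym (trans (*-cong (diagonal-≡ (λ _ → x) (proj₁ (remQuot {n} 2 i))) (diagonal-≡ (λ _ → 1#) (proj₂ (remQuot {n} 2 i)))) (*-identityʳ x))
  ... | no i≢j with proj₁ (remQuot {n} 2 i) Fin.≟ proj₁ (remQuot {n} 2 j)
  ...   | no _ = sym (zeroˡ _)
  ...   | yes eq₁ = sym (trans (*-congˡ (diagonal-≢ (λ _ → 1#) λ eq₂ → i≢j (≡.trans (≡.sym (Fin.combine-remQuot {n} 2 i))
                      (≡.trans (≡.cong₂ combine eq₁ eq₂) (Fin.combine-remQuot {n} 2 j))))) (zeroʳ x))

  diagonal-+ : ∀ x y (i j : Fin n) → diagonal (λ _ → x) i j + diagonal (λ _ → y) i j ≈ diagonal (λ _ → x + y) i j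
  diagonal-+ x y i j with i Fin.≟ j
  ... | yes _ = refl
  ... | no _  = +-identityˡ 0#

  diagonal-neg : ∀ x (i j : Fin n) → - diagonal (λ _ → x) i j ≈ diagonal (λ _ → - x) i j
  diagonal-neg x i j with i Fin.≟ j
  ... | yes _ = refl
  ... | no _  = -0#≈0#

  module _ (Γ : SignedGraph n) where
    open SignedGraph Γ

    private
      A : Matrix n
      A = adjacency Γ

    -- The adjacency matrix is [[A, I], [I, A]], so the blocks are xI - A and -I, and their sum and
    -- difference only shift x.
    charPoly-×K₂ : ∀ x → charPoly (adjacency (Γ ×ˢ K₂)) x ≈ charPoly A (x - 1#) * charPoly A (x + 1#)
    charPoly-×K₂ x = begin
      charPoly (adjacency (Γ ×ˢ K₂)) x               ≈⟨ det-cong {n ℕ.* 2} (λ i j → +-congʳ (diagonal-pairs {n} x i j)) ⟩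
      det {n ℕ.* 2} (λ i j → K (remQuot 2 i) (remQuot 2 j)) ≈⟨ det-pairs K P Q same₀ same₁ cross₀ cross₁ ⟩
      det (λ i j → P i j + Q i j) * det (λ i j → P i j - Q i j) ≈⟨ *-cong (det-cong plus) (det-cong minus) ⟩
      charPoly A (x - 1#) * charPoly A (x + 1#)      ∎
      where
      K : Fin n × Fin 2 → Fin n × Fin 2 → Carrier
      K p q = diagonal (λ _ → x) (proj₁ p) (proj₁ q) * δ (proj₂ p) (proj₂ q) - fromLabel (cartesianLabel Γ K₂ p q)
      P Q : Matrix n
      P i j = diagonal (λ _ → x) i j - A i j
      Q i j = - δ i j
      same₀ : ∀ i j → K (i , zero) (j , zero) ≈ P i j
      same₀ i j = +-congʳ (*-identityʳ _)
      same₁ : ∀ i j → K (i , suc zero) (j , suc zero) ≈ P i j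
      same₁ i j = +-congʳ (*-identityʳ _)
      cross₀ : ∀ i j → K (i , zero) (j , suc zero) ≈ Q i j
      cross₀ i j with i Fin.≟ j
      ... | yes _ = trans (+-congʳ (zeroʳ _)) (+-identityˡ _)
      ... | no _  = trans (+-congʳ (zeroʳ _)) (+-identityˡ _)
      cross₁ : ∀ i j → K (i , suc zero) (j , zero) ≈ Q i j
      cross₁ i j with i Fin.≟ j
      ... | yes _ = trans (+-congʳ (zeroʳ _)) (+-identityˡ _)
      ... | no _  = trans (+-congʳ (zeroʳ _)) (+-identityˡ _)
      plus : ∀ i j → P i j + Q i j ≈ (diagonal (λ _ → x - 1#) -ᴹ A) i j
      plus i j = trans (solve 3 (λ d a e → d :- a :+ e := (d :+ e) :- a) refl (diagonal (λ _ → x) i j) (A i j) (- δ i j))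
        (+-congʳ (trans (+-congˡ (diagonal-neg 1# i j)) (diagonal-+ x (- 1#) i j)))
      minus : ∀ i j → P i j - Q i j ≈ (diagonal (λ _ → x + 1#) -ᴹ A) i j
      minus i j = trans (solve 3 (λ d a e → d :- a :- :- e := (d :+ e) :- a) refl (diagonal (λ _ → x) i j) (A i j) (δ i j))
        (+-congʳ (diagonal-+ x 1# i j))

    -- The adjacency matrix is [[0, A], [A, 0]], so the blocks are xI and -A.
    charPoly-⊗K₂ : ∀ x → charPoly (adjacency (Γ ⊗ K₂)) x ≈ charPoly A x * charPoly (-ᴹ A) x
    charPoly-⊗K₂ x = begin
      charPoly (adjacency (Γ ⊗ K₂)) x                ≈⟨ det-cong {n ℕ.* 2} (λ i j → +-congʳ (diagonal-pairs {n} x i j)) ⟩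
      det {n ℕ.* 2} (λ i j → K (remQuot 2 i) (remQuot 2 j)) ≈⟨ det-pairs K P (-ᴹ A) (same zero) (same (suc zero)) cross₀ cross₁ ⟩
      det (λ i j → P i j + - A i j) * det (λ i j → P i j - - A i j) ∎
      where
      K : Fin n × Fin 2 → Fin n × Fin 2 → Carrier
      K p q = diagonal (λ _ → x) (proj₁ p) (proj₁ q) * δ (proj₂ p) (proj₂ q) - fromLabel (kroneckerLabel Γ K₂ p q)
      P : Matrix n
      P = diagonal (λ _ → x)
      no-loops : ∀ a (l : Maybe Sign) → fromLabel (Maybe.zipWith Sign._*_ l (SignedGraph.label K₂ a a)) ≈ 0#
      no-loops a l rewrite SignedGraph.label-irrefl K₂ a with l
      ... | just _  = refl
      ... | nothing = refl
      positive : ∀ (l : Maybe Sign) → fromLabel (Maybe.zipWith Sign._*_ l (just Sign.+)) ≈ fromLabel l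
      positive nothing       = refl
      positive (just Sign.+) = refl
      positive (just Sign.-) = refl
      same : ∀ a i j → K (i , a) (j , a) ≈ P i j
      same a i j = trans (+-cong (trans (*-congˡ (diagonal-≡ (λ _ → 1#) a)) (*-identityʳ _)) (trans (-‿cong (no-loops a (label i j))) -0#≈0#)) (+-identityʳ _)
      cross₀ : ∀ i j → K (i , zero) (j , suc zero) ≈ - A i j
      cross₀ i j = trans (+-cong (zeroʳ _) (-‿cong (positive (label i j)))) (+-identityˡ _)
      cross₁ : ∀ i j → K (i , suc zero) (j , zero) ≈ - A i j
      cross₁ i j = trans (+-cong (zeroʳ _) (-‿cong (positive (label i j)))) (+-identityˡ _)

  diagonal-splitAt : ∀ a {b} x (i j : Fin (a ℕ.+ b)) →
    diagonal (λ _ → x) i j ≈ block (diagonal (λ _ → x)) 𝟘 𝟘 (diagonal (λ _ → x)) (splitAt a i) (splitAt a j)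
  diagonal-splitAt a {b} x i j = by-cases (splitAt a i) (splitAt a j) ≡.refl ≡.refl
    where
    d : ∀ {n} → Matrix n
    d = diagonal (λ _ → x)
    on : ∀ p → block d 𝟘 𝟘 d p p ≈ x
    on (inj₁ k) = diagonal-≡ (λ _ → x) k
    on (inj₂ k) = diagonal-≡ (λ _ → x) k
    off : ∀ p q → p ≢ q → block d 𝟘 𝟘 d p q ≈ 0#
    off (inj₁ k) (inj₁ l) p≢q = diagonal-≢ (λ _ → x) (p≢q ∘ ≡.cong inj₁)
    off (inj₁ k) (inj₂ l) p≢q = refl
    off (inj₂ k) (inj₁ l) p≢q = refl
    off (inj₂ k) (inj₂ l) p≢q = diagonal-≢ (λ _ → x) (p≢q ∘ ≡.cong inj₂)
    by-cases : ∀ p q → splitAt a i ≡ p → splitAt a j ≡ q → d i j ≈ block d 𝟘 𝟘 d p q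
    by-cases p q eqp eqq with i Fin.≟ j
    ... | yes ≡.refl rewrite ≡.trans (≡.sym eqp) eqq = sym (on q)
    ... | no i≢j = sym (off p q λ p≡q → i≢j (≡.trans (≡.sym (Fin.join-splitAt a b i))
            (≡.trans (≡.cong (Fin.join a b) (≡.trans eqp (≡.trans p≡q (≡.sym eqq)))) (Fin.join-splitAt a b j))))

  *-cancelˡ-pos : ∀ {x y z} → 0# < x → x * y ≈ x * z → y ≈ z
  *-cancelˡ-pos 0<x xy≈xz = ≤-antisym (*-cancel-≤ˡ 0<x (≤-reflexive xy≈xz)) (*-cancel-≤ˡ 0<x (≤-reflexive (sym xy≈xz)))

  product-pos : {t : Vector Carrier n} → (∀ i → 0# < t i) → 0# < product t
  product-pos {zero}  0<t = 0<1
  product-pos {suc n} 0<t = *-pos (0<t zero) (product-pos (0<t ∘ suc))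

  module _ (Γ : SignedGraph n) (ϑ : Signature Γ) (compatible : Compatible Γ ϑ) where
    open SignedGraph Γ using (size)

    private
      B : Fin n → Fin size → Carrier
      B = incidenceMatrix Γ ϑ compatible

      A : Matrix (n ℕ.+ size)
      A = adjacency (subdivision Γ ϑ)

    subdivision-adjacency : ∀ i j → A i j ≈ block 𝟘 B (λ e v → B v e) 𝟘 (splitAt n i) (splitAt n j)
    subdivision-adjacency i j with splitAt n i | splitAt n j
    ... | inj₁ v | inj₁ w = refl
    ... | inj₁ v | inj₂ e = refl
    ... | inj₂ e | inj₁ v = refl
    ... | inj₂ e | inj₂ f = refl

    -- The powers of y stay on both sides: that n is at most `size` is itself drawn from this
    -- identity.
    charPoly-subdivision′ : ∀ y →
      product {n} (λ _ → y) * charPoly A y ≈ charPoly (laplacian Γ) (y * y) * product {size} (λ _ → y)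
    charPoly-subdivision′ y = trans
      (*-congˡ (det-cong {n ℕ.+ size} λ i j → trans (+-cong (diagonal-splitAt n y i j) (-‿cong (subdivision-adjacency i j))) (entries (splitAt n i) (splitAt n j))))
      (det-bipartite B (laplacian Γ) (laplacian-factorisation Γ ϑ compatible) y)
      where
      Y : ∀ {k} → Matrix k
      Y = diagonal (λ _ → y)
      entries : ∀ p q → block Y 𝟘 𝟘 Y p q - block 𝟘 B (λ e v → B v e) 𝟘 p q
        ≈ block Y (λ v e → - B v e) (λ e v → - B v e) Y p q
      entries (inj₁ v) (inj₁ w) = trans (+-congˡ -0#≈0#) (+-identityʳ _)
      entries (inj₁ v) (inj₂ e) = +-identityˡ _
      entries (inj₂ e) (inj₁ v) = +-identityˡ _
      entries (inj₂ e) (inj₂ f) = trans (+-congˡ -0#≈0#) (+-identityʳ _)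

    -- Replacing B by -B does not change B Bᵀ. This is the symmetry of a bipartite spectrum, and it
    -- makes the two factors for the Kronecker product equal.
    charPoly-neg-subdivision′ : ∀ y →
      product {n} (λ _ → y) * charPoly (-ᴹ A) y ≈ charPoly (laplacian Γ) (y * y) * product {size} (λ _ → y)
    charPoly-neg-subdivision′ y = trans
      (*-congˡ (det-cong {n ℕ.+ size} λ i j → trans (+-cong (diagonal-splitAt n y i j) (-‿cong (-‿cong (subdivision-adjacency i j)))) (entries (splitAt n i) (splitAt n j))))
      (det-bipartite (λ v e → - B v e) (laplacian Γ)
        (λ v w → trans (laplacian-factorisation Γ ϑ compatible v w) (sum-cong-≋ λ e → solve 2 (λ x y → x :* y := :- x :* :- y) refl (B v e) (B w e))) y)
      where
      Y : ∀ {k} → Matrix k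
      Y = diagonal (λ _ → y)
      entries : ∀ p q → block Y 𝟘 𝟘 Y p q - - block 𝟘 B (λ e v → B v e) 𝟘 p q
        ≈ block Y (λ v e → - - B v e) (λ e v → - - B v e) Y p q
      entries (inj₁ v) (inj₁ w) = trans (+-congˡ (-‿involutive _)) (+-identityʳ _)
      entries (inj₁ v) (inj₂ e) = +-identityˡ _
      entries (inj₂ e) (inj₁ v) = +-identityˡ _
      entries (inj₂ e) (inj₂ f) = trans (+-congˡ (-‿involutive _)) (+-identityʳ _)

    module _ (μ : Vector Carrier n) (μ-spectrum : IsSpectrum (laplacian Γ) μ) where

      -- This is det(y²I - L(Γ)), which becomes the characteristic polynomial of the subdivision
      -- once n = `size`.
      Φ : Carrier → Carrier
      Φ y = product (λ i → y * y - μ i)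

      polynomial-Φ : IsPolynomial Φ
      polynomial-Φ = polynomial-product λ i → polynomial-+ (polynomial-* polynomial-identity polynomial-identity) (polynomial-constant (- μ i))

      -- If size < n then y divides Φ(y), so that Φ(0) = 0 and some μ i is 0.
      size≥ : (∀ i → 0# < μ i) → n ℕ.≤ size
      size≥ 0<μ with n ℕ.≤? size
      ... | yes n≤m = n≤m
      ... | no n≰m = ⊥-elim (product-nonzero (λ i → 0# * 0# - μ i)
        (λ i eq → <-irrefl (trans (sym (-0#≈0#)) (trans (-‿cong (trans (sym eq) (solve 1 (λ m → :0 :* :0 :- m := :- m) refl (μ i)))) (-‿involutive _))) (0<μ i))
        (trans (sym (Φ≈yF 0#)) (zeroˡ _)))
        where
        -- `suc d` is the positive difference n - `size`; one factor y is kept outside `F` so that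
        -- the product visibly vanishes at 0.
        d = n ℕ.∸ suc size
        n≡ : n ≡ size ℕ.+ suc d
        n≡ = ≡.sym (≡.trans (ℕ.+-suc size d) (ℕ.m+[n∸m]≡n (ℕ.≰⇒> n≰m)))
        product-+ : ∀ k l y → product {k ℕ.+ l} (λ _ → y) ≈ product {k} (λ _ → y) * product {l} (λ _ → y)
        product-+ zero    l y = sym (*-identityˡ _)
        product-+ (suc k) l y = trans (*-congˡ (product-+ k l y)) (sym (*-assoc _ _ _))
        F : Carrier → Carrier
        F y = product {d} (λ _ → y) * charPoly A y
        Φ≈yF : ∀ y → y * F y ≈ Φ y
        Φ≈yF = polynomial-ext
          (polynomial-* polynomial-identity (polynomial-* (polynomial-product {d} λ _ → polynomial-identity) (polynomial-charPoly A)))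
          polynomial-Φ 0# λ y 0<y → cancel y 0<y
          where
          cancel : ∀ y → 0# < y → y * F y ≈ Φ y
          cancel y 0<y = *-cancelˡ-pos (product-pos {size} (λ _ → 0<y)) (begin
            Π size * (y * (Π d * charPoly A y))    ≈⟨ solve 4 (λ p y q c → p :* (y :* (q :* c)) := p :* (y :* q) :* c) refl (Π size) y (Π d) (charPoly A y) ⟩
            Π size * Π (suc d) * charPoly A y      ≈⟨ *-congʳ (product-+ size (suc d) y) ⟨
            Π (size ℕ.+ suc d) * charPoly A y      ≡⟨ ≡.cong (λ k → Π k * charPoly A y) n≡ ⟨
            Π n * charPoly A y                     ≈⟨ charPoly-subdivision′ y ⟩
            charPoly (laplacian Γ) (y * y) * Π size ≈⟨ *-comm _ _ ⟩
            Π size * charPoly (laplacian Γ) (y * y) ≈⟨ *-congˡ (μ-spectrum (y * y)) ⟩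
            Π size * Φ y                           ∎)
            where
            Π : ℕ → Carrier
            Π k = product {k} (λ _ → y)

      charPoly-cancel : n ≡ size → (M : Matrix (n ℕ.+ size)) →
        (∀ y → product {n} (λ _ → y) * charPoly M y ≈ charPoly (laplacian Γ) (y * y) * product {size} (λ _ → y)) →
        ∀ y → charPoly M y ≈ Φ y
      charPoly-cancel n≡m M eq = polynomial-ext (polynomial-charPoly M) polynomial-Φ 0# λ y 0<y →
        *-cancelˡ-pos (product-pos {n} (λ _ → 0<y)) (begin
          product {n} (λ _ → y) * charPoly M y                          ≈⟨ eq y ⟩
          charPoly (laplacian Γ) (y * y) * product {size} (λ _ → y)     ≡⟨ ≡.cong (λ k → charPoly (laplacian Γ) (y * y) * product {k} (λ _ → y)) n≡m ⟨
          charPoly (laplacian Γ) (y * y) * product {n} (λ _ → y)        ≈⟨ *-comm _ _ ⟩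
          product {n} (λ _ → y) * charPoly (laplacian Γ) (y * y)        ≈⟨ *-congˡ (μ-spectrum (y * y)) ⟩
          product {n} (λ _ → y) * Φ y                                   ∎)

      charPoly-×K₂-subdivision : n ≡ size → ∀ x →
        charPoly (adjacency (subdivision Γ ϑ ×ˢ K₂)) x ≈ Φ (x - 1#) * Φ (x + 1#)
      charPoly-×K₂-subdivision n≡m x = trans (charPoly-×K₂ (subdivision Γ ϑ) x)
        (*-cong (charPoly-cancel n≡m A charPoly-subdivision′ (x - 1#)) (charPoly-cancel n≡m A charPoly-subdivision′ (x + 1#)))

      charPoly-⊗K₂-subdivision : n ≡ size → ∀ x →
        charPoly (adjacency (subdivision Γ ϑ ⊗ K₂)) x ≈ Φ x * Φ x
      charPoly-⊗K₂-subdivision n≡m x = trans (charPoly-⊗K₂ (subdivision Γ ϑ) x)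
        (*-cong (charPoly-cancel n≡m A charPoly-subdivision′ x) (charPoly-cancel n≡m (-ᴹ A) charPoly-neg-subdivision′ x))

-- Explicit spectra and the comparison of the energies.

module Energy {c ℓ₁ ℓ₂} (ℝ : RealNumbers c ℓ₁ ℓ₂) where
  open RealNumbers ℝ hiding (zero)
  open Spectral ℝ
  open CommutativeRing commutativeRing using (semiring; +-commutativeMonoid; *-commutativeMonoid)
  open SemiringSum semiring hiding (sum)
  open MonoidSum *-commutativeMonoid using () renaming (sum-cong-≋ to product-cong; ∑-distrib-+ to product-distrib-*)
  open IntegerSolver commutativeRing
  open SetoidReasoning setoid
  open OrderedField ℝ
  open Polynomials ℝ
  open ProductSpectra ℝ
  open ConcatenatedSum +-commutativeMonoid using () renaming (sum-splitAt to sum-splitAt)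
  open ConcatenatedSum *-commutativeMonoid using () renaming (sum-splitAt to product-splitAt)

  private
    variable
      m n : ℕ

  sum-mono-≤ : {f g : Vector Carrier n} → (∀ i → f i ≤ g i) → sum f ≤ sum g
  sum-mono-≤ {zero}  f≤g = ≤-refl
  sum-mono-≤ {suc n} f≤g = +-mono-≤ (f≤g zero) (sum-mono-≤ (f≤g ∘ suc))

  sum-mono-< : {f g : Vector Carrier n} → (∀ i → f i ≤ g i) → ∀ j → f j < g j → sum f < sum g
  sum-mono-< {suc n} {f} {g} f≤g j fj<gj = <-resp (sym (sum-remove {i = j} f)) (sym (sum-remove {i = j} g))
    (+-mono-<-≤ fj<gj (sum-mono-≤ (f≤g ∘ punchIn j)))

  sum-++ : (F : Carrier → Carrier) (a : Vector Carrier m) (b : Vector Carrier n) →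
    sum (F ∘ (a ++ b)) ≈ sum (F ∘ a) + sum (F ∘ b)
  sum-++ {m} F a b = sum-splitAt m (λ x → F (Sum.[ a , b ] x))

  product-++ : (F : Carrier → Carrier) (a : Vector Carrier m) (b : Vector Carrier n) →
    product (F ∘ (a ++ b)) ≈ product (F ∘ a) * product (F ∘ b)
  product-++ {m} F a b = product-splitAt m (λ x → F (Sum.[ a , b ] x))

  concat₄ : (a b c d : Vector Carrier n) → Vector Carrier (n ℕ.+ (n ℕ.+ (n ℕ.+ n)))
  concat₄ a b c d = a ++ (b ++ (c ++ d))

  sum-concat₄ : ∀ F (a b c d : Vector Carrier n) →
    sum (F ∘ concat₄ a b c d) ≈ sum (λ i → F (a i) + (F (b i) + (F (c i) + F (d i))))
  sum-concat₄ F a b c d = begin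
    sum (F ∘ concat₄ a b c d)                                              ≈⟨ sum-++ F a _ ⟩
    sum (F ∘ a) + sum (F ∘ (b ++ (c ++ d)))                                ≈⟨ +-congˡ (trans (sum-++ F b _) (+-congˡ (sum-++ F c d))) ⟩
    sum (F ∘ a) + (sum (F ∘ b) + (sum (F ∘ c) + sum (F ∘ d)))              ≈⟨ +-congˡ (+-congˡ (∑-distrib-+ (F ∘ c) (F ∘ d))) ⟨
    sum (F ∘ a) + (sum (F ∘ b) + sum (λ i → F (c i) + F (d i)))            ≈⟨ +-congˡ (∑-distrib-+ (F ∘ b) (λ i → F (c i) + F (d i))) ⟨
    sum (F ∘ a) + sum (λ i → F (b i) + (F (c i) + F (d i)))                ≈⟨ ∑-distrib-+ (F ∘ a) (λ i → F (b i) + (F (c i) + F (d i))) ⟨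
    sum (λ i → F (a i) + (F (b i) + (F (c i) + F (d i))))                  ∎

  product-concat₄ : ∀ F (a b c d : Vector Carrier n) →
    product (F ∘ concat₄ a b c d) ≈ product (λ i → F (a i) * F (b i)) * product (λ i → F (c i) * F (d i))
  product-concat₄ F a b c d = begin
    product (F ∘ concat₄ a b c d)                                                    ≈⟨ product-++ F a _ ⟩
    product (F ∘ a) * product (F ∘ (b ++ (c ++ d)))                                  ≈⟨ *-congˡ (trans (product-++ F b _) (*-congˡ (product-++ F c d))) ⟩
    product (F ∘ a) * (product (F ∘ b) * (product (F ∘ c) * product (F ∘ d)))        ≈⟨ *-assoc _ _ _ ⟨
    product (F ∘ a) * product (F ∘ b) * (product (F ∘ c) * product (F ∘ d))          ≈⟨ *-cong (product-distrib-* (F ∘ a) (F ∘ b)) (product-distrib-* (F ∘ c) (F ∘ d)) ⟨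
    product (λ i → F (a i) * F (b i)) * product (λ i → F (c i) * F (d i))            ∎

  -- Carries the list of 4n eigenvalues to the length that the product graphs demand. Only sums and
  -- products over the list are ever used, so no transport appears in later goals.
  relength : m ≡ n → (v : Vector Carrier m) → ∃ λ (w : Vector Carrier n) →
    (∀ F → sum (F ∘ w) ≈ sum (F ∘ v)) × (∀ F → product (F ∘ w) ≈ product (F ∘ v))
  relength ≡.refl v = v , (λ _ → refl) , (λ _ → refl)

  module _ {k : ℕ} (Γ : SignedGraph (suc k)) (unicyclic : Unicyclic Γ) (ϑ : Signature Γ) (compatible : Compatible Γ ϑ)
    (μ : Vector Carrier (suc k)) (μ-spectrum : IsSpectrum (laplacian Γ) μ)
    (antitone : ∀ {i j} → i Fin.≤ j → μ j ≤ μ i) (0<μₙ : 0# < μ (fromℕ k))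
    (s : Vector Carrier (suc k)) (0<s : ∀ i → 0# < s i) (s²≈μ : ∀ i → s i * s i ≈ μ i) where

    open SignedGraph Γ using (size)

    N : ℕ
    N = (suc k ℕ.+ size) ℕ.* 2

    last : Fin (suc k)
    last = fromℕ k

    S×K₂ S⊗K₂ : SignedGraph N
    S×K₂ = subdivision Γ ϑ ×ˢ K₂
    S⊗K₂ = subdivision Γ ϑ ⊗ K₂

    μₙ≤μ : ∀ i → μ last ≤ μ i
    μₙ≤μ i = antitone (Fin.≤fromℕ i)

    0<μ : ∀ i → 0# < μ i
    0<μ i = <-≤-trans 0<μₙ (μₙ≤μ i)

    n≡size : suc k ≡ size
    n≡size = ℕ.≤-antisym (size≥ Γ ϑ compatible μ μ-spectrum 0<μ) (unicyclic⇒size≤ Γ unicyclic)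

    φ : Carrier → Carrier
    φ = Φ Γ ϑ compatible μ μ-spectrum

    charPoly-× : ∀ x → charPoly (adjacency S×K₂) x ≈ φ (x - 1#) * φ (x + 1#)
    charPoly-× = charPoly-×K₂-subdivision Γ ϑ compatible μ μ-spectrum n≡size

    charPoly-⊗ : ∀ x → charPoly (adjacency S⊗K₂) x ≈ φ x * φ x
    charPoly-⊗ = charPoly-⊗K₂-subdivision Γ ϑ compatible μ μ-spectrum n≡size

    -- At the largest eigenvalue √μ₁ + 1 of the Cartesian product the
    -- other characteristic polynomial is positive.
    noncospectral : Noncospectral S×K₂ S⊗K₂
    noncospectral (λs , ×-spectrum , ⊗-spectrum) = <-irrefl (sym ⊗≈0) 0<⊗
      where
      x = s zero + 1#
      ⊗≈0 : φ x * φ x ≈ 0#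
      ⊗≈0 = begin
        φ x * φ x                      ≈⟨ charPoly-⊗ x ⟨
        charPoly (adjacency S⊗K₂) x    ≈⟨ trans (⊗-spectrum x) (sym (×-spectrum x)) ⟩
        charPoly (adjacency S×K₂) x    ≈⟨ charPoly-× x ⟩
        φ (x - 1#) * φ (x + 1#)        ≈⟨ *-congʳ (*-congʳ (trans (+-cong
                                             (trans (solve 1 (λ s → (s :+ :1 :- :1) :* (s :+ :1 :- :1) := s :* s) refl (s zero)) (s²≈μ zero)) refl) (-‿inverseʳ _))) ⟩
        0# * _ * φ (x + 1#)            ≈⟨ trans (*-congʳ (zeroˡ _)) (zeroˡ _) ⟩
        0#                             ∎
      0<φ : 0# < φ x
      0<φ = product-pos λ i → diff-pos (≤-<-trans (antitone {zero} {i} ℕ.z≤n)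
        (<-respˡ (s²≈μ zero) (square-mono-< (<⇒≤ (0<s zero)) (<-respˡ (+-identityʳ _) (<-resp (+-comm _ _) (+-comm _ _) (+-monoˡ-< (s zero) 0<1))))))
      0<⊗ : 0# < φ x * φ x
      0<⊗ = *-pos 0<φ 0<φ

    length-eq : suc k ℕ.+ (suc k ℕ.+ (suc k ℕ.+ suc k)) ≡ N
    length-eq = ≡.trans quadruple (≡.cong (λ m → (suc k ℕ.+ m) ℕ.* 2) n≡size)
      where
      open +-*-Solver renaming (solve to ℕ-solve; con to ℕ-con; _:+_ to _⊕_; _:*_ to _⊛_; _:=_ to _⊜_)
      quadruple : suc k ℕ.+ (suc k ℕ.+ (suc k ℕ.+ suc k)) ≡ (suc k ℕ.+ suc k) ℕ.* 2
      quadruple = ℕ-solve 1 (λ n → n ⊕ (n ⊕ (n ⊕ n)) ⊜ (n ⊕ n) ⊛ ℕ-con 2) ≡.refl (suc k)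

    -- The order follows the factorisation: in `v×` the first two families are the roots of φ(x - 1)
    -- and the last two those of φ(x + 1); in `v⊗` each pair consists of the roots of one factor
    -- φ(x).
    v× v⊗ : Vector Carrier (suc k ℕ.+ (suc k ℕ.+ (suc k ℕ.+ suc k)))
    v× = concat₄ (λ i → 1# + s i) (λ i → 1# - s i) (λ i → s i - 1#) (λ i → - (1# + s i))
    v⊗ = concat₄ s (λ i → - s i) s (λ i → - s i)

    λ× λ⊗ : Vector Carrier N
    λ× = proj₁ (relength length-eq v×)
    λ⊗ = proj₁ (relength length-eq v⊗)

    λ×-spectrum : IsSpectrum (adjacency S×K₂) λ×
    λ×-spectrum x = begin
      charPoly (adjacency S×K₂) x       ≈⟨ charPoly-× x ⟩
      φ (x - 1#) * φ (x + 1#)           ≈⟨ *-cong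
        (product-cong λ i → trans (+-congˡ (-‿cong (sym (s²≈μ i)))) (solve 2 (λ x s → (x :- :1) :* (x :- :1) :- s :* s := (x :- (:1 :+ s)) :* (x :- (:1 :- s))) refl x (s i)))
        (product-cong λ i → trans (+-congˡ (-‿cong (sym (s²≈μ i)))) (solve 2 (λ x s → (x :+ :1) :* (x :+ :1) :- s :* s := (x :- (s :- :1)) :* (x :- :- (:1 :+ s))) refl x (s i))) ⟩
      _                                 ≈⟨ product-concat₄ (λ y → x - y) (λ i → 1# + s i) (λ i → 1# - s i) (λ i → s i - 1#) (λ i → - (1# + s i)) ⟨
      product (λ i → x - v× i)          ≈⟨ proj₂ (proj₂ (relength length-eq v×)) (λ y → x - y) ⟨
      product (λ i → x - λ× i)          ∎

    λ⊗-spectrum : IsSpectrum (adjacency S⊗K₂) λ⊗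
    λ⊗-spectrum x = begin
      charPoly (adjacency S⊗K₂) x       ≈⟨ charPoly-⊗ x ⟩
      φ x * φ x                         ≈⟨ *-cong factor factor ⟩
      _                                 ≈⟨ product-concat₄ (λ y → x - y) s (λ i → - s i) s (λ i → - s i) ⟨
      product (λ i → x - v⊗ i)          ≈⟨ proj₂ (proj₂ (relength length-eq v⊗)) (λ y → x - y) ⟨
      product (λ i → x - λ⊗ i)          ∎
      where
      factor : φ x ≈ product (λ i → (x - s i) * (x - - s i))
      factor = product-cong λ i → trans (+-congˡ (-‿cong (sym (s²≈μ i)))) (solve 2 (λ x s → x :* x :- s :* s := (x :- s) :* (x :- :- s)) refl x (s i))

    e× e⊗ : Vector Carrier (suc k)
    e× i = ∣ 1# + s i ∣ + (∣ 1# - s i ∣ + (∣ s i - 1# ∣ + ∣ - (1# + s i) ∣))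
    e⊗ i = s i + (s i + (s i + s i))

    energy-× : sum (λ i → ∣ λ× i ∣) ≈ sum e×
    energy-× = trans (proj₁ (proj₂ (relength length-eq v×)) ∣_∣)
      (sum-concat₄ ∣_∣ (λ i → 1# + s i) (λ i → 1# - s i) (λ i → s i - 1#) (λ i → - (1# + s i)))

    energy-⊗ : sum (λ i → ∣ λ⊗ i ∣) ≈ sum e⊗
    energy-⊗ = trans (proj₁ (proj₂ (relength length-eq v⊗)) ∣_∣)
      (trans (sum-concat₄ ∣_∣ s (λ i → - s i) s (λ i → - s i))
        (sum-cong-≋ λ i → +-cong (abs i) (+-cong (trans (∣∣-neg _) (abs i)) (+-cong (abs i) (trans (∣∣-neg _) (abs i))))))
      where
      abs : ∀ i → ∣ s i ∣ ≈ s i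
      abs i = ∣∣-nonneg (<⇒≤ (0<s i))

    equienergetic : 1# ≤ μ last → Equienergetic S×K₂ S⊗K₂
    equienergetic 1≤μₙ = sum (λ i → ∣ λ× i ∣) , (λ× , λ×-spectrum , refl) , (λ⊗ , λ⊗-spectrum ,
      trans energy-× (trans (sum-cong-≋ same) (sym energy-⊗)))
      where
      1≤s : ∀ i → 1# ≤ s i
      1≤s i = square-cancel-≤ (<⇒≤ (0<s i)) (≤-resp (sym (*-identityˡ 1#)) (sym (s²≈μ i)) (≤-trans 1≤μₙ (μₙ≤μ i)))
      same : ∀ i → e× i ≈ e⊗ i
      same i = begin
        e× i ≈⟨ +-cong plus (+-cong (trans (∣∣-cong (solve 1 (λ s → :1 :- s := :- (s :- :1)) refl (s i))) (trans (∣∣-neg _) minus)) (+-cong minus (trans (∣∣-neg _) plus))) ⟩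
        (1# + s i) + ((s i - 1#) + ((s i - 1#) + (1# + s i))) ≈⟨ solve 1 (λ s → (:1 :+ s) :+ ((s :- :1) :+ ((s :- :1) :+ (:1 :+ s))) := s :+ (s :+ (s :+ s))) refl (s i) ⟩
        e⊗ i ∎
        where
        plus : ∣ 1# + s i ∣ ≈ 1# + s i
        plus = ∣∣-nonneg (+-nonneg (<⇒≤ 0<1) (<⇒≤ (0<s i)))
        minus : ∣ s i - 1# ∣ ≈ s i - 1#
        minus = ∣∣-nonneg (diff-nonneg (1≤s i))

    -- Each absolute value is at least its argument with either sign, and the signs +, -, +, - give
    -- (1 + s) - (1 - s) + (s - 1) + (1 + s) = 4s, wherever s lies relative to 1.
    e⊗≤e× : ∀ i → e⊗ i ≤ e× i
    e⊗≤e× i = ≤-resp (solve 1 (λ s → (:1 :+ s) :+ (:- (:1 :- s) :+ ((s :- :1) :+ :- :- (:1 :+ s))) := s :+ (s :+ (s :+ s))) refl (s i)) refl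
      (+-mono-≤ (≤-∣∣ _) (+-mono-≤ (-≤-∣∣ _) (+-mono-≤ (≤-∣∣ _) (-≤-∣∣ _))))

    -- With the signs +, +, +, - the lower bound is 2 + 2s, which exceeds 4s by 2(1 - s).
    e⊗<e× : ∀ i → s i < 1# → e⊗ i < e× i
    e⊗<e× i s<1 = <-≤-trans
      (pos-diff (<-respʳ (solve 1 (λ s → (:1 :- s) :+ (:1 :- s) := ((:1 :+ s) :+ ((:1 :- s) :+ ((s :- :1) :+ :- :- (:1 :+ s)))) :- (s :+ (s :+ (s :+ s)))) refl (s i))
        (+-pos-nonneg (diff-pos s<1) (<⇒≤ (diff-pos s<1)))))
      (+-mono-≤ (≤-∣∣ _) (+-mono-≤ (≤-∣∣ _) (+-mono-≤ (≤-∣∣ _) (-≤-∣∣ _))))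

    -- The two given energies refer to arbitrary lists `a` and `b`, so they are first transferred to
    -- the explicit spectra. If μₙ < 1, the last summand is strictly larger for the Cartesian
    -- product and no summand is smaller.
    equienergetic⇒1≤μₙ : Equienergetic S×K₂ S⊗K₂ → 1# ≤ μ last
    equienergetic⇒1≤μₙ (E , (a , a-spectrum , E≈a) , (b , b-spectrum , E≈b)) μₙ<1 =
      <-irrefl energies-equal (sum-mono-< e⊗≤e× last (e⊗<e× last sₙ<1))
      where
      sₙ<1 : s last < 1#
      sₙ<1 = square-cancel-< (0<s last) 0<1 (<-resp (sym (s²≈μ last)) (sym (*-identityˡ 1#)) μₙ<1)
      energies-equal : sum e⊗ ≈ sum e×
      energies-equal = begin
        sum e⊗                    ≈⟨ energy-⊗ ⟨
        sum (λ i → ∣ λ⊗ i ∣)      ≈⟨ same-roots⇒same-sum ∣_∣ ∣∣-cong λ⊗ b (λ x → trans (sym (λ⊗-spectrum x)) (b-spectrum x)) ⟩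
        sum (λ i → ∣ b i ∣)       ≈⟨ trans (sym E≈b) E≈a ⟩
        sum (λ i → ∣ a i ∣)       ≈⟨ same-roots⇒same-sum ∣_∣ ∣∣-cong a λ× (λ x → trans (sym (a-spectrum x)) (λ×-spectrum x)) ⟩
        sum (λ i → ∣ λ× i ∣)      ≈⟨ energy-× ⟩
        sum e×                    ∎

    noncospectral-equienergetic⇔ : (Noncospectral S×K₂ S⊗K₂ × Equienergetic S×K₂ S⊗K₂) ⇔ (1# ≤ μ last)
    noncospectral-equienergetic⇔ = mk⇔ (equienergetic⇒1≤μₙ ∘ proj₂) (λ 1≤μₙ → noncospectral , equienergetic 1≤μₙ)

theorem4p10 : ∀ {c ℓ₁ ℓ₂} (ℝ : RealNumbers c ℓ₁ ℓ₂) →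
    let open RealNumbers ℝ
        open Spectral ℝ in
    ∀ (k : ℕ) (Γ : SignedGraph (suc k)) →
    Unicyclic Γ → Unbalanced Γ → 0 ℕ.< SignedGraph.size Γ →
    (ϑ : Signature Γ) → Compatible Γ ϑ →
    (μ : Vector Carrier (suc k)) → IsSpectrum (laplacian Γ) μ →
    (∀ {i j} → i Fin.≤ j → μ j ≤ μ i) → 0# < μ (fromℕ k) →
    (Noncospectral (subdivision Γ ϑ ×ˢ K₂) (subdivision Γ ϑ ⊗ K₂)
      × Equienergetic (subdivision Γ ϑ ×ˢ K₂) (subdivision Γ ϑ ⊗ K₂))
    ⇔ (1# ≤ μ (fromℕ k))
theorem4p10 ℝ k Γ unicyclic _ _ ϑ compatible μ μ-spectrum antitone 0<μₙ =
  Energy.noncospectral-equienergetic⇔ ℝ Γ unicyclic ϑ compatible μ μ-spectrum antitone 0<μₙ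
    (λ i → proj₁ (root i)) (λ i → proj₁ (proj₂ (root i))) (λ i → proj₂ (proj₂ (root i)))
  where
  open RealNumbers ℝ
  open OrderedField ℝ
  root : ∀ i → ∃ λ x → 0# < x × x * x ≈ μ i
  root i = SquareRoot.square-root ℝ (μ i) (<-≤-trans 0<μₙ (antitone (Fin.≤fromℕ i)))
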